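{- Let $a,b,n$ be positive integers with $a>b$, and define \[ T_1(an,bn,q)'=\sum_{k=an-bn-\lfloor n/2\rfloor}^{an-bn}(-q)^k\begin{bmatrix} an\\ k\end{bmatrix}_{q^2}\begin{bmatrix} 2an-2k\\ an-bn-k\end{bmatrix}. \] Then \[ T_1(an,bn,q)'\equiv(-q)^{an-bn}\begin{bmatrix} an\\ bn\end{bmatrix}_{q^2}\Big\{1-2(a-b)\big(1-\vartheta_n(q)\big)\Big\}\pmod{\Phi_n(q)^2}, \] where \[ \vartheta_n(q)=\begin{cases} (-1)^m(1+q^{2m})q^{m(3m-5)/2}, &\text{if } n=3m,\\ (-1)^mq^{m(3m+1)/2}, &\text{if } n=3m+1,\\ (-1)^{m+1}q^{(m-1)(3m+2)/2}, &\text{if } n=3m+2.\end{cases} \]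
   Context: For integers $n,m$, the $q$-binomial coefficient is $\begin{bmatrix} n\\ m\end{bmatrix}_q=\begin{bmatrix} n\\ m\end{bmatrix}=\frac{(1-q^n)(1-q^{n-1})\cdots(1-q^{n-m+1})}{(1-q)(1-q^2)\cdots(1-q^m)}$ if $0\le m\le n$, and $0$ otherwise; $\begin{bmatrix} n\\ m\end{bmatrix}_{q^2}$ is the same with $q$ replaced by $q^2$. $\Phi_n(q)$ denotes the $n$-th cyclotomic polynomial. $\lfloor x\rfloor$ is the integer part of $x$. For rational functions (including Laurent polynomials) $A(q),B(q)$, $A\equiv B\pmod{\Phi_n(q)^2}$ means $A-B=\Phi_n(q)^2P(q)/Q(q)$ with $P,Q\in\mathbb{Z}[q]$ and $Q$ coprime to $\Phi_n(q)$. -}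

module Defs where

open import Data.Nat as ℕ using (ℕ; zero; suc; _∸_; _≤ᵇ_)
open import Data.Nat.Divisibility using (_∣?_)
open import Data.Nat.DivMod as NDM using ()
open import Data.Integer as ℤ using (ℤ; +_; -[1+_])
open import Data.Integer.DivMod using (_/ℕ_)
open import Data.List using (List; []; _∷_; [_]; map; foldr; reverse; length; drop; replicate; _++_; upTo)
open import Data.Product using (_×_; _,_; ∃; ∃-syntax)
open import Data.Sum using (_⊎_)
open import Data.Bool using (Bool; true; false; if_then_else_)
open import Relation.Nullary using (does)
open import Relation.Binary.PropositionalEquality using (_≡_)

-- Polynomials in ℤ[q]: coefficient lists, lowest degree first.
-- Trailing zeros are allowed; equality is coefficientwise (_≈P_).

Poly : Set
Poly = List ℤ

coeff : Poly → ℕ → ℤ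
coeff []      _       = + 0
coeff (a ∷ p) zero    = a
coeff (a ∷ p) (suc i) = coeff p i

infix 4 _≈P_
_≈P_ : Poly → Poly → Set
p ≈P r = ∀ i → coeff p i ≡ coeff r i

infixl 6 _+P_ _-P_
infixl 7 _*P_

_+P_ : Poly → Poly → Poly
[]      +P r       = r
(a ∷ p) +P []      = a ∷ p
(a ∷ p) +P (b ∷ r) = (a ℤ.+ b) ∷ (p +P r)

negP : Poly → Poly
negP = map (λ x → ℤ.- x)

_-P_ : Poly → Poly → Poly
p -P r = p +P negP r

scaleP : ℤ → Poly → Poly
scaleP c = map (c ℤ.*_)

_*P_ : Poly → Poly → Poly
[]      *P r = []
(a ∷ p) *P r = scaleP a r +P (+ 0 ∷ (p *P r))

oneP : Poly
oneP = [ + 1 ]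

X : Poly
X = + 0 ∷ + 1 ∷ []

powP : Poly → ℕ → Poly
powP p zero    = oneP
powP p (suc k) = p *P powP p k

prodP : List Poly → Poly
prodP = foldr _*P_ oneP

sumP : List Poly → Poly
sumP = foldr _+P_ []

substq² : Poly → Poly
substq² []      = []
substq² (a ∷ p) = a ∷ + 0 ∷ substq² p

-- Exact division by a monic polynomial (polynomial long division,
-- quotient only).  Only used with monic divisors that divide exactly.

isZeroℤ : ℤ → Bool
isZeroℤ (+ zero) = true
isZeroℤ _        = false

dropZeros : List ℤ → List ℤ
dropZeros []      = []
dropZeros (a ∷ p) = if isZeroℤ a then dropZeros p else a ∷ p

highFirst : Poly → List ℤ
highFirst p = dropZeros (reverse p)

private
  subPrefix : ℤ → List ℤ → List ℤ → List ℤ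
  subPrefix c []       r        = r
  subPrefix c (d ∷ ds) []       = []
  subPrefix c (d ∷ ds) (r ∷ rs) = (r ℤ.- c ℤ.* d) ∷ subPrefix c ds rs

  longDiv : ℕ → List ℤ → List ℤ → List ℤ
  longDiv zero    ds _         = []
  longDiv (suc k) ds []        = []
  longDiv (suc k) ds (c ∷ rs)  = c ∷ longDiv k ds (subPrefix c ds rs)

divMonic : Poly → Poly → Poly
divMonic p d =
  let p' = highFirst p
      ds = drop 1 (highFirst d)
  in reverse (longDiv (length p' ∸ length ds) ds p')

-- q-binomial coefficient  [n m]_q
--   = (1-q^n)...(1-q^{n-m+1}) / ((1-q)...(1-q^m))   if m ≤ n, 0 otherwise.
-- Numerator and denominator both have m factors, so the signs cancel and
-- we divide ∏(q^{n-i} - 1) by the monic ∏(q^i - 1).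

qbin : ℕ → ℕ → Poly
qbin n m =
  if m ≤ᵇ n
  then divMonic (prodP (map (λ i → powP X (n ∸ i) -P oneP) (upTo m)))
                (prodP (map (λ i → powP X (suc i) -P oneP) (upTo m)))
  else []

qbin2 : ℕ → ℕ → Poly
qbin2 n m = substq² (qbin n m)

-- Cyclotomic polynomials, defined by  q^n - 1 = ∏_{d ∣ n} Φ_d(q).
-- cycs n = [(n , Φ_n) , (n-1 , Φ_{n-1}) , … , (1 , Φ_1)]

cycs : ℕ → List (ℕ × Poly)
cycs zero    = []
cycs (suc n) =
  (suc n , divMonic (powP X (suc n) -P oneP)
                    (prodP (divisorsPart (cycs n))))
  ∷ cycs n
  where
  divisorsPart : List (ℕ × Poly) → List Poly
  divisorsPart []             = []
  divisorsPart ((d , f) ∷ xs) =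
    if does (d ∣? suc n) then f ∷ divisorsPart xs else divisorsPart xs

Φ : ℕ → Poly
Φ n with cycs n
... | []          = oneP   -- n = 0, never used
... | (_ , f) ∷ _ = f

-- Laurent polynomials: (p , s) represents p(q) · q^{-s}.

LPoly : Set
LPoly = Poly × ℕ

toL : Poly → LPoly
toL p = p , 0

infixl 6 _+L_ _-L_
infixl 7 _*L_
infix 4 _≈L_

_+L_ : LPoly → LPoly → LPoly
(p , s) +L (r , t) = (p *P powP X t +P r *P powP X s) , (s ℕ.+ t)

negL : LPoly → LPoly
negL (p , s) = negP p , s

_-L_ : LPoly → LPoly → LPoly
A -L B = A +L negL B

_*L_ : LPoly → LPoly → LPoly
(p , s) *L (r , t) = (p *P r) , (s ℕ.+ t)

_≈L_ : LPoly → LPoly → Set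
(p , s) ≈L (r , t) = p *P powP X t ≈P r *P powP X s

qpowZ : ℤ → LPoly
qpowZ (+ k)     = powP X k , 0
qpowZ -[1+ k ]  = oneP , suc k

constL : ℤ → LPoly
constL c = [ c ] , 0

oneL : LPoly
oneL = constL (+ 1)

sgn : ℕ → ℤ
sgn zero    = + 1
sgn (suc m) = ℤ.- sgn m

infix 4 _∣P_
_∣P_ : Poly → Poly → Set
D ∣P F = ∃[ E ] (D *P E ≈P F)

IsUnitP : Poly → Set
IsUnitP D = (D ≈P [ + 1 ]) ⊎ (D ≈P [ ℤ.- (+ 1) ])

CoprimeP : Poly → Poly → Set
CoprimeP Q M = ∀ D → D ∣P Q → D ∣P M → IsUnitP D

-- A ≡ B (mod M):  A - B = M · P / Q  with P, Q ∈ ℤ[q], Q coprime to M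
infix 4 _≡_modP_
_≡_modP_ : LPoly → LPoly → Poly → Set
A ≡ B modP M = ∃[ P ] ∃[ Q ] (CoprimeP Q M × (toL Q *L (A -L B) ≈L toL (M *P P)))

negqPow : ℕ → Poly
negqPow k = powP (negP X) k

T1' : ℕ → ℕ → ℕ → Poly
T1' a b n =
  let an  = a ℕ.* n
      bn  = b ℕ.* n
      hi  = an ∸ bn
      lo  = hi ∸ (n NDM./ 2)
      term : ℕ → Poly
      term k = negqPow k *P qbin2 an k *P qbin (2 ℕ.* an ∸ 2 ℕ.* k) (hi ∸ k)
  in sumP (map (λ j → term (lo ℕ.+ j)) (upTo (suc (hi ∸ lo))))

-- ϑ_n(q), with the exponents computed in ℤ (they may be -1)
ϑ : ℕ → LPoly
ϑ n with n NDM.% 3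
... | 0 = let m = n NDM./ 3 in
          constL (sgn m) *L toL (oneP +P powP X (2 ℕ.* m))
            *L qpowZ ((+ m ℤ.* (+ (3 ℕ.* m) ℤ.- + 5)) /ℕ 2)
... | 1 = let m = n NDM./ 3 in
          constL (sgn m) *L qpowZ ((+ m ℤ.* + (3 ℕ.* m ℕ.+ 1)) /ℕ 2)
... | _ = let m = n NDM./ 3 in
          constL (ℤ.- sgn m)
            *L qpowZ (((+ m ℤ.- + 1) ℤ.* + (3 ℕ.* m ℕ.+ 2)) /ℕ 2)

{-# OPTIONS --safe #-}
-- Put h = (a-b)n and let t_j be the product of the two q-binomials in the term k = h - j. Absorption
-- identities turn t_j U_j, where U_j = ∏_{i ≤ j} (q^i - 1) ∏_{i < j} (q^{2(bn+i)} - 1), into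
-- [an, bn]_{q²} (q^{2h} - 1) times 2(j-1) factors q^e - 1. Modulo q^n - 1 these factors can be paired
-- up and reduced by q^n = 1, while q^{2h} - 1 = (q^n - 1) G with G ≡ 2(a-b). As 2j ≤ n, the product U_j
-- is coprime to Φ_n, whence for j ≥ 1
--   t_j ≡ 2(a-b) [an, bn]_{q²} q^{C(j,2)} (q^j [n-j, j] + [n-j-1, j-1])  (mod Φ_n²).
-- Summation over j leads to the Rogers-Schur sums S_n = Σ_j (-1)^j q^{C(j,2)} [n-j, j] through
-- ϑ_n = S_n - q^{-1} S_{n-2}. The two q-Pascal rules give S_n = S_{n-1} - q^{n-2} S_{n-3} + q^{n-3} S_{n-4},
-- so each S_n is 0 or plus or minus a power of q. That Φ_n is an exact quotient follows by strong
-- induction: an identity (q^k - 1) u + Φ_d v = m with an integer m > 0, valid for d ∤ k, makes the Φ_d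
-- pairwise coprime over ℚ, and they are monic.
module Submission where

open import Defs
open import Algebra.Bundles using (CommutativeRing)
import Algebra.Properties.Ring as RingProperties
import Algebra.Properties.Semiring.Exp as Exp
import Algebra.Solver.Ring
open import Algebra.Solver.Ring.AlmostCommutativeRing using (fromCommutativeRing; _-Raw-AlmostCommutative⟶_)
open import Data.Bool using (if_then_else_)
open import Data.Bool.Properties using (T-≡)
open import Data.Empty using (⊥-elim)
open import Data.Integer as ℤ using (ℤ; +_; -[1+_])
open import Data.Integer.DivMod using (_/ℕ_)
import Data.Integer.Properties as ℤₚ
import Data.Integer.Tactic.RingSolver as ℤ-Solver
open import Data.List using (List; []; _∷_; _++_; reverse; length; drop; foldl; map; upTo; applyUpTo)
import Data.List.Properties as Listₚ
open import Data.Maybe using (Maybe; just; nothing)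
open import Data.Nat as ℕ using (ℕ; zero; suc; _∸_)
open import Data.Nat.Divisibility as ℕ∣ using (_∣?_; divides)
import Data.Nat.DivMod as ℕ/
open import Data.Nat.GCD using (gcd; gcd[m,n]∣m; gcd[m,n]∣n; gcd-GCD; module Bézout)
open import Data.Nat.Induction using (<-rec)
import Data.Nat.Properties as ℕₚ
import Data.Nat.Tactic.RingSolver as ℕ-Solver
open import Data.Product using (_×_; _,_; proj₁; proj₂; ∃-syntax)
open import Data.Sum using (_⊎_; inj₁; inj₂; [_,_]′)
open import Function using (_∘_; flip)
open import Function.Bundles using (Equivalence)
open import Level using (_⊔_)
open import Relation.Binary.Bundles using (Setoid)
open import Relation.Binary.Definitions using (tri<; tri≈; tri>)
import Relation.Binary.PropositionalEquality as ≡
open ≡ using (_≡_; _≢_)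
import Relation.Binary.Reasoning.Setoid as SetoidReasoning
open import Relation.Nullary using (¬_; yes; no)
open import Relation.Nullary.Decidable using (dec-true; dec-false)

-- Working to second order costs little: one factor q^n - 1 is explicit on both sides, in q^{2h} - 1
-- for t_j U_j and in a product formula for q^j [n-j, j] + [n-j-1, j-1]. Only the cofactors have to
-- be compared, and only modulo q^n - 1. The second product of U_j has to stop before i = j: for 2j
-- = n the factor q^{2(bn+j)} - 1 is divisible by Φ_n and could not be cancelled. The term j = 0 is
-- the q-binomial coefficient itself, without the factor 2(a-b). The identities are therefore proved
-- for polynomials after multiplication by q, and q ends up as the denominator of the congruence,
-- being coprime to Φ_n². Cancelling U_j leaves a positive integer as well, since the Bézout
-- identities reach an integer and not 1. Division with remainder by the monic Φ_n² removes it, so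
-- Gauss's lemma on contents is avoided.

-- Integer coefficients and congruences in a commutative ring

module IntegerSolver {c ℓ} (R : CommutativeRing c ℓ) where
  open CommutativeRing R
  open RingProperties ring
  open SetoidReasoning setoid

  -- The separate case 1 makes `con (+ 1)` denote `1#` itself and not `1# + 0#`, so that solver
  -- equations match goals containing `1#` definitionally.
  natural : ℕ → Carrier
  natural 0             = 0#
  natural 1             = 1#
  natural (suc (suc n)) = 1# + natural (suc n)

  natural-suc : ∀ n → natural (suc n) ≈ 1# + natural n
  natural-suc zero    = sym (+-identityʳ 1#)
  natural-suc (suc n) = refl

  natural-+ : ∀ m n → natural (m ℕ.+ n) ≈ natural m + natural n
  natural-+ zero    n = sym (+-identityˡ _)
  natural-+ (suc m) n = begin
    natural (suc (m ℕ.+ n))      ≈⟨ natural-suc (m ℕ.+ n) ⟩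
    1# + natural (m ℕ.+ n)       ≈⟨ +-congˡ (natural-+ m n) ⟩
    1# + (natural m + natural n) ≈⟨ +-assoc _ _ _ ⟨
    1# + natural m + natural n   ≈⟨ +-congʳ (natural-suc m) ⟨
    natural (suc m) + natural n  ∎

  natural-* : ∀ m n → natural (m ℕ.* n) ≈ natural m * natural n
  natural-* zero    n = sym (zeroˡ _)
  natural-* (suc m) n = begin
    natural (n ℕ.+ m ℕ.* n)                 ≈⟨ natural-+ n (m ℕ.* n) ⟩
    natural n + natural (m ℕ.* n)           ≈⟨ +-cong (sym (*-identityˡ _)) (natural-* m n) ⟩
    1# * natural n + natural m * natural n  ≈⟨ distribʳ _ _ _ ⟨
    (1# + natural m) * natural n            ≈⟨ *-congʳ (natural-suc m) ⟨
    natural (suc m) * natural n             ∎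

  integer : ℤ → Carrier
  integer (+ n)    = natural n
  integer -[1+ n ] = - natural (suc n)

  integer-⊖ : ∀ m n → integer (m ℤ.⊖ n) ≈ natural m - natural n
  integer-⊖ m       zero    = begin
    natural m       ≈⟨ +-identityʳ _ ⟨
    natural m + 0#  ≈⟨ +-congˡ -0#≈0# ⟨
    natural m - 0#  ∎
  integer-⊖ zero    (suc n) = sym (+-identityˡ _)
  integer-⊖ (suc m) (suc n) = begin
    integer (suc m ℤ.⊖ suc n)              ≡⟨ ≡.cong integer (ℤₚ.[1+m]⊖[1+n]≡m⊖n m n) ⟩
    integer (m ℤ.⊖ n)                      ≈⟨ integer-⊖ m n ⟩
    natural m - natural n                  ≈⟨ +-congʳ (sym (trans (+-congʳ (-‿inverseˡ 1#)) (+-identityˡ _))) ⟩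
    (- 1# + 1#) + natural m - natural n    ≈⟨ +-congʳ (+-assoc _ _ _) ⟩
    (- 1# + (1# + natural m)) - natural n  ≈⟨ +-congʳ (+-comm _ _) ⟩
    (1# + natural m) + - 1# - natural n    ≈⟨ +-assoc _ _ _ ⟩
    (1# + natural m) + (- 1# - natural n)  ≈⟨ +-congˡ (-‿+-comm _ _) ⟩
    (1# + natural m) - (1# + natural n)    ≈⟨ +-cong (natural-suc m) (-‿cong (natural-suc n)) ⟨
    natural (suc m) - natural (suc n)      ∎

  integer-neg : ∀ i → integer (ℤ.- i) ≈ - integer i
  integer-neg (+ zero)   = sym -0#≈0#
  integer-neg (+ suc n)  = refl
  integer-neg -[1+ n ]   = sym (-‿involutive _)

  integer-+ : ∀ i j → integer (i ℤ.+ j) ≈ integer i + integer j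
  integer-+ (+ m)    (+ n)    = natural-+ m n
  integer-+ (+ m)    -[1+ n ] = integer-⊖ m (suc n)
  integer-+ -[1+ m ] (+ n)    = trans (integer-⊖ n (suc m)) (+-comm _ _)
  integer-+ -[1+ m ] -[1+ n ] = begin
    - natural (suc (suc (m ℕ.+ n)))        ≡⟨ ≡.cong (λ k → - natural (suc k)) (ℕₚ.+-suc m n) ⟨
    - natural (suc m ℕ.+ suc n)            ≈⟨ -‿cong (natural-+ (suc m) (suc n)) ⟩
    - (natural (suc m) + natural (suc n))  ≈⟨ -‿+-comm _ _ ⟨
    - natural (suc m) - natural (suc n)    ∎

  natural-*-integer : ∀ m j → integer (+ m ℤ.* j) ≈ natural m * integer j
  natural-*-integer m (+ n) = begin
    integer (+ m ℤ.* + n)  ≡⟨ ≡.cong integer (ℤₚ.pos-* m n) ⟨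
    natural (m ℕ.* n)      ≈⟨ natural-* m n ⟩
    natural m * natural n  ∎
  natural-*-integer m -[1+ n ] = begin
    integer (+ m ℤ.* ℤ.- (+ suc n))    ≡⟨ ≡.cong integer (ℤₚ.neg-distribʳ-* (+ m) (+ suc n)) ⟨
    integer (ℤ.- (+ m ℤ.* + suc n))    ≈⟨ integer-neg (+ m ℤ.* + suc n) ⟩
    - integer (+ m ℤ.* + suc n)        ≈⟨ -‿cong (natural-*-integer m (+ suc n)) ⟩
    - (natural m * natural (suc n))    ≈⟨ -‿distribʳ-* _ _ ⟩
    natural m * - natural (suc n)      ∎

  integer-* : ∀ i j → integer (i ℤ.* j) ≈ integer i * integer j
  integer-* (+ m)    j = natural-*-integer m j
  integer-* -[1+ m ] j = begin
    integer (ℤ.- (+ suc m) ℤ.* j)    ≡⟨ ≡.cong integer (ℤₚ.neg-distribˡ-* (+ suc m) j) ⟨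
    integer (ℤ.- (+ suc m ℤ.* j))    ≈⟨ integer-neg (+ suc m ℤ.* j) ⟩
    - integer (+ suc m ℤ.* j)        ≈⟨ -‿cong (natural-*-integer (suc m) j) ⟩
    - (natural (suc m) * integer j)  ≈⟨ -‿distribˡ-* _ _ ⟩
    - natural (suc m) * integer j    ∎

  -- The solver compares coefficients in ℤ only, so it works in every commutative ring, also where
  -- equality cannot be decided, as in quotients.
  integer-morphism : CommutativeRing.rawRing ℤₚ.+-*-commutativeRing
                       -Raw-AlmostCommutative⟶ fromCommutativeRing R
  integer-morphism = record
    { ⟦_⟧    = integer
    ; +-homo = integer-+
    ; *-homo = integer-*
    ; -‿homo = integer-neg
    ; 0-homo = refl
    ; 1-homo = refl
    }

  private
    integer-≟ : ∀ i j → Maybe (integer i ≈ integer j)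
    integer-≟ i j with i ℤ.≟ j
    ... | yes p = just (reflexive (≡.cong integer p))
    ... | no  _ = nothing

  open Algebra.Solver.Ring (CommutativeRing.rawRing ℤₚ.+-*-commutativeRing)
         (fromCommutativeRing R) integer-morphism integer-≟ public
    using (solve; _:=_; _:+_; _:*_; _:-_; :-_; con)

module Quotient {c ℓ} (R : CommutativeRing c ℓ) (W : CommutativeRing.Carrier R) where
  open CommutativeRing R
  open SetoidReasoning setoid
  open IntegerSolver R

  infix 4 _~_
  -- A relation on the same carrier instead of a new type. Its proofs carry the multiplier of `W`,
  -- which in the end becomes the witness of the congruence to be shown.
  record _~_ (x y : Carrier) : Set (c ⊔ ℓ) where
    constructor congruent
    field
      factor   : Carrier
      equation : x ≈ y + W * factor

  ≈⇒~ : ∀ {x y} → x ≈ y → x ~ y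
  ≈⇒~ {x} {y} p = congruent 0# (trans p (solve 2 (λ y w → y := y :+ w :* con (+ 0)) refl y W))

  ~-sym : ∀ {x y} → x ~ y → y ~ x
  ~-sym {x} {y} (congruent k p) = congruent (- k) (begin
    y                      ≈⟨ solve 3 (λ y w k → y := y :+ w :* k :+ w :* (:- k)) refl y W k ⟩
    y + W * k + W * (- k)  ≈⟨ +-congʳ p ⟨
    x + W * (- k)          ∎)

  ~-trans : ∀ {x y z} → x ~ y → y ~ z → x ~ z
  ~-trans {x} {y} {z} (congruent k p) (congruent l r) = congruent (l + k) (begin
    x                    ≈⟨ p ⟩
    y + W * k            ≈⟨ +-congʳ r ⟩
    z + W * l + W * k    ≈⟨ solve 4 (λ z w k l → z :+ w :* l :+ w :* k := z :+ w :* (l :+ k)) refl z W k l ⟩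
    z + W * (l + k)      ∎)

  ~-+-cong : ∀ {x y u v} → x ~ y → u ~ v → x + u ~ y + v
  ~-+-cong {x} {y} {u} {v} (congruent k p) (congruent l r) = congruent (k + l)
    (trans (+-cong p r)
      (solve 5 (λ y v w k l → (y :+ w :* k) :+ (v :+ w :* l) := y :+ v :+ w :* (k :+ l)) refl y v W k l))

  ~-*-cong : ∀ {x y u v} → x ~ y → u ~ v → x * u ~ y * v
  ~-*-cong {x} {y} {u} {v} (congruent k p) (congruent l r) = congruent (y * l + k * v + k * W * l)
    (trans (*-cong p r)
      (solve 5 (λ y v w k l → (y :+ w :* k) :* (v :+ w :* l)
                   := y :* v :+ w :* (y :* l :+ k :* v :+ k :* w :* l)) refl y v W k l))

  ~-neg-cong : ∀ {x y} → x ~ y → - x ~ - y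
  ~-neg-cong {x} {y} (congruent k p) = congruent (- k)
    (trans (-‿cong p) (solve 3 (λ y w k → :- (y :+ w :* k) := :- y :+ w :* (:- k)) refl y W k))

  -- Allows an identity proved once for all commutative rings, such as `inverse-pair-product`, to be
  -- read modulo `W`.
  quotientRing : CommutativeRing c (c ⊔ ℓ)
  quotientRing = record
    { Carrier = Carrier ; _≈_ = _~_ ; _+_ = _+_ ; _*_ = _*_ ; -_ = -_ ; 0# = 0# ; 1# = 1#
    ; isCommutativeRing = record
      { isRing = record
        { +-isAbelianGroup = record
          { isGroup = record
            { isMonoid = record
              { isSemigroup = record
                { isMagma = record
                  { isEquivalence = record { refl = ≈⇒~ refl ; sym = ~-sym ; trans = ~-trans }
                  ; ∙-cong = ~-+-cong }
                ; assoc = λ x y z → ≈⇒~ (+-assoc x y z) }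
              ; identity = (λ x → ≈⇒~ (+-identityˡ x)) , λ x → ≈⇒~ (+-identityʳ x) }
            ; inverse = (λ x → ≈⇒~ (-‿inverseˡ x)) , λ x → ≈⇒~ (-‿inverseʳ x)
            ; ⁻¹-cong = ~-neg-cong }
          ; comm = λ x y → ≈⇒~ (+-comm x y) }
        ; *-cong = ~-*-cong
        ; *-assoc = λ x y z → ≈⇒~ (*-assoc x y z)
        ; *-identity = (λ x → ≈⇒~ (*-identityˡ x)) , λ x → ≈⇒~ (*-identityʳ x)
        ; distrib = (λ x y z → ≈⇒~ (distribˡ x y z)) , λ x y z → ≈⇒~ (distribʳ x y z) }
      ; *-comm = λ x y → ≈⇒~ (*-comm x y) } }

-- q-binomial coefficients

module QCalculus {c ℓ} (R : CommutativeRing c ℓ) where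
  open CommutativeRing R
  open SetoidReasoning setoid
  open IntegerSolver R
  open Exp semiring public

  [_^_-1] : Carrier → ℕ → Carrier
  [ q ^ n -1] = q ^ n - 1#

  -- Up to the sign (-1)^m this is the q-Pochhammer symbol (q^{k+1}; q)_m; with factors q^i - 1
  -- instead of 1 - q^i it is monic in q.
  rising : Carrier → ℕ → ℕ → Carrier
  rising q k zero    = 1#
  rising q k (suc m) = rising q k m * [ q ^ suc (k ℕ.+ m) -1]

  qfactorial : Carrier → ℕ → Carrier
  qfactorial q m = rising q 0 m

  -- gauss q k m is the q-binomial coefficient [k+m, m].
  gauss : Carrier → ℕ → ℕ → Carrier
  gauss q k       zero    = 1#
  gauss q zero    (suc m) = 1#
  gauss q (suc k) (suc m) = gauss q (suc k) m + q ^ suc m * gauss q k (suc m)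

  ^-≡ : ∀ q {m n} → m ≡ n → q ^ m ≈ q ^ n
  ^-≡ q p = reflexive (≡.cong (q ^_) p)

  square-^ : ∀ q n → (q * q) ^ n ≈ q ^ (n ℕ.+ n)
  square-^ q zero    = refl
  square-^ q (suc n) = begin
    q * q * (q * q) ^ n   ≈⟨ *-congˡ (square-^ q n) ⟩
    q * q * q ^ (n ℕ.+ n) ≈⟨ *-assoc _ _ _ ⟩
    q ^ suc (suc n ℕ.+ n) ≡⟨ ≡.cong (λ k → q ^ suc k) (ℕₚ.+-suc n n) ⟨
    q ^ (suc n ℕ.+ suc n) ∎

  private
    pow-split : ∀ q k m → q ^ suc (suc k ℕ.+ m) ≈ q ^ suc k * q ^ suc m
    pow-split q k m = trans (^-≡ q (≡.sym (ℕₚ.+-suc (suc k) m))) (^-homo-* q (suc k) (suc m))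

  module _ (q : Carrier) where
    rising-front : ∀ k m → rising q k (suc m) ≈ [ q ^ suc k -1] * rising q (suc k) m
    rising-front k zero = begin
      1# * [ q ^ suc (k ℕ.+ 0) -1]  ≡⟨ ≡.cong (λ j → 1# * [ q ^ suc j -1]) (ℕₚ.+-identityʳ k) ⟩
      1# * [ q ^ suc k -1]          ≈⟨ *-comm _ _ ⟩
      [ q ^ suc k -1] * 1#          ∎
    rising-front k (suc m) = begin
      rising q k (suc m) * [ q ^ suc (k ℕ.+ suc m) -1]
        ≈⟨ *-cong (rising-front k m) (reflexive (≡.cong (λ j → [ q ^ suc j -1]) (ℕₚ.+-suc k m))) ⟩
      [ q ^ suc k -1] * rising q (suc k) m * [ q ^ suc (suc k ℕ.+ m) -1]
        ≈⟨ *-assoc _ _ _ ⟩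
      [ q ^ suc k -1] * rising q (suc k) (suc m) ∎

    -- The two absorption rules need each other. After a Pascal step one summand carries the wrong
    -- factor; going down to `gauss q k m` by one rule and up again by the other exchanges q^{m+1} -
    -- 1 and q^{k+1} - 1.
    gauss-absorbʳ : ∀ k m → gauss q k (suc m) * [ q ^ suc m -1] ≈ [ q ^ suc (k ℕ.+ m) -1] * gauss q k m
    gauss-absorbˡ : ∀ k m → gauss q (suc k) m * [ q ^ suc k -1] ≈ [ q ^ suc (k ℕ.+ m) -1] * gauss q k m
    gauss-absorbʳ zero    zero    = *-comm _ _
    gauss-absorbʳ zero    (suc m) = *-comm _ _
    gauss-absorbʳ (suc k) m = begin
      (g₁ + Q * g₂) * (Q - 1#)         ≈⟨ solve 3 (λ a b x → (a :+ x :* b) :* (x :- con (+ 1))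
                                             := a :* (x :- con (+ 1)) :+ x :* (b :* (x :- con (+ 1)))) refl g₁ g₂ Q ⟩
      g₁ * (Q - 1#) + Q * (g₂ * (Q - 1#))  ≈⟨ +-congˡ (*-congˡ (trans (gauss-absorbʳ k m) (sym (gauss-absorbˡ k m)))) ⟩
      g₁ * (Q - 1#) + Q * (g₁ * (K - 1#))  ≈⟨ solve 3 (λ a x k → a :* (x :- con (+ 1)) :+ x :* (a :* (k :- con (+ 1)))
                                                := (k :* x :- con (+ 1)) :* a) refl g₁ Q K ⟩
      (K * Q - 1#) * g₁                    ≈⟨ *-congʳ (+-congʳ (pow-split q k m)) ⟨
      [ q ^ suc (suc k ℕ.+ m) -1] * g₁     ∎
      where
      g₁ = gauss q (suc k) m
      g₂ = gauss q k (suc m)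
      Q = q ^ suc m
      K = q ^ suc k
    gauss-absorbˡ k zero = begin
      1# * [ q ^ suc k -1]          ≡⟨ ≡.cong (λ j → 1# * [ q ^ suc j -1]) (≡.sym (ℕₚ.+-identityʳ k)) ⟩
      1# * [ q ^ suc (k ℕ.+ 0) -1]  ≈⟨ *-comm _ _ ⟩
      [ q ^ suc (k ℕ.+ 0) -1] * 1#  ≈⟨ *-congˡ (gauss-0 k) ⟨
      [ q ^ suc (k ℕ.+ 0) -1] * gauss q k 0 ∎
      where
      gauss-0 : ∀ k → gauss q k 0 ≈ 1#
      gauss-0 zero    = refl
      gauss-0 (suc k) = refl
    gauss-absorbˡ k (suc m) = begin
      (g₁ + Q * g₂) * (K - 1#)             ≈⟨ solve 4 (λ a b x k → (a :+ x :* b) :* (k :- con (+ 1))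
                                                := a :* (k :- con (+ 1)) :+ x :* b :* (k :- con (+ 1))) refl g₁ g₂ Q K ⟩
      g₁ * (K - 1#) + Q * g₂ * (K - 1#)    ≈⟨ +-congʳ (trans (gauss-absorbˡ k m) (sym (gauss-absorbʳ k m))) ⟩
      g₂ * (Q - 1#) + Q * g₂ * (K - 1#)    ≈⟨ solve 3 (λ b x k → b :* (x :- con (+ 1)) :+ x :* b :* (k :- con (+ 1))
                                                := (k :* x :- con (+ 1)) :* b) refl g₂ Q K ⟩
      (K * Q - 1#) * g₂                    ≈⟨ *-congʳ (+-congʳ (^-homo-* q (suc k) (suc m))) ⟨
      [ q ^ suc (k ℕ.+ suc m) -1] * g₂     ∎
      where
      g₁ = gauss q (suc k) m
      g₂ = gauss q k (suc m)
      Q = q ^ suc m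
      K = q ^ suc k

    gauss-shift : ∀ k m → gauss q (suc k) m * [ q ^ suc k -1] ≈ gauss q k (suc m) * [ q ^ suc m -1]
    gauss-shift k m = trans (gauss-absorbˡ k m) (sym (gauss-absorbʳ k m))

    gauss-rising : ∀ k m → gauss q k m * qfactorial q m ≈ rising q k m
    gauss-rising zero    zero = *-identityˡ _
    gauss-rising (suc k) zero = *-identityˡ _
    gauss-rising k (suc m) = begin
      g′ * (F * x)        ≈⟨ solve 3 (λ a b c → a :* (b :* c) := a :* c :* b) refl g′ F x ⟩
      g′ * x * F          ≈⟨ *-congʳ (gauss-absorbʳ k m) ⟩
      y * g * F           ≈⟨ *-assoc _ _ _ ⟩
      y * (g * F)         ≈⟨ *-congˡ (gauss-rising k m) ⟩
      y * rising q k m    ≈⟨ *-comm _ _ ⟩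
      rising q k m * y    ∎
      where
      g  = gauss q k m
      g′ = gauss q k (suc m)
      F  = qfactorial q m
      x  = [ q ^ suc m -1]
      y  = [ q ^ suc (k ℕ.+ m) -1]

    -- Iteration of `gauss-shift`: `l` units pass from the first index to the second, their sum
    -- being fixed. This brings the q²-binomial coefficient of every summand to the same [an, bn].
    gauss-shift-rising : ∀ k m l →
      gauss q (k ℕ.+ l) m * rising q k l ≈ gauss q k (m ℕ.+ l) * rising q m l
    gauss-shift-rising k m zero =
      reflexive (≡.cong₂ (λ i j → gauss q i j * 1#) (ℕₚ.+-identityʳ k) (≡.sym (ℕₚ.+-identityʳ m)))
    gauss-shift-rising k m (suc l) = begin
      gauss q (k ℕ.+ suc l) m * (P * x)       ≡⟨ ≡.cong (λ j → gauss q j m * (P * x)) (ℕₚ.+-suc k l) ⟩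
      g * (P * x)                             ≈⟨ solve 3 (λ a b c → a :* (b :* c) := a :* c :* b) refl g P x ⟩
      g * x * P                               ≈⟨ *-congʳ (gauss-shift (k ℕ.+ l) m) ⟩
      g′ * y * P                              ≈⟨ solve 3 (λ a b c → a :* b :* c := a :* c :* b) refl g′ y P ⟩
      g′ * P * y                              ≈⟨ *-congʳ (gauss-shift-rising k (suc m) l) ⟩
      g″ * rising q (suc m) l * y             ≈⟨ solve 3 (λ a b c → a :* b :* c := a :* (c :* b)) refl g″ (rising q (suc m) l) y ⟩
      g″ * (y * rising q (suc m) l)           ≈⟨ *-cong (reflexive (≡.cong (gauss q k) (≡.sym (ℕₚ.+-suc m l)))) (sym (rising-front m l)) ⟩
      gauss q k (m ℕ.+ suc l) * rising q m (suc l) ∎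
      where
      P  = rising q k l
      x  = [ q ^ suc (k ℕ.+ l) -1]
      y  = [ q ^ suc m -1]
      g  = gauss q (suc (k ℕ.+ l)) m
      g′ = gauss q (k ℕ.+ l) (suc m)
      g″ = gauss q k (suc m ℕ.+ l)

-- Congruences for the summands

triangle : ℕ → ℕ
triangle zero    = 0
triangle (suc j) = triangle j ℕ.+ j

module _ {c ℓ} (S : CommutativeRing c ℓ) where
  open CommutativeRing S
  open SetoidReasoning setoid
  open IntegerSolver S

  -- Since v - 1 = -v (u - 1) and s - 1 = -s (w - 1), the signs cancel and the product is v s (u -
  -- 1)(w - 1), where v s = ρ u v = ρ.
  inverse-pair-product : ∀ {u v s w ρ} → u * v ≈ 1# → s * w ≈ 1# → ρ * u ≈ s →
    (v - 1#) * (s - 1#) ≈ ρ * ((u - 1#) * (w - 1#))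
  inverse-pair-product {u} {v} {s} {w} {ρ} uv sw ρu = begin
    (v - 1#) * (s - 1#)      ≈⟨ solve 2 (λ v s → (v :- con (+ 1)) :* (s :- con (+ 1)) := v :* s :- v :- s :+ con (+ 1)) refl v s ⟩
    v * s - v - s + 1#       ≈⟨ +-congʳ (+-congʳ (+-congʳ vs≈ρ)) ⟩
    ρ - v - s + 1#           ≈⟨ solve 3 (λ ρ v s → ρ :- v :- s :+ con (+ 1) := con (+ 1) :- s :- v :+ ρ) refl ρ v s ⟩
    1# - s - v + ρ           ≈⟨ +-congʳ (+-cong (+-congʳ sw) (-‿cong ρw≈v)) ⟨
    s * w - s - ρ * w + ρ    ≈⟨ +-congʳ (+-congʳ (+-cong (*-congʳ ρu) (-‿cong ρu))) ⟨
    ρ * u * w - ρ * u - ρ * w + ρ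
      ≈⟨ solve 3 (λ ρ u w → ρ :* u :* w :- ρ :* u :- ρ :* w :+ ρ := ρ :* ((u :- con (+ 1)) :* (w :- con (+ 1)))) refl ρ u w ⟩
    ρ * ((u - 1#) * (w - 1#)) ∎
    where
    vs≈ρ : v * s ≈ ρ
    vs≈ρ = begin
      v * s        ≈⟨ *-congˡ ρu ⟨
      v * (ρ * u)  ≈⟨ solve 3 (λ v ρ u → v :* (ρ :* u) := ρ :* (u :* v)) refl v ρ u ⟩
      ρ * (u * v)  ≈⟨ *-congˡ uv ⟩
      ρ * 1#       ≈⟨ *-identityʳ ρ ⟩
      ρ            ∎
    ρw≈v : ρ * w ≈ v
    ρw≈v = begin
      ρ * w              ≈⟨ *-identityʳ _ ⟨
      ρ * w * 1#         ≈⟨ *-congˡ uv ⟨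
      ρ * w * (u * v)    ≈⟨ solve 4 (λ ρ w u v → ρ :* w :* (u :* v) := ρ :* u :* w :* v) refl ρ w u v ⟩
      ρ * u * w * v      ≈⟨ *-congʳ (trans (*-congʳ ρu) sw) ⟩
      1# * v             ≈⟨ *-identityˡ v ⟩
      v                  ∎

module Supercongruence {c ℓ} (R : CommutativeRing c ℓ) (q : CommutativeRing.Carrier R) (n : ℕ) where
  open CommutativeRing R
  open SetoidReasoning setoid
  open IntegerSolver R
  open QCalculus R

  W : Carrier
  W = [ q ^ n -1]

  open Quotient R W

  -- `G` is the geometric sum of the powers q^{in} with i < m; each of its `m` terms is 1 modulo
  -- `W`.
  bracket-multiple : ∀ m → ∃[ G ] (([ q ^ (m ℕ.* n) -1] ≈ W * G) × (G ~ natural m))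
  bracket-multiple zero    = 0# , trans (-‿inverseʳ 1#) (sym (zeroʳ W)) , ≈⇒~ refl
  bracket-multiple (suc m) with bracket-multiple m
  ... | G , e , G~m = G * q ^ n + 1# , equation , congruence
    where
    equation : [ q ^ (n ℕ.+ m ℕ.* n) -1] ≈ W * (G * q ^ n + 1#)
    equation = begin
      q ^ (n ℕ.+ m ℕ.* n) - 1#      ≈⟨ +-congʳ (^-homo-* q n (m ℕ.* n)) ⟩
      Q * q ^ (m ℕ.* n) - 1#        ≈⟨ solve 2 (λ x y → x :* y :- con (+ 1) := (y :- con (+ 1)) :* x :+ (x :- con (+ 1))) refl Q (q ^ (m ℕ.* n)) ⟩
      (q ^ (m ℕ.* n) - 1#) * Q + W  ≈⟨ +-congʳ (*-congʳ e) ⟩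
      W * G * Q + W                 ≈⟨ solve 3 (λ w g x → w :* g :* x :+ w := w :* (g :* x :+ con (+ 1))) refl W G Q ⟩
      W * (G * Q + 1#)              ∎
      where Q = q ^ n
    Q~1 : q ^ n ~ 1#
    Q~1 = congruent 1# (solve 1 (λ x → x := con (+ 1) :+ (x :- con (+ 1)) :* con (+ 1)) refl (q ^ n))
    congruence : G * q ^ n + 1# ~ natural (suc m)
    congruence = ~-trans (~-+-cong (~-trans (~-*-cong G~m Q~1) (≈⇒~ (*-identityʳ _))) (≈⇒~ refl))
                   (~-trans (≈⇒~ (+-comm _ _)) (≈⇒~ (sym (natural-suc m))))

  geometric : ∀ m → Carrier
  geometric m = proj₁ (bracket-multiple m)

  ^~1 : ∀ m → q ^ (m ℕ.* n) ~ 1#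
  ^~1 m = congruent (geometric m) (begin
    q ^ (m ℕ.* n)            ≈⟨ solve 1 (λ x → x := con (+ 1) :+ (x :- con (+ 1))) refl _ ⟩
    1# + (q ^ (m ℕ.* n) - 1#) ≈⟨ +-congˡ (proj₁ (proj₂ (bracket-multiple m))) ⟩
    1# + W * geometric m      ∎)

  Q : Carrier
  Q = q * q

  square-bracket : ∀ m → [ Q ^ m -1] ≈ [ q ^ (m ℕ.+ m) -1]
  square-bracket m = +-congʳ (square-^ q m)

  Q^~1 : ∀ m → Q ^ (m ℕ.* n) ~ 1#
  Q^~1 m = ~-trans (≈⇒~ (trans (square-^ q (m ℕ.* n)) (^-≡ q (≡.sym (ℕₚ.*-distribʳ-+ n m m))))) (^~1 (m ℕ.+ m))

  module _ (b c : ℕ) where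
    B h : ℕ
    B = b ℕ.* n
    h = c ℕ.* n

    private
      -- The sum d + (d+1) + ... + (d+l-1) of the exponents of ρ that the pairing collects.
      exponent : ℕ → ℕ → ℕ
      exponent zero    d = 0
      exponent (suc l) d = exponent l (suc d) ℕ.+ d

      exponent-closed : ∀ l d → exponent l d ≡ triangle l ℕ.+ l ℕ.* d
      exponent-closed zero    d = ≡.refl
      exponent-closed (suc l) d rewrite exponent-closed l (suc d) = lemma (triangle l) l d
        where
        lemma : ∀ t l d → (t ℕ.+ l ℕ.* suc d) ℕ.+ d ≡ t ℕ.+ l ℕ.+ (d ℕ.+ l ℕ.* d)
        lemma = ℕ-Solver.solve-∀

    -- By `inverse-pair-product` the first factor of one product is paired with the last factor of
    -- the other. In what remains `l` is smaller and `d`, `m`, `r` are larger by one, which respects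
    -- both equations; hence the general offset `d`, equal to 1 in the application.
    rising-congruence : ∀ l d m r → m ℕ.+ suc l ≡ h → suc (l ℕ.+ l ℕ.+ d ℕ.+ r) ≡ n →
      rising Q m l * rising q (B ℕ.+ B ℕ.+ (l ℕ.+ d)) l
        ~ q ^ exponent l d * (rising Q B l * rising q r l)
    rising-congruence zero    d m r m≡ n≡ = ≈⇒~ (sym (*-identityˡ _))
    rising-congruence (suc l) d m r m≡ n≡ =
      ~-trans (≈⇒~ expand) (~-trans (~-*-cong induction pair) (≈⇒~ collect))
      where
      k = B ℕ.+ B ℕ.+ (suc l ℕ.+ d)
      u = Q ^ suc (B ℕ.+ l)
      v = Q ^ suc m
      s = q ^ suc (k ℕ.+ l)
      w = q ^ suc r
      ρ = q ^ d
      A₁ = rising Q (suc m) l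
      A₂ = rising q k l
      A₃ = rising Q B l
      A₄ = rising q (suc r) l
      induction : A₁ * A₂ ~ q ^ exponent l (suc d) * (A₃ * A₄)
      induction = ≡.subst (λ i → A₁ * rising q (B ℕ.+ B ℕ.+ i) l ~ q ^ exponent l (suc d) * (A₃ * A₄)) (ℕₚ.+-suc l d)
        (rising-congruence l (suc d) (suc m) (suc r)
          (≡.trans (≡.sym (ℕₚ.+-suc m (suc l))) m≡) (≡.trans (lemma l d r) n≡))
        where
        lemma : ∀ l d r → suc (l ℕ.+ l ℕ.+ suc d ℕ.+ suc r) ≡ suc (suc l ℕ.+ suc l ℕ.+ d ℕ.+ r)
        lemma = ℕ-Solver.solve-∀
      -- The exponents of u v add up to (b + c) n in `Q`, those of s w to 2bn + n in `q`: multiples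
      -- of `n` in both cases.
      uv : u * v ~ 1#
      uv = ~-trans (≈⇒~ (begin
          u * v                                      ≈⟨ ^-homo-* Q (suc (B ℕ.+ l)) (suc m) ⟨
          Q ^ (suc (B ℕ.+ l) ℕ.+ suc m)              ≡⟨ ≡.cong (Q ^_) (≡.trans (lemma B l m) (≡.cong (B ℕ.+_) m≡)) ⟩
          Q ^ (B ℕ.+ h)                              ≈⟨ ^-homo-* Q B h ⟩
          Q ^ B * Q ^ h                              ∎))
        (~-trans (~-*-cong (Q^~1 b) (Q^~1 c)) (≈⇒~ (*-identityˡ 1#)))
        where
        lemma : ∀ B l m → suc (B ℕ.+ l) ℕ.+ suc m ≡ B ℕ.+ (m ℕ.+ suc (suc l))
        lemma = ℕ-Solver.solve-∀
      sw : s * w ~ 1#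
      sw = ~-trans (≈⇒~ (begin
          s * w                         ≈⟨ ^-homo-* q (suc (k ℕ.+ l)) (suc r) ⟨
          q ^ (suc (k ℕ.+ l) ℕ.+ suc r) ≡⟨ ≡.cong (q ^_) (≡.trans (lemma B l d r) (≡.cong₂ (λ x y → x ℕ.+ y) (≡.sym (ℕₚ.*-distribʳ-+ n b b)) (≡.trans n≡ (≡.sym (ℕₚ.+-identityʳ n))))) ⟩
          q ^ ((b ℕ.+ b) ℕ.* n ℕ.+ 1 ℕ.* n) ≈⟨ ^-homo-* q ((b ℕ.+ b) ℕ.* n) (1 ℕ.* n) ⟩
          q ^ ((b ℕ.+ b) ℕ.* n) * q ^ (1 ℕ.* n) ∎))
        (~-trans (~-*-cong (^~1 (b ℕ.+ b)) (^~1 1)) (≈⇒~ (*-identityˡ 1#)))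
        where
        lemma : ∀ B l d r → suc (B ℕ.+ B ℕ.+ (suc l ℕ.+ d) ℕ.+ l) ℕ.+ suc r
                  ≡ B ℕ.+ B ℕ.+ suc (suc l ℕ.+ suc l ℕ.+ d ℕ.+ r)
        lemma = ℕ-Solver.solve-∀
      ρu : ρ * u ≈ s
      ρu = begin
        ρ * u                                           ≈⟨ *-congˡ (square-^ q (suc (B ℕ.+ l))) ⟩
        ρ * q ^ (suc (B ℕ.+ l) ℕ.+ suc (B ℕ.+ l))       ≈⟨ ^-homo-* q d _ ⟨
        q ^ (d ℕ.+ (suc (B ℕ.+ l) ℕ.+ suc (B ℕ.+ l)))   ≡⟨ ≡.cong (q ^_) (lemma B l d) ⟩
        s                                               ∎
        where
        lemma : ∀ B l d → d ℕ.+ (suc (B ℕ.+ l) ℕ.+ suc (B ℕ.+ l)) ≡ suc (B ℕ.+ B ℕ.+ (suc l ℕ.+ d) ℕ.+ l)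
        lemma = ℕ-Solver.solve-∀
      pair : (v - 1#) * (s - 1#) ~ ρ * ((u - 1#) * (w - 1#))
      pair = inverse-pair-product quotientRing uv sw (≈⇒~ ρu)
      expand : rising Q m (suc l) * rising q k (suc l) ≈ (A₁ * A₂) * ((v - 1#) * (s - 1#))
      expand = trans (*-congʳ (rising-front Q m l))
        (solve 4 (λ v a b s → v :* a :* (b :* s) := a :* b :* (v :* s)) refl (v - 1#) A₁ A₂ (s - 1#))
      collect : q ^ exponent l (suc d) * (A₃ * A₄) * (ρ * ((u - 1#) * (w - 1#)))
                  ≈ q ^ exponent (suc l) d * (rising Q B (suc l) * rising q r (suc l))
      collect = begin
        E * (A₃ * A₄) * (ρ * ((u - 1#) * (w - 1#)))
          ≈⟨ solve 6 (λ e a b ρ u w → e :* (a :* b) :* (ρ :* (u :* w)) := e :* ρ :* (a :* u :* (w :* b)))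
               refl E A₃ A₄ ρ (u - 1#) (w - 1#) ⟩
        E * ρ * (A₃ * (u - 1#) * ((w - 1#) * A₄))
          ≈⟨ *-cong (^-homo-* q (exponent l (suc d)) d) (*-congˡ (rising-front q r l)) ⟨
        q ^ exponent (suc l) d * (rising Q B (suc l) * rising q r (suc l)) ∎
        where E = q ^ exponent l (suc d)

    module _ (l m r : ℕ) (m≡ : m ℕ.+ suc l ≡ h) (n≡ : suc l ℕ.+ suc l ℕ.+ r ≡ n) where
      private
        j = suc l
        k = B ℕ.+ B ℕ.+ j
        N = gauss Q B h

      -- This is t_j for j = l + 1. The equations m + j = h and 2j + r = n replace the truncated
      -- subtractions h - j and n - 2j.
      summand : Carrier
      summand = gauss Q (suc (B ℕ.+ l)) m * gauss q k j

      cofactor : Carrier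
      cofactor = qfactorial q j * rising Q B l

      -- Equal to (q^n - 1)/(q^{n-j} - 1) times [n-j, j], a q-analogue of the Lucas coefficient
      -- n/(n-j) C(n-j, j); the two-term form avoids the quotient.
      reduced : Carrier
      reduced = q ^ j * gauss q r j + gauss q r l

      private
        exact : summand * cofactor ≈ N * [ Q ^ h -1] * (rising Q m l * rising q k l)
        exact = begin
          a * e * (F * f * P)          ≈⟨ solve 5 (λ a b F f P → a :* b :* (F :* f :* P) := a :* (b :* f) :* (F :* P)) refl a e F f P ⟩
          -- Absorption produces q^{2(B+j)} - 1, which is the factor Q^{B+j} - 1 that the
          -- q²-binomial coefficient needs for its own shift. This is how the two kinds of binomial
          -- coefficients interact.
          a * (e * f) * (F * P)        ≈⟨ *-congʳ (*-congˡ (trans (gauss-absorbʳ q k l) (*-congʳ double))) ⟩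
          a * (x * e′) * (F * P)       ≈⟨ solve 5 (λ a x b F P → a :* (x :* b) :* (F :* P) := a :* x :* P :* (b :* F)) refl a x e′ F P ⟩
          a * x * P * (e′ * F)         ≈⟨ *-cong (*-congʳ (gauss-shift Q (B ℕ.+ l) m)) (gauss-rising q k l) ⟩
          a′ * y * P * rising q k l    ≈⟨ *-congʳ (solve 3 (λ a b c → a :* b :* c := a :* c :* b) refl a′ y P) ⟩
          a′ * P * y * rising q k l    ≈⟨ *-congʳ (*-congʳ (gauss-shift-rising Q B (suc m) l)) ⟩
          gauss Q B (suc m ℕ.+ l) * rising Q (suc m) l * y * rising q k l
            ≈⟨ *-congʳ (*-congʳ (*-congʳ (reflexive (≡.cong (gauss Q B) h≡)))) ⟩
          N * rising Q (suc m) l * y * rising q k l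
            ≈⟨ solve 4 (λ n p y z → n :* p :* y :* z := n :* (y :* p) :* z) refl N (rising Q (suc m) l) y (rising q k l) ⟩
          N * (y * rising Q (suc m) l) * rising q k l
            ≈⟨ *-congʳ (*-congˡ (rising-front Q m l)) ⟨
          N * (rising Q m l * [ Q ^ suc (m ℕ.+ l) -1]) * rising q k l
            ≡⟨ ≡.cong (λ i → N * (rising Q m l * [ Q ^ i -1]) * rising q k l) h≡ ⟩
          N * (rising Q m l * [ Q ^ h -1]) * rising q k l
            ≈⟨ solve 4 (λ n p y z → n :* (p :* y) :* z := n :* y :* (p :* z)) refl N (rising Q m l) [ Q ^ h -1] (rising q k l) ⟩
          N * [ Q ^ h -1] * (rising Q m l * rising q k l) ∎
          where
          a = gauss Q (suc (B ℕ.+ l)) m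
          a′ = gauss Q (B ℕ.+ l) (suc m)
          e = gauss q k j
          e′ = gauss q k l
          F = qfactorial q l
          f = [ q ^ suc l -1]
          P = rising Q B l
          x = [ Q ^ suc (B ℕ.+ l) -1]
          y = [ Q ^ suc m -1]
          h≡ : suc m ℕ.+ l ≡ h
          h≡ = ≡.trans (≡.sym (ℕₚ.+-suc m l)) m≡
          double : [ q ^ suc (k ℕ.+ l) -1] ≈ x
          double = trans (reflexive (≡.cong (λ i → [ q ^ i -1]) (lemma B l))) (sym (square-bracket (suc (B ℕ.+ l))))
            where
            lemma : ∀ B l → suc (B ℕ.+ B ℕ.+ suc l ℕ.+ l) ≡ suc (B ℕ.+ l) ℕ.+ suc (B ℕ.+ l)
            lemma = ℕ-Solver.solve-∀

        -- Both binomial coefficients become multiples of `rising q r l`, with the factors x - 1 and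
        -- y - 1, and y (x - 1) + (y - 1) = x y - 1 is q^n - 1. This is the explicit `W` on the
        -- right-hand side.
        reduced-factorial : reduced * qfactorial q j ≈ W * rising q r l
        reduced-factorial = begin
          (y * g′ + g) * (F * (y - 1#))                 ≈⟨ solve 4 (λ y a b F → (y :* a :+ b) :* (F :* (y :- con (+ 1)))
                                                             := y :* (a :* (F :* (y :- con (+ 1)))) :+ b :* F :* (y :- con (+ 1))) refl y g′ g F ⟩
          y * (g′ * (F * (y - 1#))) + g * F * (y - 1#)  ≈⟨ +-cong (*-congˡ (gauss-rising q r j)) (*-congʳ (gauss-rising q r l)) ⟩
          y * (P * (x - 1#)) + P * (y - 1#)             ≈⟨ solve 3 (λ y P x → y :* (P :* (x :- con (+ 1))) :+ P :* (y :- con (+ 1))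
                                                             := (y :* x :- con (+ 1)) :* P) refl y P x ⟩
          (y * x - 1#) * P                              ≈⟨ *-congʳ (+-congʳ (trans (sym (^-homo-* q j (suc (r ℕ.+ l)))) (^-≡ q (≡.trans (lemma l r) n≡)))) ⟩
          W * P                                         ∎
          where
          y = q ^ j
          x = q ^ suc (r ℕ.+ l)
          g′ = gauss q r j
          g = gauss q r l
          F = qfactorial q l
          P = rising q r l
          lemma : ∀ l r → suc l ℕ.+ suc (r ℕ.+ l) ≡ suc l ℕ.+ suc l ℕ.+ r
          lemma = ℕ-Solver.solve-∀

        Y Z : Carrier
        Y = rising Q m l * rising q k l
        Z = q ^ triangle j * (rising Q B l * rising q r l)

        Y~Z : Y ~ Z
        Y~Z = ≡.subst₂ (λ i e → rising Q m l * rising q (B ℕ.+ B ℕ.+ i) l ~ q ^ e * (rising Q B l * rising q r l))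
          (ℕₚ.+-comm l 1)
          (≡.trans (exponent-closed l 1) (≡.cong (triangle l ℕ.+_) (ℕₚ.*-identityʳ l)))
          (rising-congruence l 1 m r m≡ (≡.trans (lemma l r) n≡))
          where
          lemma : ∀ l r → suc (l ℕ.+ l ℕ.+ 1 ℕ.+ r) ≡ suc l ℕ.+ suc l ℕ.+ r
          lemma = ℕ-Solver.solve-∀

        G : Carrier
        G = geometric (c ℕ.+ c)

        GY~2cZ : G * Y ~ natural (c ℕ.+ c) * Z
        GY~2cZ = ~-*-cong (proj₂ (proj₂ (bracket-multiple (c ℕ.+ c)))) Y~Z

        Q^h-1 : [ Q ^ h -1] ≈ W * G
        Q^h-1 = trans (square-bracket h)
          (trans (reflexive (≡.cong (λ i → [ q ^ i -1]) (≡.sym (ℕₚ.*-distribʳ-+ n c c)))) (proj₁ (proj₂ (bracket-multiple (c ℕ.+ c)))))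

      -- After multiplication by `cofactor` both terms contain `W`, and what is left, G Y and 2c Z,
      -- agrees modulo `W`. The cofactor itself is cancelled later, modulo Φ_n², where it is coprime
      -- to the modulus.
      summand-congruence : ∃[ K ] (cofactor * (summand - N * natural (c ℕ.+ c) * (q ^ triangle j * reduced)) ≈ W * W * K)
      summand-congruence = N * K , (begin
        U * (t - N * C * (τ * δ))                     ≈⟨ solve 5 (λ U t a τ δ → U :* (t :- a :* (τ :* δ))
                                                            := t :* U :- a :* (τ :* (δ :* U))) refl U t (N * C) τ δ ⟩
        t * U - N * C * (τ * (δ * U))                 ≈⟨ +-cong (trans exact (*-congʳ (*-congˡ Q^h-1))) (-‿cong (*-congˡ (*-congˡ δU))) ⟩
        N * (W * G) * Y - N * C * (τ * (W * p * P))   ≈⟨ +-cong (solve 4 (λ N W G Y → N :* (W :* G) :* Y := N :* W :* (G :* Y)) refl N W G Y)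
                                                           (-‿cong (trans (*-congˡ (solve 4 (λ τ W p P → τ :* (W :* p :* P) := W :* (τ :* (P :* p))) refl τ W p P))
                                                             (solve 4 (λ N C W Z → N :* C :* (W :* Z) := N :* W :* (C :* Z)) refl N C W Z))) ⟩
        N * W * (G * Y) - N * W * (C * Z)             ≈⟨ solve 3 (λ a x y → a :* x :- a :* y := a :* (x :- y)) refl (N * W) (G * Y) (C * Z) ⟩
        N * W * (G * Y - C * Z)                       ≈⟨ *-congˡ (+-congʳ eq) ⟩
        N * W * (C * Z + W * K - C * Z)               ≈⟨ solve 4 (λ N W K x → N :* W :* (x :+ W :* K :- x) := W :* W :* (N :* K)) refl N W K (C * Z) ⟩
        W * W * (N * K)                               ∎)
        where
        K = _~_.factor GY~2cZ
        eq = _~_.equation GY~2cZ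
        U = cofactor
        t = summand
        C = natural (c ℕ.+ c)
        τ = q ^ triangle j
        δ = reduced
        P = rising Q B l
        p = rising q r l
        δU : δ * U ≈ W * p * P
        δU = trans (sym (*-assoc _ _ _)) (*-congʳ reduced-factorial)

-- The number m (3m - 1)/2, summed from its differences so that neither division nor subtraction
-- occurs.
pentagonal : ℕ → ℕ
pentagonal zero    = 0
pentagonal (suc m) = pentagonal m ℕ.+ suc (m ℕ.* 3)

-- Rogers-Schur sums

module Alternating {c ℓ} (R : CommutativeRing c ℓ) where
  open CommutativeRing R
  open SetoidReasoning setoid
  open IntegerSolver R

  sign : ℕ → Carrier
  sign zero    = 1#
  sign (suc j) = - sign j

  sum : ℕ → (ℕ → Carrier) → Carrier
  sum zero    f = 0#
  sum (suc L) f = f 0 + sum L (f ∘ suc)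

  sum-cong : ∀ L {f g : ℕ → Carrier} → (∀ j → j ℕ.< L → f j ≈ g j) → sum L f ≈ sum L g
  sum-cong zero    f≈g = refl
  sum-cong (suc L) f≈g = +-cong (f≈g 0 (ℕ.s≤s ℕ.z≤n)) (sum-cong L (λ j j<L → f≈g (suc j) (ℕ.s≤s j<L)))

  sum-linear : ∀ {a x y} {f g h : ℕ → Carrier} →
    (∀ j → a * f j ≈ x * g j + y * h j) → ∀ L → a * sum L f ≈ x * sum L g + y * sum L h
  sum-linear {a} {x} {y} e zero =
    solve 3 (λ a x y → a :* con (+ 0) := x :* con (+ 0) :+ y :* con (+ 0)) refl a x y
  sum-linear {a} {x} {y} {f} {g} {h} e (suc L) = begin
    a * (f 0 + sum L (f ∘ suc))      ≈⟨ distribˡ _ _ _ ⟩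
    a * f 0 + a * sum L (f ∘ suc)    ≈⟨ +-cong (e 0) (sum-linear (e ∘ suc) L) ⟩
    (x * g 0 + y * h 0) + (x * sum L (g ∘ suc) + y * sum L (h ∘ suc))
      ≈⟨ solve 6 (λ x y a b c d → (x :* a :+ y :* b) :+ (x :* c :+ y :* d) := x :* (a :+ c) :+ y :* (b :+ d))
           refl x y (g 0) (h 0) (sum L (g ∘ suc)) (sum L (h ∘ suc)) ⟩
    x * (g 0 + sum L (g ∘ suc)) + y * (h 0 + sum L (h ∘ suc)) ∎

  sum-zero : ∀ L {f : ℕ → Carrier} → (∀ j → f j ≈ 0#) → sum L f ≈ 0#
  sum-zero zero    f≈0 = refl
  sum-zero (suc L) f≈0 = trans (+-cong (f≈0 0) (sum-zero L (f≈0 ∘ suc))) (+-identityˡ 0#)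

  sum-truncate : ∀ L k {f : ℕ → Carrier} → (∀ j → f (L ℕ.+ j) ≈ 0#) → sum (L ℕ.+ k) f ≈ sum L f
  sum-truncate zero    k f≈0 = sum-zero k f≈0
  sum-truncate (suc L) k f≈0 = +-congˡ (sum-truncate L k f≈0)

  sign² : ∀ j → sign j * sign j ≈ 1#
  sign² zero    = *-identityˡ 1#
  sign² (suc j) = trans (solve 1 (λ σ → :- σ :* :- σ := σ :* σ) refl (sign j)) (sign² j)

  sum-snoc : ∀ L f → sum (suc L) f ≈ sum L f + f L
  sum-snoc zero    f = +-comm _ _
  sum-snoc (suc L) f = trans (+-congˡ (sum-snoc L (f ∘ suc))) (sym (+-assoc _ _ _))

  sum-reverse : ∀ L f → sum (suc L) (λ i → f (L ∸ i)) ≈ sum (suc L) f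
  sum-reverse zero    f = refl
  sum-reverse (suc L) f = begin
    f (suc L) + sum (suc L) (λ i → f (L ∸ i))  ≈⟨ +-congˡ (sum-reverse L f) ⟩
    f (suc L) + sum (suc L) f                  ≈⟨ +-comm _ _ ⟩
    sum (suc L) f + f (suc L)                  ≈⟨ sum-snoc (suc L) f ⟨
    sum (suc (suc L)) f                        ∎

module RogersSchur {c ℓ} (R : CommutativeRing c ℓ) (q : CommutativeRing.Carrier R) where
  open CommutativeRing R
  open SetoidReasoning setoid
  open IntegerSolver R
  open QCalculus R
  open Alternating R

  -- antidiagonal n j is the q-binomial coefficient [n-j, j], zero for n < 2j.
  antidiagonal : ℕ → ℕ → Carrier
  antidiagonal n             zero    = 1#
  antidiagonal zero          (suc j) = 0#
  antidiagonal (suc zero)    (suc j) = 0#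
  antidiagonal (suc (suc n)) (suc j) = q ^ suc j * antidiagonal (suc n) (suc j) + antidiagonal n j

  antidiagonal-0 : ∀ n → antidiagonal n 0 ≈ 1#
  antidiagonal-0 zero          = refl
  antidiagonal-0 (suc zero)    = refl
  antidiagonal-0 (suc (suc n)) = refl

  antidiagonal-zero : ∀ n j → n ℕ.< j ℕ.+ j → antidiagonal n j ≈ 0#
  antidiagonal-zero zero          (suc j) n<2j = refl
  antidiagonal-zero (suc zero)    (suc j) n<2j = refl
  antidiagonal-zero (suc (suc n)) (suc j) n<2j = begin
    q ^ suc j * antidiagonal (suc n) (suc j) + antidiagonal n j
      ≈⟨ +-cong (*-congˡ (antidiagonal-zero (suc n) (suc j) (ℕₚ.<-trans (ℕₚ.n<1+n _) n<2j)))
           (antidiagonal-zero n j (ℕ.s≤s⁻¹ (≡.subst (suc (suc n) ℕ.≤_) (ℕₚ.+-suc j j) (ℕ.s≤s⁻¹ n<2j)))) ⟩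
    q ^ suc j * 0# + 0#  ≈⟨ solve 1 (λ x → x :* con (+ 0) :+ con (+ 0) := con (+ 0)) refl (q ^ suc j) ⟩
    0#                   ∎

  antidiagonal-gauss : ∀ r j → antidiagonal (j ℕ.+ j ℕ.+ r) j ≈ gauss q r j
  antidiagonal-gauss r       zero    = trans (antidiagonal-0 r) (sym (gauss-0 r))
    where
    gauss-0 : ∀ r → gauss q r 0 ≈ 1#
    gauss-0 zero    = refl
    gauss-0 (suc r) = refl
  antidiagonal-gauss r (suc j) = trans (reflexive (≡.cong (λ k → antidiagonal (suc k ℕ.+ r) (suc j)) (ℕₚ.+-suc j j))) (step r)
    where
    step : ∀ r → q ^ suc j * antidiagonal (suc (j ℕ.+ j ℕ.+ r)) (suc j) + antidiagonal (j ℕ.+ j ℕ.+ r) j ≈ gauss q r (suc j)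
    step zero = begin
      q ^ suc j * antidiagonal (suc (j ℕ.+ j ℕ.+ 0)) (suc j) + antidiagonal (j ℕ.+ j ℕ.+ 0) j
        ≈⟨ +-cong (*-congˡ (antidiagonal-zero _ (suc j) (ℕ.s≤s (ℕₚ.≤-reflexive (≡.trans (≡.cong suc (ℕₚ.+-identityʳ (j ℕ.+ j))) (≡.sym (ℕₚ.+-suc j j)))))))
             (antidiagonal-gauss 0 j) ⟩
      q ^ suc j * 0# + gauss q 0 j  ≈⟨ +-congˡ (gauss-00 j) ⟩
      q ^ suc j * 0# + 1#           ≈⟨ solve 1 (λ x → x :* con (+ 0) :+ con (+ 1) := con (+ 1)) refl (q ^ suc j) ⟩
      1#                            ∎
      where
      gauss-00 : ∀ j → gauss q 0 j ≈ 1#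
      gauss-00 zero    = refl
      gauss-00 (suc j) = refl
    step (suc r) = begin
      q ^ suc j * antidiagonal (suc (j ℕ.+ j ℕ.+ suc r)) (suc j) + antidiagonal (j ℕ.+ j ℕ.+ suc r) j
        ≈⟨ +-cong (*-congˡ (trans (reflexive (≡.cong (λ k → antidiagonal k (suc j)) (lemma j r))) (antidiagonal-gauss r (suc j))))
             (antidiagonal-gauss (suc r) j) ⟩
      q ^ suc j * gauss q r (suc j) + gauss q (suc r) j  ≈⟨ +-comm _ _ ⟩
      gauss q (suc r) (suc j)                            ∎
      where
      lemma : ∀ j r → suc (j ℕ.+ j ℕ.+ suc r) ≡ suc j ℕ.+ suc j ℕ.+ r
      lemma = ℕ-Solver.solve-∀

  -- The other q-Pascal rule, multiplied by q^{2j} to avoid the exponent n - 2j.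
  antidiagonal-pascal : ∀ n j →
    q ^ (j ℕ.+ j) * (antidiagonal (suc (suc n)) (suc j) - antidiagonal (suc n) (suc j)) ≈ q ^ n * antidiagonal n j
  antidiagonal-pascal zero zero =
    solve 1 (λ q → con (+ 1) :* (q :* con (+ 1) :* con (+ 0) :+ con (+ 1) :- con (+ 0)) := con (+ 1) :* con (+ 1)) refl q
  antidiagonal-pascal zero (suc j) =
    solve 3 (λ x y z → x :* (y :* con (+ 0) :+ con (+ 0) :- con (+ 0)) := z :* con (+ 0)) refl _ _ _
  antidiagonal-pascal (suc zero) zero =
    solve 1 (λ q → con (+ 1) :* (q :* con (+ 1) :* (q :* con (+ 1) :* con (+ 0) :+ con (+ 1)) :+ con (+ 1) :- (q :* con (+ 1) :* con (+ 0) :+ con (+ 1))) := q :* con (+ 1) :* con (+ 1)) refl q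
  antidiagonal-pascal (suc zero) (suc j) =
    solve 3 (λ x y z → x :* (y :* (y :* con (+ 0) :+ con (+ 0)) :+ con (+ 0) :- (y :* con (+ 0) :+ con (+ 0))) := z :* con (+ 0)) refl _ _ _
  antidiagonal-pascal (suc (suc n)) zero = begin
    1# * (q ^ 1 * e₃ + 1# - (q ^ 1 * e₂ + antidiagonal (suc n) 0))  ≈⟨ *-congˡ (+-congˡ (-‿cong (+-congˡ (antidiagonal-0 (suc n))))) ⟩
    1# * (q ^ 1 * e₃ + 1# - (q ^ 1 * e₂ + 1#))  ≈⟨ solve 3 (λ x a b → con (+ 1) :* (x :* a :+ con (+ 1) :- (x :* b :+ con (+ 1)))
                                                      := x :* (con (+ 1) :* (a :- b))) refl (q ^ 1) e₃ e₂ ⟩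
    q ^ 1 * (1# * (e₃ - e₂))                    ≈⟨ *-congˡ (antidiagonal-pascal (suc n) 0) ⟩
    q ^ 1 * (q ^ suc n * antidiagonal (suc n) 0)  ≈⟨ *-congˡ (*-congˡ (antidiagonal-0 (suc n))) ⟩
    q ^ 1 * (q ^ suc n * 1#)                    ≈⟨ solve 2 (λ q x → q :* con (+ 1) :* (x :* con (+ 1)) := q :* x :* con (+ 1)) refl q (q ^ suc n) ⟩
    q ^ suc (suc n) * 1#                        ∎
    where
    e₃ = antidiagonal (suc (suc (suc n))) 1
    e₂ = antidiagonal (suc (suc n)) 1
  antidiagonal-pascal (suc (suc n)) (suc j) = begin
    x * (y * e₃ + f₂ - (y * e₂ + f₁))        ≈⟨ solve 6 (λ x y a b c d → x :* (y :* a :+ b :- (y :* c :+ d))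
                                                   := y :* (x :* (a :- c)) :+ x :* (b :- d)) refl x y e₃ f₂ e₂ f₁ ⟩
    y * (x * (e₃ - e₂)) + x * (f₂ - f₁)      ≈⟨ +-cong (*-congˡ (antidiagonal-pascal (suc n) (suc j)))
                                                  (trans (*-congʳ (^-≡ q (≡.cong suc (ℕₚ.+-suc j j)))) (trans (assoc³ _ _ _) (*-congˡ (*-congˡ (antidiagonal-pascal n j))))) ⟩
    y * (q ^ suc n * f₁) + q * (q * (q ^ n * antidiagonal n j))
      ≈⟨ solve 5 (λ q y z a b → q :* y :* (q :* z :* a) :+ q :* (q :* (z :* b)) := q :* (q :* z) :* (y :* a :+ b))
           refl q (q ^ suc j) (q ^ n) f₁ (antidiagonal n j) ⟩
    q ^ suc (suc n) * f₂                     ∎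
    where
    x = q ^ (suc j ℕ.+ suc j)
    y = q ^ suc (suc j)
    e₃ = antidiagonal (suc (suc (suc n))) (suc (suc j))
    e₂ = antidiagonal (suc (suc n)) (suc (suc j))
    f₂ = antidiagonal (suc (suc n)) (suc j)
    f₁ = antidiagonal (suc n) (suc j)
    assoc³ : ∀ a b d → q * (q * a) * (b - d) ≈ q * (q * (a * (b - d)))
    assoc³ a b d = trans (*-assoc _ _ _) (*-congˡ (*-assoc _ _ _))

  schur-term : ℕ → ℕ → Carrier
  schur-term n j = sign j * q ^ triangle j * antidiagonal n j

  -- The number of terms is kept apart from `n`, because the recurrences shift the summation index
  -- and change the two independently; once it exceeds n/2 the value no longer depends on it.
  partial-schur : ℕ → ℕ → Carrier
  partial-schur L n = sum L (schur-term n)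

  schur : ℕ → Carrier
  schur n = partial-schur (suc n) n

  neg-^ : ∀ j → (- q) ^ j ≈ sign j * q ^ j
  neg-^ zero    = sym (*-identityˡ 1#)
  neg-^ (suc j) = trans (*-congˡ (neg-^ j))
    (solve 3 (λ q σ x → :- q :* (σ :* x) := :- σ :* (q :* x)) refl q (sign j) (q ^ j))

  -- q ϑ_n as a combination of Rogers-Schur sums, with the sum of index -1 equal to 0.
  theta : ℕ → Carrier
  theta zero          = 0#
  theta (suc zero)    = q * schur 1
  theta (suc (suc n)) = q * schur (suc (suc n)) - schur n

  partial-schur-stable : ∀ L k n → n ℕ.< L ℕ.+ L → partial-schur (L ℕ.+ k) n ≈ partial-schur L n
  partial-schur-stable L k n n<2L = sum-truncate L k (λ j →
    trans (*-congˡ (antidiagonal-zero n (L ℕ.+ j) (ℕₚ.<-≤-trans n<2L (ℕₚ.+-mono-≤ (ℕₚ.m≤m+n L j) (ℕₚ.m≤m+n L j)))))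
      (zeroʳ _))

  partial≈schur : ∀ L n → n ℕ.< L ℕ.+ L → partial-schur L n ≈ schur n
  partial≈schur L n n<2L = begin
    partial-schur L n                  ≈⟨ partial-schur-stable L (suc n) n n<2L ⟨
    partial-schur (L ℕ.+ suc n) n      ≡⟨ ≡.cong (λ k → partial-schur k n) (ℕₚ.+-comm L (suc n)) ⟩
    partial-schur (suc n ℕ.+ L) n      ≈⟨ partial-schur-stable (suc n) L n (ℕₚ.m≤m+n (suc n) (suc n)) ⟩
    schur n                            ∎

  private
    -- shifted j = C(j,2) - j + 1
    shifted : ℕ → ℕ
    shifted zero    = 1
    shifted (suc j) = triangle j

    triangle-shifted : ∀ j → suc (triangle (suc j)) ≡ shifted j ℕ.+ (j ℕ.+ j)
    triangle-shifted zero    = ≡.refl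
    triangle-shifted (suc j) = lemma (triangle j) j
      where
      lemma : ∀ t j → suc (t ℕ.+ j ℕ.+ suc j) ≡ t ℕ.+ (suc j ℕ.+ suc j)
      lemma = ℕ-Solver.solve-∀

    dual-term : ℕ → ℕ → Carrier
    dual-term n j = sign j * q ^ shifted j * antidiagonal n j

    -- The second Pascal rule, term by term; the terms j = 0 of both Rogers-Schur sums are 1.
    schur-difference : ∀ L n →
      q * partial-schur (suc L) (suc (suc n)) ≈ q * partial-schur (suc L) (suc n) + - (q ^ n) * sum L (dual-term n)
    schur-difference L n = begin
      q * (1# * 1# * 1# + Σ₂)              ≈⟨ solve 2 (λ q x → q :* (con (+ 1) :* con (+ 1) :* con (+ 1) :+ x) := q :+ q :* x) refl q Σ₂ ⟩
      q + q * Σ₂                           ≈⟨ +-congˡ (sum-linear term L) ⟩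
      q + (q * Σ₁ + - (q ^ n) * Σ₀)          ≈⟨ solve 3 (λ q x y → q :+ (q :* x :+ y)
                                                := q :* (con (+ 1) :* con (+ 1) :* con (+ 1) :+ x) :+ y) refl q Σ₁ (- (q ^ n) * Σ₀) ⟩
      q * (1# * 1# * 1# + Σ₁) + - (q ^ n) * Σ₀  ≈⟨ +-congʳ (*-congˡ (+-congʳ (*-congˡ (antidiagonal-0 (suc n))))) ⟨
      q * partial-schur (suc L) (suc n) + - (q ^ n) * Σ₀ ∎
      where
      Σ₂ = sum L (schur-term (suc (suc n)) ∘ suc)
      Σ₁ = sum L (schur-term (suc n) ∘ suc)
      Σ₀ = sum L (dual-term n)
      term : ∀ j → q * schur-term (suc (suc n)) (suc j) ≈ q * schur-term (suc n) (suc j) + - (q ^ n) * dual-term n j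
      term j = begin
        q * (- σ * t * e₂)                        ≈⟨ solve 5 (λ q σ t a b → q :* (:- σ :* t :* a)
                                                       := q :* (:- σ :* t :* b) :+ :- (σ :* ((q :* t) :* (a :- b)))) refl q σ t e₂ e₁ ⟩
        q * (- σ * t * e₁) + - (σ * ((q * t) * (e₂ - e₁)))
          ≈⟨ +-congˡ (-‿cong (*-congˡ (*-congʳ (trans (^-≡ q (triangle-shifted j)) (^-homo-* q (shifted j) (j ℕ.+ j)))))) ⟩
        q * (- σ * t * e₁) + - (σ * (s * q ^ (j ℕ.+ j) * (e₂ - e₁)))
          ≈⟨ +-congˡ (-‿cong (*-congˡ (trans (*-assoc _ _ _) (*-congˡ (antidiagonal-pascal n j))))) ⟩
        q * (- σ * t * e₁) + - (σ * (s * (q ^ n * e₀)))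
          ≈⟨ +-congˡ (solve 4 (λ σ s x e → :- (σ :* (s :* (x :* e))) := :- x :* (σ :* s :* e)) refl σ s (q ^ n) e₀) ⟩
        q * (- σ * t * e₁) + - (q ^ n) * (σ * s * e₀) ∎
        where
        σ = sign j
        t = q ^ triangle (suc j)
        s = q ^ shifted j
        e₂ = antidiagonal (suc (suc n)) (suc j)
        e₁ = antidiagonal (suc n) (suc j)
        e₀ = antidiagonal n j

    -- The first Pascal rule, built into `antidiagonal`, leads from the companion sums back to the
    -- original ones, so that the two rules together close up into one recurrence.
    dual-sum : ∀ L n →
      sum (suc L) (dual-term (suc (suc n))) ≈ q * partial-schur (suc L) (suc n) - partial-schur L n
    dual-sum L n = begin
      1# * (q * 1#) * 1# + Σ₂                 ≈⟨ solve 2 (λ q x → con (+ 1) :* (q :* con (+ 1)) :* con (+ 1) :+ x := q :+ con (+ 1) :* x) refl q Σ₂ ⟩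
      q + 1# * Σ₂                             ≈⟨ +-congˡ (sum-linear term L) ⟩
      q + (q * Σ₁ + - 1# * Σ₀)                ≈⟨ solve 3 (λ q x y → q :+ (q :* x :+ :- con (+ 1) :* y)
                                                   := q :* (con (+ 1) :* con (+ 1) :* con (+ 1) :+ x) :- y) refl q Σ₁ Σ₀ ⟩
      q * (1# * 1# * 1# + Σ₁) - Σ₀            ≈⟨ +-congʳ (*-congˡ (+-congʳ (*-congˡ (antidiagonal-0 (suc n))))) ⟨
      q * partial-schur (suc L) (suc n) - Σ₀  ∎
      where
      Σ₂ = sum L (dual-term (suc (suc n)) ∘ suc)
      Σ₁ = sum L (schur-term (suc n) ∘ suc)
      Σ₀ = partial-schur L n
      term : ∀ j → 1# * dual-term (suc (suc n)) (suc j) ≈ q * schur-term (suc n) (suc j) + - 1# * schur-term n j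
      term j = begin
        1# * (- σ * t * (q * y * e₁ + e₀))                ≈⟨ solve 6 (λ q σ t y a b → con (+ 1) :* (:- σ :* t :* (q :* y :* a :+ b))
                                                               := q :* (:- σ :* (t :* y) :* a) :+ :- con (+ 1) :* (σ :* t :* b)) refl q σ t y e₁ e₀ ⟩
        q * (- σ * (t * y) * e₁) + - 1# * (σ * t * e₀)    ≈⟨ +-congʳ (*-congˡ (*-congʳ (*-congˡ (^-homo-* q (triangle j) j)))) ⟨
        q * schur-term (suc n) (suc j) + - 1# * schur-term n j ∎
        where
        σ = sign j
        t = q ^ triangle j
        y = q ^ j
        e₁ = antidiagonal (suc n) (suc j)
        e₀ = antidiagonal n j

  module _ (q-cancel : ∀ {x y} → q * x ≈ q * y → x ≈ y) where
    schur-recurrence : ∀ n →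
      schur (4 ℕ.+ n) ≈ schur (3 ℕ.+ n) - q ^ suc n * (q * schur (suc n) - schur n)
    schur-recurrence n = q-cancel (begin
      q * schur (4 ℕ.+ n)
        ≈⟨ *-congˡ (partial≈schur (3 ℕ.+ n) (4 ℕ.+ n) (≡.subst (5 ℕ.+ n ℕ.≤_) (lemma₄ n) (ℕₚ.m≤m+n _ (suc n)))) ⟨
      -- With this length `dual-sum` ends in sums whose lengths are exactly those in the definitions
      -- of `schur (suc n)` and `schur n`.
      q * partial-schur (3 ℕ.+ n) (4 ℕ.+ n)
        ≈⟨ schur-difference (2 ℕ.+ n) (2 ℕ.+ n) ⟩
      q * partial-schur (3 ℕ.+ n) (3 ℕ.+ n) + - (q ^ (2 ℕ.+ n)) * sum (2 ℕ.+ n) (dual-term (2 ℕ.+ n))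
        ≈⟨ +-cong (*-congˡ (partial≈schur (3 ℕ.+ n) (3 ℕ.+ n) (ℕ.s≤s (ℕₚ.m≤n+m _ (2 ℕ.+ n))))) (*-congˡ (dual-sum (suc n) n)) ⟩
      q * s₃ + - (q ^ (2 ℕ.+ n)) * (q * schur (suc n) - schur n)
        ≈⟨ solve 4 (λ q a x d → q :* a :+ :- (q :* x) :* d := q :* (a :- x :* d)) refl q s₃ (q ^ suc n) (q * schur (suc n) - schur n) ⟩
      q * (s₃ - q ^ suc n * (q * schur (suc n) - schur n)) ∎)
      where
      s₃ = schur (3 ℕ.+ n)
      lemma₄ : ∀ n → 5 ℕ.+ n ℕ.+ suc n ≡ 3 ℕ.+ n ℕ.+ (3 ℕ.+ n)
      lemma₄ = ℕ-Solver.solve-∀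

    -- The recurrence reaches back four places, so four consecutive values are carried along. In the
    -- induction step one pair of terms cancels at index 3m + 4 and everything cancels at 3m + 5.
    schur-values : ∀ m →
      (schur (m ℕ.* 3) ≈ sign m * q ^ pentagonal m) ×
      (schur (1 ℕ.+ m ℕ.* 3) ≈ sign m * q ^ (pentagonal m ℕ.+ m)) ×
      (schur (2 ℕ.+ m ℕ.* 3) ≈ 0#) ×
      (schur (3 ℕ.+ m ℕ.* 3) ≈ sign (suc m) * q ^ pentagonal (suc m))
    schur-values zero =
        solve 0 (con (+ 1) :* con (+ 1) :* con (+ 1) :+ con (+ 0) := con (+ 1) :* con (+ 1)) refl
      , solve 1 (λ q → con (+ 1) :* con (+ 1) :* con (+ 1) :+ (:- con (+ 1) :* con (+ 1) :* con (+ 0) :+ con (+ 0)) := con (+ 1) :* con (+ 1)) refl q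
      -- Passing to two terms, enough for the indices 2 and 3, keeps the expression for the solver
      -- small.
      , trans (sym (partial≈schur 2 2 (ℕ.s≤s (ℕ.s≤s (ℕ.s≤s ℕ.z≤n)))))
         (solve 1 (λ q → con (+ 1) :* con (+ 1) :* con (+ 1) :+ (:- con (+ 1) :* con (+ 1) :* (q :* con (+ 1) :* con (+ 0) :+ con (+ 1)) :+ con (+ 0)) := con (+ 0)) refl q)
      , trans (sym (partial≈schur 2 3 (ℕ.s≤s (ℕ.s≤s (ℕ.s≤s (ℕ.s≤s ℕ.z≤n))))))
         (solve 1 (λ q → con (+ 1) :* con (+ 1) :* con (+ 1) :+ (:- con (+ 1) :* con (+ 1) :* (q :* con (+ 1) :* (q :* con (+ 1) :* con (+ 0) :+ con (+ 1)) :+ con (+ 1)) :+ con (+ 0))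
            := :- con (+ 1) :* (q :* con (+ 1))) refl q)
    schur-values (suc m) = next (schur-values m)
      where
      σ = sign m
      N = m ℕ.* 3
      p = q ^ pentagonal m
      next : (schur N ≈ σ * p) × (schur (1 ℕ.+ N) ≈ σ * q ^ (pentagonal m ℕ.+ m)) ×
             (schur (2 ℕ.+ N) ≈ 0#) × (schur (3 ℕ.+ N) ≈ - σ * q ^ pentagonal (suc m)) →
             (schur (3 ℕ.+ N) ≈ - σ * q ^ pentagonal (suc m)) ×
             (schur (4 ℕ.+ N) ≈ - σ * q ^ (pentagonal (suc m) ℕ.+ suc m)) ×
             (schur (5 ℕ.+ N) ≈ 0#) ×
             (schur (6 ℕ.+ N) ≈ - - σ * q ^ pentagonal (suc (suc m)))
      next (s₀ , s₁ , s₂ , s₃) = s₃ , s₄ , s₅ , s₆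
        where
        P′ : q ^ pentagonal (suc m) ≈ p * q ^ suc N
        P′ = ^-homo-* q (pentagonal m) (suc N)
        P″ : q ^ (pentagonal m ℕ.+ m) ≈ p * q ^ m
        P″ = ^-homo-* q (pentagonal m) m
        P‴ : q ^ (pentagonal (suc m) ℕ.+ suc m) ≈ p * q ^ suc N * (q * q ^ m)
        P‴ = trans (^-homo-* q (pentagonal (suc m)) (suc m)) (*-congʳ P′)
        s₄ : schur (4 ℕ.+ N) ≈ - σ * q ^ (pentagonal (suc m) ℕ.+ suc m)
        s₄ = begin
          schur (4 ℕ.+ N)                                              ≈⟨ schur-recurrence N ⟩
          schur (3 ℕ.+ N) - x * (q * schur (suc N) - schur N)          ≈⟨ +-cong (trans s₃ (*-congˡ P′)) (-‿cong (*-congˡ (+-cong (*-congˡ (trans s₁ (*-congˡ P″))) (-‿cong s₀)))) ⟩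
          - σ * (p * x) - x * (q * (σ * (p * y)) - σ * p)              ≈⟨ solve 5 (λ σ p x q y → :- σ :* (p :* x) :- x :* (q :* (σ :* (p :* y)) :- σ :* p)
                                                                             := :- σ :* (p :* x :* (q :* y))) refl σ p x q y ⟩
          - σ * (p * x * (q * y))                                      ≈⟨ *-congˡ P‴ ⟨
          - σ * q ^ (pentagonal (suc m) ℕ.+ suc m)                     ∎
          where
          x = q ^ suc N
          y = q ^ m
        s₅ : schur (5 ℕ.+ N) ≈ 0#
        s₅ = begin
          schur (5 ℕ.+ N)                                              ≈⟨ schur-recurrence (suc N) ⟩
          schur (4 ℕ.+ N) - q * x * (q * schur (2 ℕ.+ N) - schur (suc N)) ≈⟨ +-cong (trans s₄ (*-congˡ P‴)) (-‿cong (*-congˡ (+-cong (*-congˡ s₂) (-‿cong (trans s₁ (*-congˡ P″)))))) ⟩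
          - σ * (p * x * (q * y)) - q * x * (q * 0# - σ * (p * y))     ≈⟨ solve 5 (λ σ p x q y → :- σ :* (p :* x :* (q :* y)) :- q :* x :* (q :* con (+ 0) :- σ :* (p :* y))
                                                                             := con (+ 0)) refl σ p x q y ⟩
          0#                                                           ∎
          where
          x = q ^ suc N
          y = q ^ m
        s₆ : schur (6 ℕ.+ N) ≈ - - σ * q ^ pentagonal (suc (suc m))
        s₆ = begin
          schur (6 ℕ.+ N)                                              ≈⟨ schur-recurrence (2 ℕ.+ N) ⟩
          schur (5 ℕ.+ N) - x * (q * schur (3 ℕ.+ N) - schur (2 ℕ.+ N)) ≈⟨ +-cong s₅ (-‿cong (*-congˡ (+-cong (*-congˡ s₃) (-‿cong s₂)))) ⟩
          0# - x * (q * (- σ * z) - 0#)                                ≈⟨ solve 4 (λ σ z x q → con (+ 0) :- x :* (q :* (:- σ :* z) :- con (+ 0))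
                                                                             := :- :- σ :* (z :* (q :* x))) refl σ z x q ⟩
          - - σ * (z * (q * x))                                        ≈⟨ *-congˡ (^-homo-* q (pentagonal (suc m)) (4 ℕ.+ N)) ⟨
          - - σ * q ^ pentagonal (suc (suc m))                         ∎
          where
          x = q ^ (3 ℕ.+ N)
          z = q ^ pentagonal (suc m)

-- Summation of the congruences

module TruncatedSum {c ℓ} (R : CommutativeRing c ℓ) (q D : CommutativeRing.Carrier R) where
  open CommutativeRing R
  open SetoidReasoning setoid
  open IntegerSolver R
  open QCalculus R
  open Alternating R
  open RogersSchur R q
  open Quotient R D

  sum-linear-~ : ∀ {a x y} {f g h : ℕ → Carrier} L →
    (∀ j → j ℕ.< L → a * f j ~ x * g j + y * h j) → a * sum L f ~ x * sum L g + y * sum L h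
  sum-linear-~ {a} {x} {y} zero e =
    ≈⇒~ (solve 3 (λ a x y → a :* con (+ 0) := x :* con (+ 0) :+ y :* con (+ 0)) refl a x y)
  sum-linear-~ {a} {x} {y} {f} {g} {h} (suc L) e =
    ~-trans (≈⇒~ (distribˡ _ _ _))
      (~-trans (~-+-cong (e 0 (ℕ.s≤s ℕ.z≤n)) (sum-linear-~ {a} {x} {y} {f ∘ suc} {g ∘ suc} {h ∘ suc} L (λ j j<L → e (suc j) (ℕ.s≤s j<L))))
        (≈⇒~ (solve 6 (λ x y a b c d → (x :* a :+ y :* b) :+ (x :* c :+ y :* d) := x :* (a :+ c) :+ y :* (b :+ d))
           refl x y (g 0) (h 0) (sum L (g ∘ suc)) (sum L (h ∘ suc)))))

  module _ (h : ℕ) (N C : Carrier) (t : ℕ → Carrier) where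
    weighted : ℕ → Carrier
    weighted j = (- q) ^ (h ∸ j) * t j

    -- This is `q` times the right-hand side of the theorem, for C = 2(a-b) and `theta n` = q ϑ_n.
    value : ℕ → Carrier
    value n = (- q) ^ h * (N * (q + C * (theta n - q)))

    private
      -- The weight `u` is (-q)^{h-j} with j = l + 1. Relative to (-q)^h, the first binomial
      -- coefficient of the bracket gets q (-1)^j q^{C(j,2)} and the second, because C(j,2) - j + 1
      -- = C(j-1,2), gets -(-1)^{j-1} q^{C(j-1,2)}: a term of q S_n and a term of -S_{n-2}.
      weight-split : ∀ l u → (- q) ^ h ≈ u * (- sign l * (q * q ^ l)) → ∀ r T →
        T ~ N * C * (q ^ triangle (suc l) * (q ^ suc l * gauss q r (suc l) + gauss q r l)) →
        ∀ n′ → n′ ≡ l ℕ.+ l ℕ.+ r →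
        q * (u * T) ~ N * C * ((- q) ^ h) * q * schur-term (suc (suc n′)) (suc l) + - (N * C * ((- q) ^ h)) * schur-term n′ l
      weight-split l u hu r T T~ n′ ≡.refl = ~-trans (~-*-cong (≈⇒~ refl) (~-*-cong (≈⇒~ refl) T~)) (≈⇒~ (begin
        q * (u * (n * (q ^ triangle (suc l) * (q * y * g + g′))))
          ≈⟨ *-congˡ (*-congˡ (*-congˡ (*-congʳ (^-homo-* q (triangle l) l)))) ⟩
        q * (u * (n * (p * y * (q * y * g + g′))))
          ≈⟨ *-identityˡ _ ⟨
        -- Inserting the square of the sign supplies the sign that is missing to assemble (-q)^h
        -- from `u`.
        1# * (q * (u * (n * (p * y * (q * y * g + g′)))))
          ≈⟨ *-congʳ (sign² l) ⟨
        σ * σ * (q * (u * (n * (p * y * (q * y * g + g′)))))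
          ≈⟨ step₁ ⟩
        n * (u * (- σ * (q * y))) * (q * (- σ * (p * y) * g) - σ * p * g′)
          ≈⟨ *-congʳ (*-congˡ hu) ⟨
        n * H * (q * (- σ * (p * y) * g) - σ * p * g′)
          ≈⟨ solve 4 (λ nH q x z → nH :* (q :* x :- z) := nH :* q :* x :+ :- nH :* z) refl (n * H) q (- σ * (p * y) * g) (σ * p * g′) ⟩
        n * H * q * (- σ * (p * y) * g) + - (n * H) * (σ * p * g′)
          ≈⟨ +-cong (*-congˡ (*-cong (*-congˡ (sym (^-homo-* q (triangle l) l))) (sym g≈))) (*-congˡ (*-congˡ (sym (antidiagonal-gauss r l)))) ⟩
        n * H * q * schur-term (suc (suc (l ℕ.+ l ℕ.+ r))) (suc l) + - (n * H) * schur-term (l ℕ.+ l ℕ.+ r) l ∎))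
        where
        n = N * C
        H = (- q) ^ h
        y = q ^ l
        p = q ^ triangle l
        σ = sign l
        g = gauss q r (suc l)
        g′ = gauss q r l
        g≈ : antidiagonal (suc (suc (l ℕ.+ l ℕ.+ r))) (suc l) ≈ g
        g≈ = trans (reflexive (≡.cong (λ k → antidiagonal (suc k ℕ.+ r) (suc l)) (≡.sym (ℕₚ.+-suc l l)))) (antidiagonal-gauss r (suc l))
        step₁ : σ * σ * (q * (u * (n * (p * y * (q * y * g + g′))))) ≈ n * (u * (- σ * (q * y))) * (q * (- σ * (p * y) * g) - σ * p * g′)
        step₁ = begin
          σ * σ * (q * (u * (n * (p * y * (q * y * g + g′)))))
            ≈⟨ *-congˡ (solve 6 (λ q u n p y w → q :* (u :* (n :* (p :* y :* w))) := n :* u :* (q :* y) :* (p :* w)) refl q u n p y (q * y * g + g′)) ⟩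
          σ * σ * (n * u * (q * y) * (p * (q * y * g + g′)))
            ≈⟨ solve 4 (λ σ nu qy w → σ :* σ :* (nu :* qy :* w) := nu :* (:- σ :* qy) :* (:- σ :* w)) refl σ (n * u) (q * y) (p * (q * y * g + g′)) ⟩
          n * u * (- σ * (q * y)) * (- σ * (p * (q * y * g + g′)))
            ≈⟨ *-cong (*-assoc _ _ _) (solve 6 (λ σ p q y g g′ → :- σ :* (p :* (q :* y :* g :+ g′)) := q :* (:- σ :* (p :* y) :* g) :- σ :* p :* g′) refl σ p q y g g′) ⟩
          n * (u * (- σ * (q * y))) * (q * (- σ * (p * y) * g) - σ * p * g′) ∎

    truncated-sum : t 0 ≈ N → ∀ n L → 0 ℕ.< n → L ℕ.≤ h → L ℕ.+ L ℕ.≤ n → n ℕ.< suc L ℕ.+ suc L →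
      (∀ l r → suc l ℕ.≤ L → suc l ℕ.+ suc l ℕ.+ r ≡ n →
        t (suc l) ~ N * C * (q ^ triangle (suc l) * (q ^ suc l * gauss q r (suc l) + gauss q r l))) →
      q * sum (suc L) weighted ~ value n
    -- Only j = 0 occurs for n = 1, and `theta 1` equals `q`, so that the multiple of `C` vanishes.
    truncated-sum t₀ (suc zero) zero _ _ _ _ _ = ≈⇒~ (begin
      q * (H * t 0 + 0#)                       ≈⟨ *-congˡ (+-congʳ (*-congˡ t₀)) ⟩
      q * (H * N + 0#)                         ≈⟨ solve 4 (λ q H N C → q :* (H :* N :+ con (+ 0))
                                                    := H :* (N :* (q :+ C :* (q :* con (+ 1) :- q)))) refl q H N C ⟩
      H * (N * (q + C * (q * 1# - q)))         ≈⟨ *-congˡ (*-congˡ (+-congˡ (*-congˡ (+-congʳ (*-congˡ schur-1))))) ⟨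
      value 1                                  ∎)
      where
      H = (- q) ^ h
      schur-1 : schur 1 ≈ 1#
      schur-1 = solve 0 (con (+ 1) :* con (+ 1) :* con (+ 1) :+ (:- con (+ 1) :* con (+ 1) :* con (+ 0) :+ con (+ 0)) := con (+ 1)) refl
    truncated-sum t₀ (suc zero) (suc L) _ _ (ℕ.s≤s 2L≤0) =
      ⊥-elim (ℕₚ.n≮0 (≡.subst (ℕ._≤ 0) (ℕₚ.+-suc L L) 2L≤0))
    truncated-sum t₀ n@(suc (suc n′)) L _ L≤h 2L≤n n<2L+2 t~ =
      ~-trans (≈⇒~ (begin
        q * (H * t 0 + sum L (weighted ∘ suc))      ≈⟨ *-congˡ (+-congʳ (*-congˡ t₀)) ⟩
        q * (H * N + sum L (weighted ∘ suc))        ≈⟨ distribˡ _ _ _ ⟩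
        q * (H * N) + q * sum L (weighted ∘ suc)    ∎))
      (~-trans (~-+-cong (≈⇒~ refl) (sum-linear-~ {q} {N * C * H * q} { - (N * C * H)} {weighted ∘ suc} {schur-term n ∘ suc} {schur-term n′} L term))
      (≈⇒~ (begin
        q * (H * N) + (N * C * H * q * Σ₁ + - (N * C * H) * partial-schur L n′)
          ≈⟨ +-congˡ (+-cong (*-congˡ Σ₁≈) (*-congˡ (partial≈schur L n′ n′<2L))) ⟩
        q * (H * N) + (N * C * H * q * (schur n - 1#) + - (N * C * H) * schur n′)
          ≈⟨ solve 6 (λ q H N C s s′ → q :* (H :* N) :+ (N :* C :* H :* q :* (s :- con (+ 1)) :+ :- (N :* C :* H) :* s′)
                := H :* (N :* (q :+ C :* (q :* s :- s′ :- q)))) refl q H N C (schur n) (schur n′) ⟩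
        value n ∎)))
      where
      H = (- q) ^ h
      Σ₁ = sum L (schur-term n ∘ suc)
      n′<2L : n′ ℕ.< L ℕ.+ L
      n′<2L = ℕ.s≤s⁻¹ (≡.subst (suc n′ ℕ.<_) (ℕₚ.+-suc L L) (ℕ.s≤s⁻¹ n<2L+2))
      Σ₁≈ : Σ₁ ≈ schur n - 1#
      Σ₁≈ = begin
        Σ₁                               ≈⟨ solve 1 (λ x → x := con (+ 1) :* con (+ 1) :* con (+ 1) :+ x :- con (+ 1)) refl Σ₁ ⟩
        partial-schur (suc L) n - 1#     ≈⟨ +-congʳ (partial≈schur (suc L) n n<2L+2) ⟩
        schur n - 1#                     ∎
      term : ∀ l → l ℕ.< L → q * weighted (suc l) ~ N * C * H * q * schur-term n (suc l) + - (N * C * H) * schur-term n′ l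
      term l l<L = weight-split l ((- q) ^ (h ∸ suc l)) split (n′ ∸ (l ℕ.+ l)) (t (suc l)) (t~ l (n′ ∸ (l ℕ.+ l)) l<L n≡) n′ n′≡
        where
        2l≤n′ : l ℕ.+ l ℕ.≤ n′
        2l≤n′ = ℕ.s≤s⁻¹ (ℕ.s≤s⁻¹ (ℕₚ.≤-trans (≡.subst (ℕ._≤ L ℕ.+ L) (≡.cong suc (ℕₚ.+-suc l l)) (ℕₚ.+-mono-≤ l<L l<L)) 2L≤n))
        n′≡ : n′ ≡ l ℕ.+ l ℕ.+ (n′ ∸ (l ℕ.+ l))
        n′≡ = ≡.sym (ℕₚ.m+[n∸m]≡n 2l≤n′)
        n≡ : suc l ℕ.+ suc l ℕ.+ (n′ ∸ (l ℕ.+ l)) ≡ n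
        n≡ = ≡.trans (≡.cong (λ k → suc k ℕ.+ (n′ ∸ (l ℕ.+ l))) (ℕₚ.+-suc l l)) (≡.cong (λ k → suc (suc k)) (≡.sym n′≡))
        split : H ≈ (- q) ^ (h ∸ suc l) * (- sign l * (q * q ^ l))
        split = begin
          H                                            ≡⟨ ≡.cong ((- q) ^_) (≡.sym (ℕₚ.m∸n+n≡m (ℕₚ.≤-trans l<L L≤h))) ⟩
          (- q) ^ (h ∸ suc l ℕ.+ suc l)                ≈⟨ ^-homo-* (- q) (h ∸ suc l) (suc l) ⟩
          (- q) ^ (h ∸ suc l) * (- q) ^ suc l          ≈⟨ *-congˡ (neg-^ (suc l)) ⟩
          (- q) ^ (h ∸ suc l) * (- sign l * (q * q ^ l)) ∎

-- Coprimality of q^k - 1 and factors of q^n - 1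

module Coprimality {c ℓ} (R : CommutativeRing c ℓ) where
  open CommutativeRing R
  open SetoidReasoning setoid
  open IntegerSolver R
  open QCalculus R

  infix 4 _⊥_ _∣_
  record _∣_ (x y : Carrier) : Set (c ⊔ ℓ) where
    constructor factors
    field
      cofactor : Carrier
      equation : x * cofactor ≈ y

  ∣-refl : ∀ {x} → x ∣ x
  ∣-refl = factors 1# (*-identityʳ _)

  ∣-trans : ∀ {x y z} → x ∣ y → y ∣ z → x ∣ z
  ∣-trans (factors a e) (factors b f) = factors (a * b) (trans (sym (*-assoc _ _ _)) (trans (*-congʳ e) f))

  ∣-*ˡ : ∀ {x y} z → x ∣ y → x ∣ z * y
  ∣-*ˡ {x} z (factors a e) = factors (z * a) (trans (solve 3 (λ x z a → x :* (z :* a) := z :* (x :* a)) refl x z a) (*-congˡ e))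

  *-mono-∣ : ∀ {x y} z → x ∣ y → z * x ∣ z * y
  *-mono-∣ z (factors a e) = factors a (trans (*-assoc _ _ _) (*-congˡ e))

  -- Coprimality after inverting the positive integers.
  record _⊥_ (x y : Carrier) : Set (c ⊔ ℓ) where
    constructor bézout
    field
      {u v}    : Carrier
      {k}      : ℕ
      equation : u * x + v * y ≈ natural (suc k)

  ⊥-sym : ∀ {x y} → x ⊥ y → y ⊥ x
  ⊥-sym (bézout {u} {v} {k} e) = bézout {k = k} (trans (+-comm _ _) e)

  ⊥-oneʳ : ∀ x → x ⊥ 1#
  ⊥-oneʳ x = bézout {u = 0#} {v = 1#} {k = 0} (solve 1 (λ x → con (+ 0) :* x :+ con (+ 1) :* con (+ 1) := con (+ 1)) refl x)

  -- The product of the two Bézout identities: apart from v v′ y z every term contains x. The new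
  -- `k` makes its successor equal to `suc k ℕ.* suc k′` by computation.
  ⊥-*ʳ : ∀ {x y z} → x ⊥ y → x ⊥ z → x ⊥ y * z
  ⊥-*ʳ {x} {y} {z} (bézout {u} {v} {k} e) (bézout {u′} {v′} {k′} e′) =
    bézout {u = u * (u′ * x + v′ * z) + v * y * u′} {v = v * v′} {k = k′ ℕ.+ k ℕ.* suc k′} (begin
      (u * (u′ * x + v′ * z) + v * y * u′) * x + v * v′ * (y * z)
        ≈⟨ regroup ⟩
      (u * x + v * y) * (u′ * x + v′ * z)      ≈⟨ *-cong e e′ ⟩
      natural (suc k) * natural (suc k′)       ≈⟨ natural-* (suc k) (suc k′) ⟨
      natural (suc k ℕ.* suc k′)               ∎)
    where
    regroup = begin
      (u * (u′ * x + v′ * z) + v * y * u′) * x + v * v′ * (y * z)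
        ≈⟨ +-congˡ (solve 4 (λ v v′ y z → v :* v′ :* (y :* z) := v :* y :* (v′ :* z)) refl v v′ y z) ⟩
      (u * (u′ * x + v′ * z) + v * y * u′) * x + v * y * (v′ * z)
        ≈⟨ solve 5 (λ u vy u′ x w → (u :* (u′ :* x :+ w) :+ vy :* u′) :* x :+ vy :* w := (u :* x :+ vy) :* (u′ :* x :+ w))
             refl u (v * y) u′ x (v′ * z) ⟩
      (u * x + v * y) * (u′ * x + v′ * z) ∎

  ⊥-∣ʳ : ∀ {x y z} → x ⊥ z → y ∣ z → x ⊥ y
  ⊥-∣ʳ {x} {y} {z} (bézout {u} {v} {k} e) (factors a f) = bézout {u = u} {v = v * a} {k = k}
    (trans (+-congˡ (trans (*-assoc v a y) (*-congˡ (trans (*-comm a y) f)))) e)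

  -- Euclid's lemma. The integer of the Bézout identity stays in the conclusion, to be removed where
  -- `y` is known to be monic.
  ⊥-cancel : ∀ {x y z} (x⊥y : x ⊥ y) → y ∣ x * z → y ∣ natural (suc (_⊥_.k x⊥y)) * z
  ⊥-cancel {x} {y} {z} (bézout {u} {v} {k} e) (factors a f) = factors (u * a + v * z) (begin
    y * (u * a + v * z)       ≈⟨ solve 5 (λ y u a v z → y :* (u :* a :+ v :* z) := u :* (y :* a) :+ v :* y :* z) refl y u a v z ⟩
    u * (y * a) + v * y * z   ≈⟨ +-congʳ (*-congˡ f) ⟩
    u * (x * z) + v * y * z   ≈⟨ solve 5 (λ u x z v y → u :* (x :* z) :+ v :* y :* z := (u :* x :+ v :* y) :* z) refl u x z v y ⟩
    (u * x + v * y) * z       ≈⟨ *-congʳ e ⟩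
    natural (suc k) * z       ∎)

  ⊥-product : ∀ {x y z} (x⊥y : x ⊥ y) → x ∣ z → y ∣ z → x * y ∣ natural (suc (_⊥_.k x⊥y)) * z
  ⊥-product {x} {y} {z} (bézout {u} {v} {k} e) (factors a f) (factors b g) = factors (u * b + v * a) (begin
    x * y * (u * b + v * a)              ≈⟨ solve 6 (λ x y u b v a → x :* y :* (u :* b :+ v :* a) := u :* x :* (y :* b) :+ v :* y :* (x :* a)) refl x y u b v a ⟩
    u * x * (y * b) + v * y * (x * a)    ≈⟨ +-cong (*-congˡ g) (*-congˡ f) ⟩
    u * x * z + v * y * z                ≈⟨ distribʳ _ _ _ ⟨
    (u * x + v * y) * z                  ≈⟨ *-congʳ e ⟩
    natural (suc k) * z                  ∎)

  module _ (q : Carrier) where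
    bracket-∣ : ∀ {m n} → m ℕ∣.∣ n → [ q ^ m -1] ∣ [ q ^ n -1]
    bracket-∣ {m} (divides t ≡.refl) = factors (proj₁ (Supercongruence.bracket-multiple R q m t)) (sym (proj₁ (proj₂ (Supercongruence.bracket-multiple R q m t))))

    private
      -- From (q^i - 1) - q^d (q^j - 1) = q^d - 1 for i = d + j. Bézout's identity for the exponents
      -- thus carries over to the brackets, with no integer factor.
      bézout-step : ∀ {d i j m n} → d ℕ.+ j ≡ i → [ q ^ m -1] ∣ [ q ^ i -1] → [ q ^ n -1] ∣ [ q ^ j -1] →
        ∃[ u ] ∃[ v ] (u * [ q ^ m -1] + v * [ q ^ n -1] ≈ [ q ^ d -1])
      bézout-step {d} {i} {j} {m} {n} e (factors a f) (factors b g) = a , - (q ^ d * b) , (begin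
        a * M + - (q ^ d * b) * N       ≈⟨ solve 5 (λ a M x b N → a :* M :+ :- (x :* b) :* N := M :* a :- x :* (N :* b)) refl a M (q ^ d) b N ⟩
        M * a - q ^ d * (N * b)         ≈⟨ +-cong f (-‿cong (*-congˡ g)) ⟩
        [ q ^ i -1] - q ^ d * [ q ^ j -1]  ≈⟨ +-congʳ (+-congʳ (trans (^-≡ q (≡.sym e)) (^-homo-* q d j))) ⟩
        (q ^ d * q ^ j - 1#) - q ^ d * (q ^ j - 1#)  ≈⟨ solve 2 (λ x y → (x :* y :- con (+ 1)) :- x :* (y :- con (+ 1)) := x :- con (+ 1)) refl (q ^ d) (q ^ j) ⟩
        [ q ^ d -1]                     ∎)
        where
        M = [ q ^ m -1]
        N = [ q ^ n -1]

    bracket-bézout : ∀ m n → ∃[ u ] ∃[ v ] (u * [ q ^ m -1] + v * [ q ^ n -1] ≈ [ q ^ gcd m n -1])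
    bracket-bézout m n = from (Bézout.identity (gcd-GCD m n))
      where
      from : Bézout.Identity (gcd m n) m n → ∃[ u ] ∃[ v ] (u * [ q ^ m -1] + v * [ q ^ n -1] ≈ [ q ^ gcd m n -1])
      from (Bézout.Identity.+- x y e) =
        bézout-step {gcd m n} {x ℕ.* m} {y ℕ.* n} {m} {n} e (bracket-∣ (divides x ≡.refl)) (bracket-∣ (divides y ≡.refl))
      from (Bézout.Identity.-+ x y e) =
        let u , v , f = bézout-step {gcd m n} {y ℕ.* n} {x ℕ.* m} {n} {m} e (bracket-∣ (divides y ≡.refl)) (bracket-∣ (divides x ≡.refl))
        in v , u , trans (+-comm _ _) f

    -- With d = gcd k n, the factor f divides (q^n - 1)/(q^d - 1), which is n/d modulo q^d - 1.
    bracket-⊥ : ∀ k n (f : Carrier) →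
      (∀ {x y} → [ q ^ gcd k (suc n) -1] * x ≈ [ q ^ gcd k (suc n) -1] * y → x ≈ y) →
      [ q ^ gcd k (suc n) -1] * f ∣ [ q ^ suc n -1] → [ q ^ k -1] ⊥ f
    bracket-⊥ k n f cancel (factors C e) = from (gcd[m,n]∣n k (suc n))
      where
      g = gcd k (suc n)
      D K : Carrier
      D = [ q ^ g -1]
      K = [ q ^ k -1]
      u = proj₁ (bracket-bézout k (suc n))
      v = proj₁ (proj₂ (bracket-bézout k (suc n)))
      split : ∀ s u v → - (s * u) * K + (C - s * (v * (D * C))) * f ≈ C * f - s * (u * K + v * (D * f * C))
      split s u v = begin
        - (s * u) * K + (C - s * (v * (D * C))) * f
          ≈⟨ solve 5 (λ s w C y f → y :+ (C :- s :* w) :* f := C :* f :+ (y :- s :* (w :* f))) refl s (v * (D * C)) C (- (s * u) * K) f ⟩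
        C * f + (- (s * u) * K - s * (v * (D * C) * f))
          ≈⟨ +-congˡ (+-congˡ (-‿cong (*-congˡ (solve 4 (λ v D C f → v :* (D :* C) :* f := v :* (D :* f :* C)) refl v D C f)))) ⟩
        C * f + (- (s * u) * K - s * (v * (D * f * C)))
          ≈⟨ +-congˡ (solve 4 (λ s u K w → :- (s :* u) :* K :- s :* w := :- (s :* (u :* K :+ w))) refl s u K (v * (D * f * C))) ⟩
        C * f - s * (u * K + v * (D * f * C)) ∎
      from : g ℕ∣.∣ suc n → K ⊥ f
      from (divides (suc t) n≡) = bézout {u = - (s * u)} {v = C - s * (v * (D * C))} {k = t} (begin
        - (s * u) * K + (C - s * (v * (D * C))) * f
          ≈⟨ split s u v ⟩
        C * f - s * (u * K + v * (D * f * C))  ≈⟨ +-cong (trans (*-comm C f) fC≈G) (-‿cong (*-congˡ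
                                                    (trans (+-congˡ (*-congˡ e)) (proj₂ (proj₂ (bracket-bézout k (suc n))))))) ⟩
        G - s * D                              ≈⟨ +-congʳ (Quotient._~_.equation G~t) ⟩
        natural (suc t) + D * s - s * D        ≈⟨ solve 3 (λ t D s → t :+ D :* s :- s :* D := t) refl (natural (suc t)) D s ⟩
        natural (suc t)                        ∎)
        where
        G = proj₁ (Supercongruence.bracket-multiple R q g (suc t))
        G-equation = proj₁ (proj₂ (Supercongruence.bracket-multiple R q g (suc t)))
        G~t = proj₂ (proj₂ (Supercongruence.bracket-multiple R q g (suc t)))
        s = Quotient._~_.factor G~t
        fC≈G : f * C ≈ G
        fC≈G = cancel (begin
          D * (f * C)                    ≈⟨ *-assoc _ _ _ ⟨
          D * f * C                      ≈⟨ e ⟩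
          [ q ^ suc n -1]                ≡⟨ ≡.cong [ q ^_-1] n≡ ⟩
          [ q ^ (suc t ℕ.* g) -1]        ≈⟨ G-equation ⟩
          D * G                          ∎)

-- Polynomials over ℤ

-- _≈P_ unfolds to a function type, from which its arguments cannot be inferred.
infix 4 _≋_
record _≋_ (p r : Poly) : Set where
  constructor coefficientwise
  field at : p ≈P r
open _≋_ public

≋-setoid : Setoid _ _
≋-setoid = record
  { Carrier = Poly ; _≈_ = _≋_
  ; isEquivalence = record
    { refl  = coefficientwise λ i → ≡.refl
    ; sym   = λ e → coefficientwise λ i → ≡.sym (at e i)
    ; trans = λ e f → coefficientwise λ i → ≡.trans (at e i) (at f i) } }

coeff-+ : ∀ p r i → coeff (p +P r) i ≡ coeff p i ℤ.+ coeff r i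
coeff-+ []      r       i       = ≡.sym (ℤₚ.+-identityˡ (coeff r i))
coeff-+ (a ∷ p) []      zero    = ≡.sym (ℤₚ.+-identityʳ a)
coeff-+ (a ∷ p) []      (suc i) = ≡.sym (ℤₚ.+-identityʳ (coeff p i))
coeff-+ (a ∷ p) (b ∷ r) zero    = ≡.refl
coeff-+ (a ∷ p) (b ∷ r) (suc i) = coeff-+ p r i

coeff-neg : ∀ p i → coeff (negP p) i ≡ ℤ.- coeff p i
coeff-neg []      i       = ≡.refl
coeff-neg (a ∷ p) zero    = ≡.refl
coeff-neg (a ∷ p) (suc i) = coeff-neg p i

coeff-scale : ∀ c p i → coeff (scaleP c p) i ≡ c ℤ.* coeff p i
coeff-scale c []      i       = ≡.sym (ℤₚ.*-zeroʳ c)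
coeff-scale c (a ∷ p) zero    = ≡.refl
coeff-scale c (a ∷ p) (suc i) = coeff-scale c p i

private
  module P = Setoid ≋-setoid

  ∷-cong : ∀ {a b p r} → a ≡ b → p ≋ r → a ∷ p ≋ b ∷ r
  ∷-cong {a} {b} {p} {r} a≡b p≋r = coefficientwise λ { zero → a≡b ; (suc i) → at p≋r i }

  +-cong : ∀ {p p′ r r′} → p ≋ p′ → r ≋ r′ → p +P r ≋ p′ +P r′
  +-cong {p} {p′} {r} {r′} e f = coefficientwise λ i →
    ≡.trans (coeff-+ p r i) (≡.trans (≡.cong₂ ℤ._+_ (at e i) (at f i)) (≡.sym (coeff-+ p′ r′ i)))

  +-assoc : ∀ p r s → (p +P r) +P s ≋ p +P (r +P s)
  +-assoc p r s = coefficientwise λ i → begin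
    coeff ((p +P r) +P s) i               ≡⟨ coeff-+ (p +P r) s i ⟩
    coeff (p +P r) i ℤ.+ coeff s i        ≡⟨ ≡.cong (ℤ._+ coeff s i) (coeff-+ p r i) ⟩
    coeff p i ℤ.+ coeff r i ℤ.+ coeff s i ≡⟨ ℤₚ.+-assoc (coeff p i) _ _ ⟩
    coeff p i ℤ.+ (coeff r i ℤ.+ coeff s i) ≡⟨ ≡.cong₂ ℤ._+_ (≡.refl {x = coeff p i}) (coeff-+ r s i) ⟨
    coeff p i ℤ.+ coeff (r +P s) i        ≡⟨ coeff-+ p (r +P s) i ⟨
    coeff (p +P (r +P s)) i               ∎
    where open ≡.≡-Reasoning

  +-comm : ∀ p r → p +P r ≋ r +P p
  +-comm p r = coefficientwise λ i →
    ≡.trans (coeff-+ p r i) (≡.trans (ℤₚ.+-comm (coeff p i) _) (≡.sym (coeff-+ r p i)))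

  +-identityʳ : ∀ p → p +P [] ≋ p
  +-identityʳ p = +-comm p []

  +-inverseˡ : ∀ p → negP p +P p ≋ []
  +-inverseˡ p = coefficientwise λ i →
    ≡.trans (coeff-+ (negP p) p i) (≡.trans (≡.cong (ℤ._+ coeff p i) (coeff-neg p i)) (ℤₚ.+-inverseˡ (coeff p i)))

  neg-cong : ∀ {p r} → p ≋ r → negP p ≋ negP r
  neg-cong {p} {r} e = coefficientwise λ i →
    ≡.trans (coeff-neg p i) (≡.trans (≡.cong ℤ.-_ (at e i)) (≡.sym (coeff-neg r i)))

  scale-cong : ∀ c {p r} → p ≋ r → scaleP c p ≋ scaleP c r
  scale-cong c {p} {r} e = coefficientwise λ i →
    ≡.trans (coeff-scale c p i) (≡.trans (≡.cong (c ℤ.*_) (at e i)) (≡.sym (coeff-scale c r i)))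

  scale-+ : ∀ c p r → scaleP c (p +P r) ≋ scaleP c p +P scaleP c r
  scale-+ c p r = coefficientwise λ i → begin
    coeff (scaleP c (p +P r)) i                       ≡⟨ coeff-scale c (p +P r) i ⟩
    c ℤ.* coeff (p +P r) i                            ≡⟨ ≡.cong (c ℤ.*_) (coeff-+ p r i) ⟩
    c ℤ.* (coeff p i ℤ.+ coeff r i)                   ≡⟨ ℤₚ.*-distribˡ-+ c (coeff p i) _ ⟩
    c ℤ.* coeff p i ℤ.+ c ℤ.* coeff r i               ≡⟨ ≡.cong₂ ℤ._+_ (coeff-scale c p i) (coeff-scale c r i) ⟨
    coeff (scaleP c p) i ℤ.+ coeff (scaleP c r) i     ≡⟨ coeff-+ (scaleP c p) (scaleP c r) i ⟨
    coeff (scaleP c p +P scaleP c r) i                ∎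
    where open ≡.≡-Reasoning

  scale-scale : ∀ c d p → scaleP c (scaleP d p) ≋ scaleP (c ℤ.* d) p
  scale-scale c d p = coefficientwise λ i →
    ≡.trans (coeff-scale c (scaleP d p) i) (≡.trans (≡.cong (c ℤ.*_) (coeff-scale d p i))
      (≡.trans (≡.sym (ℤₚ.*-assoc c d _)) (≡.sym (coeff-scale (c ℤ.* d) p i))))

  scale-0 : ∀ p → scaleP (+ 0) p ≋ []
  scale-0 p = coefficientwise (coeff-scale (+ 0) p)

  scale-1 : ∀ p → scaleP (+ 1) p ≋ p
  scale-1 p = coefficientwise λ i → ≡.trans (coeff-scale (+ 1) p i) (ℤₚ.*-identityˡ _)

  0∷[] : + 0 ∷ [] ≋ []
  0∷[] = coefficientwise λ { zero → ≡.refl ; (suc i) → ≡.refl }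

  open SetoidReasoning ≋-setoid

  +-congˡ : ∀ p {r r′} → r ≋ r′ → p +P r ≋ p +P r′
  +-congˡ p = +-cong (P.refl {p})

  +-congʳ : ∀ p {r r′} → r ≋ r′ → r +P p ≋ r′ +P p
  +-congʳ p e = +-cong e (P.refl {p})

  +-middle : ∀ p r s t → (p +P r) +P (s +P t) ≋ (p +P s) +P (r +P t)
  +-middle p r s t = begin
    (p +P r) +P (s +P t)  ≈⟨ +-assoc p r (s +P t) ⟩
    p +P (r +P (s +P t))  ≈⟨ +-congˡ p (+-assoc r s t) ⟨
    p +P ((r +P s) +P t)  ≈⟨ +-congˡ p (+-congʳ t (+-comm r s)) ⟩
    p +P ((s +P r) +P t)  ≈⟨ +-congˡ p (+-assoc s r t) ⟩
    p +P (s +P (r +P t))  ≈⟨ +-assoc p s (r +P t) ⟨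
    (p +P s) +P (r +P t)  ∎

  *-congˡ : ∀ p {r r′} → r ≋ r′ → p *P r ≋ p *P r′
  *-congˡ []      e = P.refl
  *-congˡ (a ∷ p) e = +-cong (scale-cong a e) (∷-cong ≡.refl (*-congˡ p e))

  *-zeroʳ : ∀ p → p *P [] ≋ []
  *-zeroʳ []      = P.refl
  *-zeroʳ (a ∷ p) = P.trans (∷-cong ≡.refl (*-zeroʳ p)) 0∷[]

  -- The mirror image of the recursion that defines `_*P_`; commutativity comes from comparing the
  -- two.
  *-∷ : ∀ r a p → r *P (a ∷ p) ≋ scaleP a r +P (+ 0 ∷ (r *P p))
  *-∷ []      a p = P.sym 0∷[]
  *-∷ (b ∷ r) a p = ∷-cong (≡.cong (ℤ._+ + 0) (ℤₚ.*-comm b a)) (begin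
    scaleP b p +P (r *P (a ∷ p))                            ≈⟨ +-congˡ (scaleP b p) (*-∷ r a p) ⟩
    scaleP b p +P (scaleP a r +P (+ 0 ∷ (r *P p)))          ≈⟨ +-assoc (scaleP b p) (scaleP a r) _ ⟨
    (scaleP b p +P scaleP a r) +P (+ 0 ∷ (r *P p))          ≈⟨ +-congʳ (+ 0 ∷ (r *P p)) (+-comm (scaleP b p) (scaleP a r)) ⟩
    (scaleP a r +P scaleP b p) +P (+ 0 ∷ (r *P p))          ≈⟨ +-assoc (scaleP a r) (scaleP b p) _ ⟩
    scaleP a r +P (scaleP b p +P (+ 0 ∷ (r *P p)))          ∎)

  *-comm : ∀ p r → p *P r ≋ r *P p
  *-comm []      r = P.sym (*-zeroʳ r)
  *-comm (a ∷ p) r = P.trans (+-congˡ (scaleP a r) (∷-cong ≡.refl (*-comm p r))) (P.sym (*-∷ r a p))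

  *-cong : ∀ {p p′ r r′} → p ≋ p′ → r ≋ r′ → p *P r ≋ p′ *P r′
  *-cong {p} {p′} {r} {r′} e f = begin
    p *P r    ≈⟨ *-congˡ p f ⟩
    p *P r′   ≈⟨ *-comm p r′ ⟩
    r′ *P p   ≈⟨ *-congˡ r′ e ⟩
    r′ *P p′  ≈⟨ *-comm r′ p′ ⟩
    p′ *P r′  ∎

  *-distribˡ : ∀ p r s → p *P (r +P s) ≋ (p *P r) +P (p *P s)
  *-distribˡ []      r s = P.refl
  *-distribˡ (a ∷ p) r s = begin
    scaleP a (r +P s) +P (+ 0 ∷ (p *P (r +P s)))
      ≈⟨ +-cong (scale-+ a r s) (∷-cong ≡.refl (*-distribˡ p r s)) ⟩
    (scaleP a r +P scaleP a s) +P ((+ 0 ∷ (p *P r)) +P (+ 0 ∷ (p *P s)))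
      ≈⟨ +-middle (scaleP a r) (scaleP a s) _ _ ⟩
    (scaleP a r +P (+ 0 ∷ (p *P r))) +P (scaleP a s +P (+ 0 ∷ (p *P s))) ∎

  *-distribʳ : ∀ s p r → (p +P r) *P s ≋ (p *P s) +P (r *P s)
  *-distribʳ s p r = begin
    (p +P r) *P s         ≈⟨ *-comm (p +P r) s ⟩
    s *P (p +P r)         ≈⟨ *-distribˡ s p r ⟩
    (s *P p) +P (s *P r)  ≈⟨ +-cong (*-comm s p) (*-comm s r) ⟩
    (p *P s) +P (r *P s)  ∎

  scale-* : ∀ c r s → scaleP c r *P s ≋ scaleP c (r *P s)
  scale-* c []      s = P.refl
  scale-* c (b ∷ r) s = begin
    scaleP (c ℤ.* b) s +P (+ 0 ∷ (scaleP c r *P s))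
      ≈⟨ +-cong (P.sym (scale-scale c b s)) (∷-cong (≡.sym (ℤₚ.*-zeroʳ c)) (scale-* c r s)) ⟩
    scaleP c (scaleP b s) +P scaleP c (+ 0 ∷ (r *P s))  ≈⟨ scale-+ c (scaleP b s) _ ⟨
    scaleP c (scaleP b s +P (+ 0 ∷ (r *P s)))           ∎

shift-* : ∀ r s → (+ 0 ∷ r) *P s ≋ + 0 ∷ (r *P s)
shift-* r s = +-congʳ (+ 0 ∷ (r *P s)) (scale-0 s)

constant-* : ∀ c p → (c ∷ []) *P p ≋ scaleP c p
constant-* c p = P.trans (+-congˡ (scaleP c p) 0∷[]) (+-identityʳ (scaleP c p))

private
  *-assoc : ∀ p r s → (p *P r) *P s ≋ p *P (r *P s)
  *-assoc []      r s = P.refl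
  *-assoc (a ∷ p) r s = begin
    (scaleP a r +P (+ 0 ∷ (p *P r))) *P s              ≈⟨ *-distribʳ s (scaleP a r) _ ⟩
    (scaleP a r *P s) +P ((+ 0 ∷ (p *P r)) *P s)       ≈⟨ +-cong (scale-* a r s) (shift-* (p *P r) s) ⟩
    scaleP a (r *P s) +P (+ 0 ∷ ((p *P r) *P s))       ≈⟨ +-congˡ (scaleP a (r *P s)) (∷-cong ≡.refl (*-assoc p r s)) ⟩
    scaleP a (r *P s) +P (+ 0 ∷ (p *P (r *P s)))       ∎

  *-identityˡ : ∀ p → oneP *P p ≋ p
  *-identityˡ p = P.trans (constant-* (+ 1) p) (scale-1 p)

polyRing : CommutativeRing _ _
polyRing = record
  { Carrier = Poly ; _≈_ = _≋_ ; _+_ = _+P_ ; _*_ = _*P_ ; -_ = negP ; 0# = [] ; 1# = oneP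
  ; isCommutativeRing = record
    { isRing = record
      { +-isAbelianGroup = record
        { isGroup = record
          { isMonoid = record
            { isSemigroup = record
              { isMagma = record { isEquivalence = P.isEquivalence ; ∙-cong = +-cong }
              ; assoc = +-assoc }
            ; identity = (λ p → P.refl) , +-identityʳ }
          ; inverse = +-inverseˡ , λ p → P.trans (+-comm p (negP p)) (+-inverseˡ p)
          ; ⁻¹-cong = neg-cong }
        ; comm = +-comm }
      ; *-cong = *-cong
      ; *-assoc = *-assoc
      ; *-identity = *-identityˡ , λ p → P.trans (*-comm p oneP) (*-identityˡ p)
      ; distrib = *-distribˡ , *-distribʳ }
    ; *-comm = *-comm } }

module PolyRing = CommutativeRing polyRing
open IntegerSolver polyRing using (natural; solve; _:=_; _:+_; _:*_; _:-_; :-_; con)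
open QCalculus polyRing using (_^_; ^-homo-*; [_^_-1]; rising; rising-front; qfactorial; gauss; gauss-rising)

powP≡^ : ∀ p k → powP p k ≡ p ^ k
powP≡^ p zero    = ≡.refl
powP≡^ p (suc k) = ≡.cong (p *P_) (powP≡^ p k)

X*-∷ : ∀ p → X *P p ≋ + 0 ∷ p
X*-∷ p = PolyRing.trans (shift-* (+ 1 ∷ []) p)
  (coefficientwise λ { zero → ≡.refl ; (suc i) → at (PolyRing.*-identityˡ p) i })

-- Degrees and monic polynomials

Below : ℕ → Poly → Set
Below d p = ∀ i → d ℕ.≤ i → coeff p i ≡ + 0

Below-cong : ∀ {d p r} → p ≋ r → Below d p → Below d r
Below-cong e b i d≤i = ≡.trans (≡.sym (at e i)) (b i d≤i)

Below-scale : ∀ {d} c p → Below d p → Below d (scaleP c p)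
Below-scale c p b i d≤i = ≡.trans (coeff-scale c p i) (≡.trans (≡.cong (c ℤ.*_) (b i d≤i)) (ℤₚ.*-zeroʳ c))

Below-length : ∀ p → Below (length p) p
Below-length []      i       _           = ≡.refl
Below-length (a ∷ p) (suc i) (ℕ.s≤s n≤i) = Below-length p i n≤i

-- Stated with bounds, since lists may end in zeros: `d` and `e` need not be the degrees, and the
-- coefficient at d + e may vanish.
product-top : ∀ p r d e → Below (suc d) p → Below (suc e) r →
  Below (suc (d ℕ.+ e)) (p *P r) × coeff (p *P r) (d ℕ.+ e) ≡ coeff p d ℤ.* coeff r e
product-top []      r d e p< r< = (λ i _ → ≡.refl) , ≡.refl
product-top (a ∷ p) r zero e p< r< = below , top
  where
  p≋0 : p ≋ []
  p≋0 = coefficientwise λ i → p< (suc i) (ℕ.s≤s ℕ.z≤n)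
  product : (a ∷ p) *P r ≋ scaleP a r
  product = PolyRing.trans (PolyRing.+-cong (PolyRing.refl {scaleP a r})
      (coefficientwise λ { zero → ≡.refl ; (suc i) → at (PolyRing.*-cong p≋0 (PolyRing.refl {r})) i }))
    (PolyRing.+-identityʳ (scaleP a r))
  below : Below (suc e) ((a ∷ p) *P r)
  below = Below-cong (PolyRing.sym product) (Below-scale a r r<)
  top : coeff ((a ∷ p) *P r) e ≡ a ℤ.* coeff r e
  top = ≡.trans (at product e) (coeff-scale a r e)
product-top (a ∷ p) r (suc d) e p< r< = below , top
  where
  induction = product-top p r d e (λ i d<i → p< (suc i) (ℕ.s≤s d<i)) r<
  coeff-suc : ∀ i → coeff ((a ∷ p) *P r) (suc i) ≡ a ℤ.* coeff r (suc i) ℤ.+ coeff (p *P r) i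
  coeff-suc i = ≡.trans (coeff-+ (scaleP a r) _ (suc i)) (≡.cong (ℤ._+ coeff (p *P r) i) (coeff-scale a r (suc i)))
  vanish : ∀ {i} → e ℕ.≤ i → a ℤ.* coeff r (suc i) ≡ + 0
  vanish e≤i = ≡.trans (≡.cong (a ℤ.*_) (r< _ (ℕ.s≤s e≤i))) (ℤₚ.*-zeroʳ a)
  below : Below (suc (suc d ℕ.+ e)) ((a ∷ p) *P r)
  below (suc i) (ℕ.s≤s d+e<i) = ≡.trans (coeff-suc i) (≡.cong₂ ℤ._+_
    (vanish (ℕₚ.≤-trans (ℕₚ.m≤n+m e (suc d)) d+e<i)) (proj₁ induction i d+e<i))
  top : coeff ((a ∷ p) *P r) (suc d ℕ.+ e) ≡ coeff p d ℤ.* coeff r e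
  top = ≡.trans (coeff-suc (d ℕ.+ e)) (≡.trans (≡.cong₂ ℤ._+_ (vanish (ℕₚ.m≤n+m e d)) (proj₂ induction)) (ℤₚ.+-identityˡ _))

record Degree (p : Poly) : Set where
  constructor degree
  field
    deg     : ℕ
    below   : Below (suc deg) p
    nonzero : coeff p deg ≢ + 0

zero-or-degree : ∀ p → p ≋ [] ⊎ Degree p
zero-or-degree []      = inj₁ PolyRing.refl
zero-or-degree (a ∷ p) with zero-or-degree p
... | inj₂ (degree d b n) = inj₂ (degree (suc d) (λ { (suc i) (ℕ.s≤s d<i) → b i d<i }) n)
... | inj₁ p≋0 with a ℤ.≟ + 0
...   | yes a≡0 = inj₁ (coefficientwise λ { zero → a≡0 ; (suc i) → at p≋0 i })
...   | no  a≢0 = inj₂ (degree 0 (λ { (suc i) _ → at p≋0 i }) a≢0)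

record Monic (p : Poly) : Set where
  constructor monic
  field
    deg   : ℕ
    below : Below (suc deg) p
    top   : coeff p deg ≡ + 1

1≢0 : + 1 ≢ + 0
1≢0 ()

Monic-cong : ∀ {p r} → p ≋ r → Monic p → Monic r
Monic-cong e (monic d b t) = monic d (Below-cong e b) (≡.trans (≡.sym (at e d)) t)

Monic-* : ∀ p r → Monic p → Monic r → Monic (p *P r)
Monic-* p r (monic d b t) (monic d′ b′ t′) = monic (d ℕ.+ d′) (proj₁ product)
  (≡.trans (proj₂ product) (≡.cong₂ ℤ._*_ t t′))
  where product = product-top p r d d′ b b′

Monic-one : Monic oneP
Monic-one = monic 0 (λ { (suc i) _ → ≡.refl }) ≡.refl

Monic-X : Monic X
Monic-X = monic 1 (λ { (suc (suc i)) _ → ≡.refl ; (suc zero) (ℕ.s≤s ()) }) ≡.refl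

-- The top coefficient of `M *P E` is that of `E`; comparing its position d + e with `f` leaves only
-- equality.
Monic-quotient : ∀ M E → Monic M → Monic (M *P E) → Monic E
Monic-quotient M E (monic d b t) (monic f b′ t′) with zero-or-degree E
... | inj₁ E≋0 = ⊥-elim (1≢0 (≡.trans (≡.sym t′)
        (at (PolyRing.trans (PolyRing.*-cong (PolyRing.refl {M}) E≋0) (PolyRing.zeroʳ M)) f)))
... | inj₂ (degree e bₑ n) with product-top M E d e b bₑ | ℕₚ.<-cmp (d ℕ.+ e) f
...   | product | tri< lt _ _ = ⊥-elim (1≢0 (≡.trans (≡.sym t′) (proj₁ product f lt)))
...   | product | tri> _ _ gt = ⊥-elim (n (≡.trans (≡.sym top) (b′ (d ℕ.+ e) gt)))
  where
  top : coeff (M *P E) (d ℕ.+ e) ≡ coeff E e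
  top = ≡.trans (proj₂ product) (≡.trans (≡.cong (ℤ._* coeff E e) t) (ℤₚ.*-identityˡ _))
...   | product | tri≈ _ ≡.refl _ = monic e bₑ (≡.trans (≡.sym top) t′)
  where
  top : coeff (M *P E) (d ℕ.+ e) ≡ coeff E e
  top = ≡.trans (proj₂ product) (≡.trans (≡.cong (ℤ._* coeff E e) t) (ℤₚ.*-identityˡ _))

-- Uniqueness of division with remainder, on which cancellation, exactness of `divMonic` and
-- saturation all rest.
multiple-below : ∀ M E → (m : Monic M) → Below (Monic.deg m) (M *P E) → E ≋ []
multiple-below M E (monic d b t) ME< with zero-or-degree E
... | inj₁ E≋0 = E≋0
... | inj₂ (degree e bₑ n) = ⊥-elim (n (≡.trans (≡.sym top) (ME< (d ℕ.+ e) (ℕₚ.m≤m+n d e))))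
  where
  top : coeff (M *P E) (d ℕ.+ e) ≡ coeff E e
  top = ≡.trans (proj₂ (product-top M E d e b bₑ)) (≡.trans (≡.cong (ℤ._* coeff E e) t) (ℤₚ.*-identityˡ _))

difference-zero : ∀ p r → p -P r ≋ [] → p ≋ r
difference-zero p r e = begin
  p               ≈⟨ solve 2 (λ p r → p := p :- r :+ r) PolyRing.refl p r ⟩
  (p -P r) +P r   ≈⟨ PolyRing.+-cong e (PolyRing.refl {r}) ⟩
  r               ∎

Monic-cancel : ∀ M p r → Monic M → M *P p ≋ M *P r → p ≋ r
Monic-cancel M p r m e = difference-zero p r (multiple-below M (p -P r) m (λ i _ → at zero-product i))
  where
  zero-product : M *P (p -P r) ≋ []
  zero-product = begin
    M *P (p -P r)         ≈⟨ solve 3 (λ M p r → M :* (p :- r) := M :* p :- M :* r) PolyRing.refl M p r ⟩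
    (M *P p) -P (M *P r)  ≈⟨ PolyRing.+-cong e (PolyRing.refl {negP (M *P r)}) ⟩
    (M *P r) -P (M *P r)  ≈⟨ PolyRing.-‿inverseʳ (M *P r) ⟩
    []                    ∎

-- `CoprimeP` asks for common divisors to be 1 or -1. Degrees add in a product over ℤ, so both
-- factors are constants, and absolute values decide the rest.
unit-constant : ∀ D E → D *P E ≋ oneP → IsUnitP D
unit-constant D E e with zero-or-degree D | zero-or-degree E
... | inj₁ D≋0 | _ = ⊥-elim (1≢0 (≡.trans (≡.sym (at e 0)) (at (PolyRing.*-cong D≋0 (PolyRing.refl {E})) 0)))
... | inj₂ _ | inj₁ E≋0 = ⊥-elim (1≢0 (≡.trans (≡.sym (at e 0))
        (at (PolyRing.trans (PolyRing.*-cong (PolyRing.refl {D}) E≋0) (PolyRing.zeroʳ D)) 0)))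
... | inj₂ (degree d b n) | inj₂ (degree e′ b′ n′) with product-top D E d e′ b b′
unit-constant D E e | inj₂ (degree zero b n) | inj₂ (degree zero b′ n′) | _ , top =
  [ inj₁ ∘ constant , inj₂ ∘ constant ]′ (±1 (coeff D 0) (coeff E 0) (≡.trans (≡.sym top) (at e 0)))
  where
  constant : ∀ {c} → coeff D 0 ≡ c → D ≈P (c ∷ [])
  constant D₀ zero    = D₀
  constant D₀ (suc i) = b (suc i) (ℕ.s≤s ℕ.z≤n)
  ±1 : ∀ x y → x ℤ.* y ≡ + 1 → x ≡ + 1 ⊎ x ≡ ℤ.- (+ 1)
  ±1 (+ n)    y xy≡1 = inj₁ (≡.cong +_ (ℕₚ.m*n≡1⇒m≡1 n ℤ.∣ y ∣ (≡.trans (≡.sym (ℤₚ.abs-* (+ n) y)) (≡.cong ℤ.∣_∣ xy≡1))))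
  ±1 -[1+ n ] y xy≡1 = inj₂ (≡.cong (λ k → ℤ.- (+ k))
    (ℕₚ.m*n≡1⇒m≡1 (suc n) ℤ.∣ y ∣ (≡.trans (≡.sym (ℤₚ.abs-* -[1+ n ] y)) (≡.cong ℤ.∣_∣ xy≡1))))
unit-constant D E e | inj₂ (degree zero b n) | inj₂ (degree (suc e′) b′ n′) | _ , top =
  ⊥-elim ([ n , n′ ]′ (ℤₚ.i*j≡0⇒i≡0∨j≡0 _ (≡.trans (≡.sym top) (at e (suc e′)))))
unit-constant D E e | inj₂ (degree (suc d) b n) | inj₂ (degree e′ b′ n′) | _ , top =
  ⊥-elim ([ n , n′ ]′ (ℤₚ.i*j≡0⇒i≡0∨j≡0 _ (≡.trans (≡.sym top) (at e (suc d ℕ.+ e′)))))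

-- Division by a monic polynomial

mutual
  -- longDiv and subPrefix are private to Defs; unification recovers them
  -- once reverse is generalised to a variable, so that it cannot block.
  longDivision : ℕ → List ℤ → List ℤ → List ℤ
  longDivision = _

  subtractPrefix : ℤ → List ℤ → List ℤ → List ℤ
  subtractPrefix = _

  divMonic-unfold : ∀ p d → divMonic p d ≡
    reverse (longDivision (length (highFirst p) ∸ length (drop 1 (highFirst d))) (drop 1 (highFirst d)) (highFirst p))
  divMonic-unfold p d with highFirst p | drop 1 (highFirst d)
  ... | p′ | ds with length p′ ∸ length ds
  ...   | k with foldl {A = List ℤ} {B = ℤ} (flip _∷_) []
  ...     | rev = ≡.refl

  longDivision-step : ∀ k ds c rs →
    longDivision (suc k) ds (c ∷ rs) ≡ c ∷ longDivision k ds (subtractPrefix c ds rs)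
  longDivision-step k ds c rs = ≡.refl

subtractPrefix-length : ∀ c ds rs → length (subtractPrefix c ds rs) ≡ length rs
subtractPrefix-length c []       rs       = ≡.refl
subtractPrefix-length c (d ∷ ds) []       = ≡.refl
subtractPrefix-length c (d ∷ ds) (r ∷ rs) = ≡.cong suc (subtractPrefix-length c ds rs)

longDivision-length : ∀ k ds l → length l ≡ k ℕ.+ length ds → length (longDivision k ds l) ≡ k
longDivision-length zero    ds l        e = ≡.refl
longDivision-length (suc k) ds (c ∷ rs) e = ≡.cong suc (longDivision-length k ds (subtractPrefix c ds rs)
  (≡.trans (subtractPrefix-length c ds rs) (ℕₚ.suc-injective e)))

-- The polynomial of a coefficient list with the highest degree first, the order in which long
-- division proceeds.
descending : List ℤ → Poly
descending []       = []
descending (c ∷ rs) = (c ∷ []) *P X ^ length rs +P descending rs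

snoc : ∀ p c → p ++ (c ∷ []) ≋ p +P (c ∷ []) *P X ^ length p
snoc []      c = PolyRing.sym (PolyRing.*-identityʳ (c ∷ []))
snoc (a ∷ p) c = PolyRing.sym (begin
  (a ∷ p) +P (c ∷ []) *P (X *P Xᵏ)      ≈⟨ PolyRing.+-cong (PolyRing.refl {a ∷ p}) step ⟩
  (a ∷ p) +P (+ 0 ∷ ((c ∷ []) *P Xᵏ))   ≈⟨ coefficientwise (λ { zero → ℤₚ.+-identityʳ a ; (suc i) → ≡.sym (at (snoc p c) i) }) ⟩
  a ∷ (p ++ (c ∷ []))                   ∎)
  where
  Xᵏ = X ^ length p
  step : (c ∷ []) *P (X *P Xᵏ) ≋ + 0 ∷ ((c ∷ []) *P Xᵏ)
  step = begin
    (c ∷ []) *P (X *P Xᵏ)   ≈⟨ solve 3 (λ c x y → c :* (x :* y) := x :* (c :* y)) PolyRing.refl (c ∷ []) X Xᵏ ⟩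
    X *P ((c ∷ []) *P Xᵏ)   ≈⟨ X*-∷ ((c ∷ []) *P Xᵏ) ⟩
    + 0 ∷ ((c ∷ []) *P Xᵏ)  ∎

descending-reverse : ∀ l → reverse l ≋ descending l
descending-reverse []       = PolyRing.refl
descending-reverse (c ∷ rs) = begin
  reverse (c ∷ rs)                                          ≡⟨ Listₚ.unfold-reverse c rs ⟩
  reverse rs ++ (c ∷ [])                                    ≈⟨ snoc (reverse rs) c ⟩
  reverse rs +P (c ∷ []) *P X ^ length (reverse rs)         ≡⟨ ≡.cong (λ k → reverse rs +P (c ∷ []) *P X ^ k) (Listₚ.length-reverse rs) ⟩
  reverse rs +P (c ∷ []) *P X ^ length rs                   ≈⟨ PolyRing.+-comm (reverse rs) _ ⟩
  (c ∷ []) *P X ^ length rs +P reverse rs                   ≈⟨ PolyRing.+-cong (PolyRing.refl {(c ∷ []) *P X ^ length rs}) (descending-reverse rs) ⟩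
  descending (c ∷ rs)                                       ∎

descending-below : ∀ l → Below (length l) (descending l)
descending-below l = Below-cong (descending-reverse l)
  (≡.subst (λ k → Below k (reverse l)) (Listₚ.length-reverse l) (Below-length (reverse l)))

descending-top : ∀ c rs → coeff (descending (c ∷ rs)) (length rs) ≡ c
descending-top c rs = ≡.trans (≡.sym (at (descending-reverse (c ∷ rs)) (length rs)))
  (≡.trans (≡.cong (λ l → coeff l (length rs)) (Listₚ.unfold-reverse c rs))
    (≡.trans (≡.cong (coeff (reverse rs ++ (c ∷ []))) (≡.sym (Listₚ.length-reverse rs))) (last (reverse rs))))
  where
  last : ∀ p → coeff (p ++ (c ∷ [])) (length p) ≡ c
  last []      = ≡.refl
  last (a ∷ p) = last p

descending-dropZeros : ∀ l → descending (dropZeros l) ≋ descending l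
descending-dropZeros []                 = PolyRing.refl
descending-dropZeros ((+ zero) ∷ rs)    = PolyRing.trans (descending-dropZeros rs)
  (PolyRing.sym (begin
    (+ 0 ∷ []) *P X ^ length rs +P descending rs  ≈⟨ PolyRing.+-cong (PolyRing.trans (constant-* (+ 0) (X ^ length rs))
                                                       (coefficientwise (coeff-scale (+ 0) (X ^ length rs)))) (PolyRing.refl {descending rs}) ⟩
    descending rs                                 ∎))
descending-dropZeros ((+ suc n) ∷ rs)   = PolyRing.refl
descending-dropZeros (-[1+ n ] ∷ rs)    = PolyRing.refl

descending-highFirst : ∀ p → descending (highFirst p) ≋ p
descending-highFirst p = begin
  descending (highFirst p)  ≈⟨ descending-dropZeros (reverse p) ⟩
  descending (reverse p)    ≈⟨ descending-reverse (reverse p) ⟨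
  reverse (reverse p)       ≡⟨ Listₚ.reverse-involutive p ⟩
  p                         ∎

dropZeros-head : ∀ l {c rs} → dropZeros l ≡ c ∷ rs → c ≢ + 0
dropZeros-head ((+ zero) ∷ l)  e      = dropZeros-head l e
dropZeros-head ((+ suc n) ∷ l) ≡.refl = λ ()
dropZeros-head (-[1+ n ] ∷ l)  ≡.refl = λ ()

highFirst-monic : ∀ M → (m : Monic M) → ∃[ ds ] (highFirst M ≡ + 1 ∷ ds × length ds ≡ Monic.deg m)
highFirst-monic M (monic d b t) with highFirst M in eq
... | [] = ⊥-elim (1≢0 (≡.trans (≡.sym t) (≡.sym (at (≡.subst (λ l → descending l ≋ M) eq (descending-highFirst M)) d))))
... | c ∷ ds with ℕₚ.<-cmp (length ds) d
...   | tri< lt _ _ = ⊥-elim (1≢0 (≡.trans (≡.sym t) (Below-cong value (descending-below (c ∷ ds)) d lt)))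
  where
  value : descending (c ∷ ds) ≋ M
  value = ≡.subst (λ l → descending l ≋ M) eq (descending-highFirst M)
...   | tri> _ _ gt = ⊥-elim (dropZeros-head (reverse M) eq
          (≡.trans (≡.sym (descending-top c ds)) (≡.trans (at value (length ds)) (b (length ds) gt))))
  where
  value : descending (c ∷ ds) ≋ M
  value = ≡.subst (λ l → descending l ≋ M) eq (descending-highFirst M)
...   | tri≈ _ ≡.refl _ = ds , ≡.cong (_∷ ds) (≡.trans (≡.sym (descending-top c ds)) (≡.trans (at value (length ds)) t)) , ≡.refl
  where
  value : descending (c ∷ ds) ≋ M
  value = ≡.subst (λ l → descending l ≋ M) eq (descending-highFirst M)

constant-difference : ∀ r c d → (r ℤ.- c ℤ.* d) ∷ [] ≋ (r ∷ []) -P (c ∷ []) *P (d ∷ [])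
constant-difference r c d = coefficientwise λ
  { zero    → lemma r (c ℤ.* d)
  ; (suc i) → ≡.refl }
  where
  lemma : ∀ r x → r ℤ.- x ≡ r ℤ.+ ℤ.- (x ℤ.+ + 0)
  lemma = ℤ-Solver.solve-∀

-- The lists are aligned at their leading ends, so the surplus length `k` of `rs` appears as the
-- factor `X ^ k` on `ds`.
subtractPrefix-descending : ∀ k c ds rs → length rs ≡ k ℕ.+ length ds →
  descending (subtractPrefix c ds rs) ≋ descending rs -P (c ∷ []) *P (X ^ k *P descending ds)
subtractPrefix-descending k c [] rs e =
  solve 3 (λ r c x → r := r :- c :* (x :* con (+ 0))) PolyRing.refl (descending rs) (c ∷ []) (X ^ k)
subtractPrefix-descending k c (d ∷ ds) [] e = ⊥-elim (ℕₚ.m+1+n≢0 k (≡.sym e))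
subtractPrefix-descending k c (d ∷ ds) (r ∷ rs) e = begin
  ((r ℤ.- c ℤ.* d) ∷ []) *P X ^ length (subtractPrefix c ds rs) +P descending (subtractPrefix c ds rs)
    ≡⟨ ≡.cong (λ j → ((r ℤ.- c ℤ.* d) ∷ []) *P X ^ j +P descending (subtractPrefix c ds rs)) (subtractPrefix-length c ds rs) ⟩
  ((r ℤ.- c ℤ.* d) ∷ []) *P Xⁿ +P descending (subtractPrefix c ds rs)
    ≈⟨ PolyRing.+-cong (PolyRing.*-cong (constant-difference r c d) (PolyRing.refl {Xⁿ})) (subtractPrefix-descending k c ds rs e′) ⟩
  (R -P C *P D) *P Xⁿ +P (rs′ -P C *P (Xᵏ *P ds′))
    ≈⟨ solve 5 (λ R CD Xⁿ rs y → (R :- CD) :* Xⁿ :+ (rs :- y) := (R :* Xⁿ :+ rs) :- (CD :* Xⁿ :+ y)) PolyRing.refl R (C *P D) Xⁿ rs′ (C *P (Xᵏ *P ds′)) ⟩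
  (R *P Xⁿ +P rs′) -P (C *P D *P Xⁿ +P C *P (Xᵏ *P ds′))
    ≈⟨ PolyRing.+-cong (PolyRing.refl {R *P Xⁿ +P rs′}) (PolyRing.-‿cong tail) ⟩
  (R *P Xⁿ +P rs′) -P C *P (Xᵏ *P (D *P Xᵐ +P ds′)) ∎
  where
  e′ = ℕₚ.suc-injective (≡.trans e (ℕₚ.+-suc k (length ds)))
  R = r ∷ []
  C = c ∷ []
  D = d ∷ []
  Xⁿ = X ^ length rs
  Xᵏ = X ^ k
  Xᵐ = X ^ length ds
  rs′ = descending rs
  ds′ = descending ds
  tail : C *P D *P Xⁿ +P C *P (Xᵏ *P ds′) ≋ C *P (Xᵏ *P (D *P Xᵐ +P ds′))
  tail = begin
    C *P D *P Xⁿ +P C *P (Xᵏ *P ds′)         ≡⟨ ≡.cong (λ j → C *P D *P X ^ j +P C *P (Xᵏ *P ds′)) e′ ⟩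
    C *P D *P X ^ (k ℕ.+ length ds) +P C *P (Xᵏ *P ds′)
      ≈⟨ PolyRing.+-cong (PolyRing.*-cong (PolyRing.refl {C *P D}) (^-homo-* X k (length ds))) (PolyRing.refl {C *P (Xᵏ *P ds′)}) ⟩
    C *P D *P (Xᵏ *P Xᵐ) +P C *P (Xᵏ *P ds′)
      ≈⟨ solve 5 (λ C D x y z → C :* D :* (x :* y) :+ C :* (x :* z) := C :* (x :* (D :* y :+ z))) PolyRing.refl C D Xᵏ Xᵐ ds′ ⟩
    C *P (Xᵏ *P (D *P Xᵐ +P ds′))            ∎

-- `ds` is the divisor without its leading 1. Subtracting c X^k times the divisor kills the head `c`
-- of the dividend, so only the tail is adjusted; the length equation says that exactly `length ds`
-- coefficients remain after `k` steps.
longDivision-remainder : ∀ k ds l → length l ≡ k ℕ.+ length ds →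
  ∃[ R ] (Below (length ds) R × descending l ≋ descending (+ 1 ∷ ds) *P descending (longDivision k ds l) +P R)
longDivision-remainder zero ds l e =
  descending l , ≡.subst (λ j → Below j (descending l)) e (descending-below l) ,
  solve 2 (λ M l → l := M :* con (+ 0) :+ l) PolyRing.refl (descending (+ 1 ∷ ds)) (descending l)
longDivision-remainder (suc k) ds (c ∷ rs) e
  with longDivision-remainder k ds (subtractPrefix c ds rs) (≡.trans (subtractPrefix-length c ds rs) (ℕₚ.suc-injective e))
... | R , R< , eq = R , R< , (begin
  C *P X ^ length rs +P rs′
    ≡⟨ ≡.cong (λ j → C *P X ^ j +P rs′) e′ ⟩
  C *P X ^ (k ℕ.+ length ds) +P rs′
    ≈⟨ PolyRing.+-cong (PolyRing.*-cong (PolyRing.refl {C}) (^-homo-* X k (length ds))) (PolyRing.refl {rs′}) ⟩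
  C *P (Xᵏ *P Xᵐ) +P rs′
    ≈⟨ solve 5 (λ C x y r d → C :* (x :* y) :+ r := C :* (x :* (con (+ 1) :* y :+ d)) :+ (r :- C :* (x :* d))) PolyRing.refl C Xᵏ Xᵐ rs′ ds′ ⟩
  C *P (Xᵏ *P M) +P (rs′ -P C *P (Xᵏ *P ds′))
    ≈⟨ PolyRing.+-cong (PolyRing.refl {C *P (Xᵏ *P M)}) (PolyRing.trans (PolyRing.sym (subtractPrefix-descending k c ds rs e′)) eq) ⟩
  C *P (Xᵏ *P M) +P (M *P Q +P R)
    ≈⟨ solve 5 (λ C x M Q R → C :* (x :* M) :+ (M :* Q :+ R) := M :* (C :* x :+ Q) :+ R) PolyRing.refl C Xᵏ M Q R ⟩
  M *P (C *P Xᵏ +P Q) +P R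
    ≡⟨ ≡.cong (λ j → M *P (C *P X ^ j +P Q) +P R) (longDivision-length k ds (subtractPrefix c ds rs)
         (≡.trans (subtractPrefix-length c ds rs) e′)) ⟨
  M *P descending (longDivision (suc k) ds (c ∷ rs)) +P R ∎)
  where
  e′ = ℕₚ.suc-injective e
  C = c ∷ []
  Xᵏ = X ^ k
  Xᵐ = X ^ length ds
  M = descending (+ 1 ∷ ds)
  Q = descending (longDivision k ds (subtractPrefix c ds rs))
  rs′ = descending rs
  ds′ = descending ds

longDivision-truncated : ∀ ds l →
  ∃[ R ] (Below (length ds) R ×
    descending l ≋ descending (+ 1 ∷ ds) *P descending (longDivision (length l ∸ length ds) ds l) +P R)
longDivision-truncated ds l with ℕₚ.≤-total (length ds) (length l)
... | inj₁ ds≤l = longDivision-remainder (length l ∸ length ds) ds l (≡.sym (ℕₚ.m∸n+n≡m ds≤l))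
-- For a dividend shorter than the divisor truncated subtraction gives no step at all, and the
-- dividend is its own remainder.
... | inj₂ l≤ds = descending l , (λ i ds≤i → descending-below l i (ℕₚ.≤-trans l≤ds ds≤i)) ,
  ≡.subst (λ k → descending l ≋ M *P descending (longDivision k ds l) +P descending l) (≡.sym (ℕₚ.m≤n⇒m∸n≡0 l≤ds))
    (solve 2 (λ M l → l := M :* con (+ 0) :+ l) PolyRing.refl M (descending l))
  where
  M = descending (+ 1 ∷ ds)

divMonic-remainder : ∀ F M → (m : Monic M) → ∃[ R ] (Below (Monic.deg m) R × F ≋ M *P divMonic F M +P R)
divMonic-remainder F M m = R , ≡.subst (λ d → Below d R) (proj₂ (proj₂ head)) R< , (begin
  F                                                        ≈⟨ descending-highFirst F ⟨
  descending l                                             ≈⟨ eq ⟩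
  descending (+ 1 ∷ ds) *P descending quotient +P R        ≈⟨ PolyRing.+-cong (PolyRing.*-cong M≋ (PolyRing.sym (descending-reverse quotient))) (PolyRing.refl {R}) ⟩
  M *P reverse quotient +P R                               ≡⟨ ≡.cong (λ D → M *P D +P R) (≡.trans (divMonic-unfold F M)
                                                                (≡.cong (λ ds → reverse (longDivision (length l ∸ length ds) ds l)) (≡.cong (drop 1) (proj₁ (proj₂ head))))) ⟨
  M *P divMonic F M +P R                                   ∎)
  where
  head = highFirst-monic M m
  ds = proj₁ head
  l = highFirst F
  quotient = longDivision (length l ∸ length ds) ds l
  R = proj₁ (longDivision-truncated ds l)
  R< = proj₁ (proj₂ (longDivision-truncated ds l))
  eq = proj₂ (proj₂ (longDivision-truncated ds l))
  M≋ : descending (+ 1 ∷ ds) ≋ M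
  M≋ = ≡.subst (λ l → descending l ≋ M) (proj₁ (proj₂ head)) (descending-highFirst M)

divMonic-exact : ∀ F M E → Monic M → M *P E ≋ F → divMonic F M ≋ E
divMonic-exact F M E m e = PolyRing.sym (difference-zero E Q (multiple-below M (E -P Q) m (Below-cong (PolyRing.sym eq) R<)))
  where
  Q = divMonic F M
  R = proj₁ (divMonic-remainder F M m)
  R< = proj₁ (proj₂ (divMonic-remainder F M m))
  eq : M *P (E -P Q) ≋ R
  eq = begin
    M *P (E -P Q)               ≈⟨ solve 3 (λ M E Q → M :* (E :- Q) := M :* E :- M :* Q) PolyRing.refl M E Q ⟩
    M *P E -P M *P Q            ≈⟨ PolyRing.+-cong (PolyRing.trans e (proj₂ (proj₂ (divMonic-remainder F M m)))) (PolyRing.refl {negP (M *P Q)}) ⟩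
    M *P Q +P R -P M *P Q       ≈⟨ solve 2 (λ x R → x :+ R :- x := R) PolyRing.refl (M *P Q) R ⟩
    R                           ∎

-- Division of F by M with quotient Q and remainder R gives M (E - c Q) = c R. The right-hand side
-- has degree below that of M, so it is zero, and R = 0 because ℤ has no zero divisors.
Monic-saturated : ∀ M E F c → c ≢ + 0 → Monic M → M *P E ≋ (c ∷ []) *P F → M *P divMonic F M ≋ F
Monic-saturated M E F c c≢0 m e = PolyRing.sym (PolyRing.trans F≋ (PolyRing.trans
    (PolyRing.+-cong (PolyRing.refl {M *P Q}) R≋0) (PolyRing.+-identityʳ (M *P Q))))
  where
  C = c ∷ []
  Q = divMonic F M
  R = proj₁ (divMonic-remainder F M m)
  R< = proj₁ (proj₂ (divMonic-remainder F M m))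
  F≋ = proj₂ (proj₂ (divMonic-remainder F M m))
  eq : M *P (E -P C *P Q) ≋ C *P R
  eq = begin
    M *P (E -P C *P Q)               ≈⟨ solve 4 (λ M E C Q → M :* (E :- C :* Q) := M :* E :- C :* (M :* Q)) PolyRing.refl M E C Q ⟩
    M *P E -P C *P (M *P Q)          ≈⟨ PolyRing.+-cong (PolyRing.trans e (PolyRing.*-cong (PolyRing.refl {C}) F≋)) (PolyRing.refl {negP (C *P (M *P Q))}) ⟩
    C *P (M *P Q +P R) -P C *P (M *P Q) ≈⟨ solve 3 (λ C x R → C :* (x :+ R) :- C :* x := C :* R) PolyRing.refl C (M *P Q) R ⟩
    C *P R                           ∎
  CR< : Below (Monic.deg m) (C *P R)
  CR< = Below-cong (PolyRing.sym (constant-* c R)) (Below-scale c R R<)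
  CR≋0 : C *P R ≋ []
  CR≋0 = PolyRing.trans (PolyRing.sym eq) (PolyRing.trans
    (PolyRing.*-cong (PolyRing.refl {M}) (multiple-below M (E -P C *P Q) m (Below-cong (PolyRing.sym eq) CR<))) (PolyRing.zeroʳ M))
  R≋0 : R ≋ []
  R≋0 = coefficientwise λ i → [ (λ c≡0 → ⊥-elim (c≢0 c≡0)) , (λ z → z) ]′
    (ℤₚ.i*j≡0⇒i≡0∨j≡0 c (≡.trans (≡.sym (≡.trans (at (constant-* c R) i) (coeff-scale c R i))) (at CR≋0 i)))

open Coprimality polyRing using (_∣_; factors; _⊥_; bézout; ∣-refl; ∣-trans; ∣-*ˡ; *-mono-∣; ⊥-sym; ⊥-oneʳ; ⊥-*ʳ; ⊥-∣ʳ; ⊥-cancel; ⊥-product; bracket-∣; bracket-⊥)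

-- Cyclotomic polynomials

natural-constant : ∀ n → natural n ≋ (+ n) ∷ []
natural-constant zero          = coefficientwise λ { zero → ≡.refl ; (suc i) → ≡.refl }
natural-constant (suc zero)    = PolyRing.refl
natural-constant (suc (suc n)) = PolyRing.+-cong (PolyRing.refl {oneP}) (natural-constant (suc n))

Monic-∣-saturated : ∀ M F k → Monic M → M ∣ natural (suc k) *P F → M ∣ F
Monic-∣-saturated M F k m (factors E e) = factors (divMonic F M)
  (Monic-saturated M E F (+ suc k) (λ ()) m (PolyRing.trans e (PolyRing.*-cong (natural-constant (suc k)) (PolyRing.refl {F}))))

Monic-bracket : ∀ n → Monic [ X ^ suc n -1]
Monic-bracket n = monic (suc n) below top
  where
  coeff-X^ : ∀ n i → coeff (X ^ suc n) (suc i) ≡ coeff (X ^ n) i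
  coeff-X^ n i = at (X*-∷ (X ^ n)) (suc i)
  X^-top : ∀ n → coeff (X ^ n) n ≡ + 1
  X^-top zero    = ≡.refl
  X^-top (suc n) = ≡.trans (coeff-X^ n n) (X^-top n)
  X^-below : ∀ n → Below (suc n) (X ^ n)
  X^-below zero    (suc i) _           = ≡.refl
  X^-below (suc n) (suc i) (ℕ.s≤s n<i) = ≡.trans (coeff-X^ n i) (X^-below n i n<i)
  below : Below (suc (suc n)) [ X ^ suc n -1]
  below (suc i) n<i = ≡.trans (coeff-+ (X ^ suc n) (negP oneP) (suc i)) (≡.cong (ℤ._+ + 0) (X^-below (suc n) (suc i) n<i))
  top : coeff [ X ^ suc n -1] (suc n) ≡ + 1
  top = ≡.trans (coeff-+ (X ^ suc n) (negP oneP) (suc n)) (≡.cong (ℤ._+ + 0) (X^-top (suc n)))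

mutual
  -- divisorsPart is local to cycs; unification recovers it.
  divisorFactors : ℕ → List (ℕ × Poly) → List Poly
  divisorFactors = _

  cycs-unfold : ∀ n → cycs (suc n) ≡
    (suc n , divMonic (powP X (suc n) -P oneP) (prodP (divisorFactors n (cycs n)))) ∷ cycs n
  cycs-unfold n with cycs n
  ... | xs with prodP
  ...   | product = ≡.refl

-- The product of Φ_d over the divisors d ≤ m of n + 1.
divisorProduct : ℕ → ℕ → Poly
divisorProduct n m = prodP (divisorFactors n (cycs m))

divisorProduct-yes : ∀ n m → suc m ℕ∣.∣ suc n → divisorProduct n (suc m) ≡ Φ (suc m) *P divisorProduct n m
divisorProduct-yes n m d = ≡.cong
  (λ b → prodP (if b then Φ (suc m) ∷ divisorFactors n (cycs m) else divisorFactors n (cycs m)))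
  (dec-true (suc m ∣? suc n) d)

divisorProduct-no : ∀ n m → ¬ suc m ℕ∣.∣ suc n → divisorProduct n (suc m) ≡ divisorProduct n m
divisorProduct-no n m d = ≡.cong
  (λ b → prodP (if b then Φ (suc m) ∷ divisorFactors n (cycs m) else divisorFactors n (cycs m)))
  (dec-false (suc m ∣? suc n) d)

∣-≡ : ∀ {p r s} → r ≡ s → p ∣ r → p ∣ s
∣-≡ ≡.refl d = d

divisorProduct-mono-∣ : ∀ {n n′} → suc n ℕ∣.∣ suc n′ → ∀ m → divisorProduct n m ∣ divisorProduct n′ m
divisorProduct-mono-∣ n∣n′ zero    = ∣-refl
divisorProduct-mono-∣ {n} {n′} n∣n′ (suc m) with suc m ∣? suc n
... | yes d = ≡.subst₂ _∣_ (≡.sym (divisorProduct-yes n m d)) (≡.sym (divisorProduct-yes n′ m (ℕ∣.∣-trans d n∣n′)))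
                (*-mono-∣ (Φ (suc m)) (divisorProduct-mono-∣ n∣n′ m))
... | no ¬d with suc m ∣? suc n′
...   | yes d′ = ≡.subst₂ _∣_ (≡.sym (divisorProduct-no n m ¬d)) (≡.sym (divisorProduct-yes n′ m d′))
                   (∣-*ˡ (Φ (suc m)) (divisorProduct-mono-∣ n∣n′ m))
...   | no ¬d′ = ≡.subst₂ _∣_ (≡.sym (divisorProduct-no n m ¬d)) (≡.sym (divisorProduct-no n′ m ¬d′))
                   (divisorProduct-mono-∣ n∣n′ m)

divisorProduct-extend : ∀ n {m m′} → m ℕ.≤ m′ → divisorProduct n m ∣ divisorProduct n m′
divisorProduct-extend n {m} m≤m′ = ≡.subst (λ k → divisorProduct n m ∣ divisorProduct n k) (ℕₚ.m+[n∸m]≡n m≤m′) (extend (_ ∸ m))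
  where
  step : ∀ k → divisorProduct n k ∣ divisorProduct n (suc k)
  step k with suc k ∣? suc n
  ... | yes d = ∣-≡ (≡.sym (divisorProduct-yes n k d)) (∣-*ˡ (Φ (suc k)) ∣-refl)
  ... | no ¬d = ∣-≡ (≡.sym (divisorProduct-no n k ¬d)) ∣-refl
  extend : ∀ k → divisorProduct n m ∣ divisorProduct n (m ℕ.+ k)
  extend zero    = ∣-≡ (≡.cong (divisorProduct n) (≡.sym (ℕₚ.+-identityʳ m))) ∣-refl
  extend (suc k) = ∣-≡ (≡.cong (divisorProduct n) (≡.sym (ℕₚ.+-suc m k))) (∣-trans (extend k) (step (m ℕ.+ k)))

-- The index is shifted: this concerns `Φ (suc n)`. The field `product` expresses that the long
-- division in `cycs` leaves no remainder.
record Cyclotomic (n : ℕ) : Set where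
  constructor cyclotomic
  field
    Φ-monic : Monic (Φ (suc n))
    product : divisorProduct n n *P Φ (suc n) ≋ [ X ^ suc n -1]

  Φ-∣-bracket : Φ (suc n) ∣ [ X ^ suc n -1]
  Φ-∣-bracket = factors (divisorProduct n n) (PolyRing.trans (PolyRing.*-comm (Φ (suc n)) (divisorProduct n n)) product)

  bracket-∣-divisorProduct : [ X ^ suc n -1] ∣ divisorProduct n (suc n)
  bracket-∣-divisorProduct = ∣-≡ (≡.sym (divisorProduct-yes n n ℕ∣.∣-refl))
    (factors oneP (PolyRing.trans (PolyRing.*-identityʳ [ X ^ suc n -1])
      (PolyRing.trans (PolyRing.sym product) (PolyRing.*-comm (divisorProduct n n) (Φ (suc n))))))
open Cyclotomic

-- As n + 1 does not divide k, g = gcd(k, n+1) is a proper divisor of n + 1. The Φ_d with d dividing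
-- g are then among the factors of `divisorProduct n n`, so (X^g - 1) Φ_{n+1} divides X^{n+1} - 1,
-- as `bracket-⊥` requires. Assuming only indices up to `n` keeps the lemma available inside the
-- strong induction below.
bracket-⊥-Φ : ∀ {n} → (∀ {m} → m ℕ.≤ n → Cyclotomic m) → ∀ k → ¬ suc n ℕ∣.∣ k → [ X ^ k -1] ⊥ Φ (suc n)
bracket-⊥-Φ {n} C k n∤k = bracket-⊥ X k n (Φ (suc n)) (λ {x} {y} → cancel g≢0 {x} {y}) (divide g∣n g∤′)
  where
  g = gcd k (suc n)
  g∣n : g ℕ∣.∣ suc n
  g∣n = gcd[m,n]∣n k (suc n)
  g≢0 : g ≢ 0
  g≢0 e = ℕₚ.1+n≢0 (ℕ∣.0∣⇒≡0 (≡.subst (ℕ∣._∣ suc n) e g∣n))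
  g∤′ : g ≢ suc n
  g∤′ e = n∤k (≡.subst (ℕ∣._∣ k) e (gcd[m,n]∣m k (suc n)))
  cancel : ∀ {d} → d ≢ 0 → ∀ {x y} → [ X ^ d -1] *P x ≋ [ X ^ d -1] *P y → x ≋ y
  cancel {zero}  d≢0 = ⊥-elim (d≢0 ≡.refl)
  cancel {suc d} d≢0 {x} {y} = Monic-cancel [ X ^ suc d -1] x y (Monic-bracket d)
  divide : ∀ {d} → d ℕ∣.∣ suc n → d ≢ suc n → [ X ^ d -1] *P Φ (suc n) ∣ [ X ^ suc n -1]
  divide {zero}  d∣n d≢n = ⊥-elim (ℕₚ.1+n≢0 (ℕ∣.0∣⇒≡0 d∣n))
  divide {suc d} d∣n d≢n = ∣-trans (swap (*-mono-∣ (Φ (suc n)) below)) (factors oneP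
      (PolyRing.trans (PolyRing.*-identityʳ (Φ (suc n) *P divisorProduct n n))
        (PolyRing.trans (PolyRing.*-comm (Φ (suc n)) (divisorProduct n n)) (product (C ℕₚ.≤-refl)))))
    where
    d<n : suc d ℕ.≤ n
    d<n = ℕ.s≤s⁻¹ (ℕₚ.≤∧≢⇒< (ℕ∣.∣⇒≤ d∣n) d≢n)
    below : [ X ^ suc d -1] ∣ divisorProduct n n
    below = ∣-trans (bracket-∣-divisorProduct (C (ℕₚ.<⇒≤ d<n)))
      (∣-trans (divisorProduct-mono-∣ d∣n (suc d)) (divisorProduct-extend n d<n))
    swap : Φ (suc n) *P [ X ^ suc d -1] ∣ Φ (suc n) *P divisorProduct n n →
           [ X ^ suc d -1] *P Φ (suc n) ∣ Φ (suc n) *P divisorProduct n n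
    swap (factors a e) = factors a (PolyRing.trans
      (PolyRing.*-cong (PolyRing.*-comm [ X ^ suc d -1] (Φ (suc n))) (PolyRing.refl {a})) e)

cyclotomic-all : ∀ n → Cyclotomic n
cyclotomic-all = <-rec Cyclotomic step
  where
  step : ∀ n → (∀ {m} → m ℕ.< n → Cyclotomic m) → Cyclotomic n
  step n C = cyclotomic Φ-monic′ product′
    where
    -- Each factor Φ_{i+1} divides X^{i+1} - 1, and the larger number m + 1 cannot divide i + 1.
    coprime : ∀ {m} → m ℕ.< n → ∀ i → i ℕ.≤ m → Φ (suc m) ⊥ divisorProduct n i
    coprime {m} m<n zero    i≤m = ⊥-oneʳ (Φ (suc m))
    coprime {m} m<n (suc i) i<m with suc i ∣? suc n
    ... | no ¬d = ≡.subst (Φ (suc m) ⊥_) (≡.sym (divisorProduct-no n i ¬d)) (coprime m<n i (ℕₚ.<⇒≤ i<m))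
    ... | yes d = ≡.subst (Φ (suc m) ⊥_) (≡.sym (divisorProduct-yes n i d))
      (⊥-*ʳ (⊥-∣ʳ (⊥-sym (bracket-⊥-Φ (λ l≤m → C (ℕₚ.≤-<-trans l≤m m<n)) (suc i) (ℕ∣.>⇒∤ (ℕ.s≤s i<m))))
                   (Φ-∣-bracket (C (ℕₚ.<-trans i<m m<n))))
            (coprime m<n i (ℕₚ.<⇒≤ i<m)))
    -- Two coprime divisors multiply to a divisor of an integer multiple only; monicity of their
    -- product, carried along for this purpose, removes the integer.
    partialProduct : ∀ m → m ℕ.≤ n → Monic (divisorProduct n m) × divisorProduct n m ∣ [ X ^ suc n -1]
    partialProduct zero    m≤n = Monic-one , factors [ X ^ suc n -1] (PolyRing.*-identityˡ [ X ^ suc n -1])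
    partialProduct (suc m) m<n with suc m ∣? suc n | partialProduct m (ℕₚ.<⇒≤ m<n)
    ... | no ¬d | M , D = ≡.subst (λ p → Monic p × p ∣ [ X ^ suc n -1]) (≡.sym (divisorProduct-no n m ¬d)) (M , D)
    ... | yes d | M , D = ≡.subst (λ p → Monic p × p ∣ [ X ^ suc n -1]) (≡.sym (divisorProduct-yes n m d))
      (M′ , Monic-∣-saturated (Φ (suc m) *P divisorProduct n m) [ X ^ suc n -1] (_⊥_.k coprime-m) M′
              (⊥-product coprime-m (∣-trans (Φ-∣-bracket (C m<n)) (bracket-∣ X d)) D))
      where
      M′ = Monic-* (Φ (suc m)) (divisorProduct n m) (Φ-monic (C m<n)) M
      coprime-m = coprime m<n m ℕₚ.≤-refl
    P = divisorProduct n n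
    P-monic = proj₁ (partialProduct n ℕₚ.≤-refl)
    E = _∣_.cofactor (proj₂ (partialProduct n ℕₚ.≤-refl))
    PE≋ : P *P E ≋ [ X ^ suc n -1]
    PE≋ = _∣_.equation (proj₂ (partialProduct n ℕₚ.≤-refl))
    powP-bracket : powP X (suc n) -P oneP ≡ [ X ^ suc n -1]
    powP-bracket = ≡.cong (_-P oneP) (powP≡^ X (suc n))
    Φ≋E : Φ (suc n) ≋ E
    Φ≋E = divMonic-exact (powP X (suc n) -P oneP) P E P-monic
      (PolyRing.trans PE≋ (PolyRing.reflexive (≡.sym powP-bracket)))
    product′ : P *P Φ (suc n) ≋ [ X ^ suc n -1]
    product′ = PolyRing.trans (PolyRing.*-cong (PolyRing.refl {P}) Φ≋E) PE≋
    Φ-monic′ : Monic (Φ (suc n))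
    Φ-monic′ = Monic-quotient P (Φ (suc n)) P-monic (Monic-cong (PolyRing.sym product′) (Monic-bracket n))

-- The q-binomial coefficients of the statement

prodP-applyUpTo-rising : ∀ k m (f : ℕ → Poly) → (∀ i → f i ≡ powP X (suc (k ℕ.+ i)) -P oneP) →
  prodP (applyUpTo f m) ≋ rising X k m
prodP-applyUpTo-rising k zero    f e = PolyRing.refl
prodP-applyUpTo-rising k (suc m) f e = begin
  f 0 *P prodP (applyUpTo (f ∘ suc) m)    ≈⟨ PolyRing.*-cong (PolyRing.reflexive f0≡) (prodP-applyUpTo-rising (suc k) m (f ∘ suc) e′) ⟩
  [ X ^ suc k -1] *P rising X (suc k) m   ≈⟨ rising-front X k m ⟨
  rising X k (suc m)                      ∎
  where
  f0≡ : f 0 ≡ [ X ^ suc k -1]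
  f0≡ = ≡.trans (e 0) (≡.trans (≡.cong (λ j → powP X (suc j) -P oneP) (ℕₚ.+-identityʳ k)) (≡.cong (_-P oneP) (powP≡^ X (suc k))))
  e′ : ∀ i → f (suc i) ≡ powP X (suc (suc k ℕ.+ i)) -P oneP
  e′ i = ≡.trans (e (suc i)) (≡.cong (λ j → powP X (suc j) -P oneP) (ℕₚ.+-suc k i))

-- The numerator of `qbin` lists its factors downwards, so its head is the last factor of `rising`;
-- for the denominator it is the first.
prodP-descending-rising : ∀ k m (f : ℕ → Poly) → (∀ i → i ℕ.< m → f i ≡ powP X (k ℕ.+ m ∸ i) -P oneP) →
  prodP (applyUpTo f m) ≋ rising X k m
prodP-descending-rising k zero    f e = PolyRing.refl
prodP-descending-rising k (suc m) f e = begin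
  f 0 *P prodP (applyUpTo (f ∘ suc) m)        ≈⟨ PolyRing.*-cong (PolyRing.reflexive f0≡) (prodP-descending-rising k m (f ∘ suc) e′) ⟩
  [ X ^ suc (k ℕ.+ m) -1] *P rising X k m     ≈⟨ PolyRing.*-comm [ X ^ suc (k ℕ.+ m) -1] (rising X k m) ⟩
  rising X k (suc m)                          ∎
  where
  f0≡ : f 0 ≡ [ X ^ suc (k ℕ.+ m) -1]
  f0≡ = ≡.trans (e 0 (ℕ.s≤s ℕ.z≤n)) (≡.trans (≡.cong (λ j → powP X j -P oneP) (ℕₚ.+-suc k m)) (≡.cong (_-P oneP) (powP≡^ X (suc (k ℕ.+ m)))))
  e′ : ∀ i → i ℕ.< m → f (suc i) ≡ powP X (k ℕ.+ m ∸ i) -P oneP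
  e′ i i<m = ≡.trans (e (suc i) (ℕ.s≤s i<m)) (≡.cong (λ j → powP X (j ∸ suc i) -P oneP) (ℕₚ.+-suc k m))

Monic-rising : ∀ k m → Monic (rising X k m)
Monic-rising k zero    = Monic-one
Monic-rising k (suc m) = Monic-* (rising X k m) [ X ^ suc (k ℕ.+ m) -1] (Monic-rising k m) (Monic-bracket (k ℕ.+ m))

qbin-gauss : ∀ k m → qbin (k ℕ.+ m) m ≋ gauss X k m
qbin-gauss k m = begin
  qbin (k ℕ.+ m) m
    ≡⟨ ≡.cong (λ b → if b then divMonic numerator denominator else [])
         (Equivalence.to T-≡ (ℕₚ.≤⇒≤ᵇ (ℕₚ.m≤n+m m k))) ⟩
  divMonic numerator denominator
    ≈⟨ divMonic-exact numerator denominator (gauss X k m) (Monic-cong (PolyRing.sym denominator≋) (Monic-rising 0 m)) exact ⟩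
  gauss X k m ∎
  where
  numerator = prodP (map (λ i → powP X (k ℕ.+ m ∸ i) -P oneP) (upTo m))
  denominator = prodP (map (λ i → powP X (suc i) -P oneP) (upTo m))
  denominator≋ : denominator ≋ qfactorial X m
  denominator≋ = PolyRing.trans
    (PolyRing.reflexive (≡.cong prodP (Listₚ.map-upTo (λ i → powP X (suc i) -P oneP) m)))
    (prodP-applyUpTo-rising 0 m (λ i → powP X (suc i) -P oneP) (λ i → ≡.refl))
  numerator≋ : numerator ≋ rising X k m
  numerator≋ = PolyRing.trans
    (PolyRing.reflexive (≡.cong prodP (Listₚ.map-upTo (λ i → powP X (k ℕ.+ m ∸ i) -P oneP) m)))
    (prodP-descending-rising k m (λ i → powP X (k ℕ.+ m ∸ i) -P oneP) (λ i _ → ≡.refl))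
  exact : denominator *P gauss X k m ≋ numerator
  exact = begin
    denominator *P gauss X k m       ≈⟨ PolyRing.*-cong denominator≋ (PolyRing.refl {gauss X k m}) ⟩
    qfactorial X m *P gauss X k m    ≈⟨ PolyRing.*-comm (qfactorial X m) (gauss X k m) ⟩
    gauss X k m *P qfactorial X m    ≈⟨ gauss-rising X k m ⟩
    rising X k m                     ≈⟨ numerator≋ ⟨
    numerator                        ∎

rising-append : ∀ k l m → rising X k (l ℕ.+ m) ≋ rising X k l *P rising X (k ℕ.+ l) m
rising-append k l zero = PolyRing.trans (PolyRing.reflexive (≡.cong (rising X k) (ℕₚ.+-identityʳ l)))
  (PolyRing.sym (PolyRing.*-identityʳ (rising X k l)))
rising-append k l (suc m) = begin
  rising X k (l ℕ.+ suc m)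
    ≡⟨ ≡.cong (rising X k) (ℕₚ.+-suc l m) ⟩
  rising X k (l ℕ.+ m) *P [ X ^ suc (k ℕ.+ (l ℕ.+ m)) -1]
    ≈⟨ PolyRing.*-cong (rising-append k l m) (PolyRing.reflexive (≡.cong (λ j → [ X ^ suc j -1]) (≡.sym (ℕₚ.+-assoc k l m)))) ⟩
  rising X k l *P rising X (k ℕ.+ l) m *P [ X ^ suc (k ℕ.+ l ℕ.+ m) -1]
    ≈⟨ PolyRing.*-assoc (rising X k l) (rising X (k ℕ.+ l) m) [ X ^ suc (k ℕ.+ l ℕ.+ m) -1] ⟩
  rising X k l *P rising X (k ℕ.+ l) (suc m) ∎

gauss-factorials : ∀ k m → qfactorial X k *P qfactorial X m *P gauss X k m ≋ qfactorial X (k ℕ.+ m)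
gauss-factorials k m = begin
  qfactorial X k *P qfactorial X m *P gauss X k m
    ≈⟨ solve 3 (λ a b g → a :* b :* g := a :* (g :* b)) PolyRing.refl (qfactorial X k) (qfactorial X m) (gauss X k m) ⟩
  qfactorial X k *P (gauss X k m *P qfactorial X m)
    ≈⟨ PolyRing.*-cong (PolyRing.refl {qfactorial X k}) (gauss-rising X k m) ⟩
  qfactorial X k *P rising X k m
    ≈⟨ rising-append 0 k m ⟨
  qfactorial X (k ℕ.+ m) ∎

-- The recursion of `gauss` treats its two indices differently. Symmetry becomes visible after
-- multiplication by both q-factorials, which are monic and can be cancelled.
gauss-symmetric : ∀ k m → gauss X k m ≋ gauss X m k
gauss-symmetric k m = Monic-cancel (qfactorial X k *P qfactorial X m) (gauss X k m) (gauss X m k)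
  (Monic-* (qfactorial X k) (qfactorial X m) (Monic-rising 0 k) (Monic-rising 0 m)) (begin
    qfactorial X k *P qfactorial X m *P gauss X k m  ≈⟨ gauss-factorials k m ⟩
    qfactorial X (k ℕ.+ m)                           ≡⟨ ≡.cong (qfactorial X) (ℕₚ.+-comm k m) ⟩
    qfactorial X (m ℕ.+ k)                           ≈⟨ gauss-factorials m k ⟨
    qfactorial X m *P qfactorial X k *P gauss X m k  ≈⟨ PolyRing.*-cong (PolyRing.*-comm (qfactorial X m) (qfactorial X k)) (PolyRing.refl {gauss X m k}) ⟩
    qfactorial X k *P qfactorial X m *P gauss X m k  ∎)

substq²-cong : ∀ {p r} → p ≋ r → substq² p ≋ substq² r
substq²-cong {p} {r} e = coefficientwise (coefficients p r (at e))
  where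
  coefficients : ∀ p r → p ≈P r → substq² p ≈P substq² r
  coefficients []      []      e i             = ≡.refl
  coefficients []      (b ∷ r) e zero          = e 0
  coefficients []      (b ∷ r) e (suc zero)    = ≡.refl
  coefficients []      (b ∷ r) e (suc (suc i)) = coefficients [] r (e ∘ suc) i
  coefficients (a ∷ p) []      e zero          = e 0
  coefficients (a ∷ p) []      e (suc zero)    = ≡.refl
  coefficients (a ∷ p) []      e (suc (suc i)) = coefficients p [] (e ∘ suc) i
  coefficients (a ∷ p) (b ∷ r) e zero          = e 0
  coefficients (a ∷ p) (b ∷ r) e (suc zero)    = ≡.refl
  coefficients (a ∷ p) (b ∷ r) e (suc (suc i)) = coefficients p r (e ∘ suc) i

substq²-+ : ∀ p r → substq² (p +P r) ≡ substq² p +P substq² r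
substq²-+ []      r       = ≡.refl
substq²-+ (a ∷ p) []      = ≡.refl
substq²-+ (a ∷ p) (b ∷ r) = ≡.cong (λ s → (a ℤ.+ b) ∷ + 0 ∷ s) (substq²-+ p r)

substq²-scale : ∀ c p → substq² (scaleP c p) ≡ scaleP c (substq² p)
substq²-scale c []      = ≡.refl
substq²-scale c (a ∷ p) = ≡.cong₂ (λ z s → (c ℤ.* a) ∷ z ∷ s) (≡.sym (ℤₚ.*-zeroʳ c)) (substq²-scale c p)

substq²-* : ∀ p r → substq² (p *P r) ≋ substq² p *P substq² r
substq²-* []      r = PolyRing.refl
substq²-* (a ∷ p) r = begin
  substq² (scaleP a r +P (+ 0 ∷ (p *P r)))               ≡⟨ substq²-+ (scaleP a r) (+ 0 ∷ (p *P r)) ⟩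
  substq² (scaleP a r) +P (+ 0 ∷ + 0 ∷ substq² (p *P r)) ≈⟨ PolyRing.+-cong (PolyRing.reflexive (substq²-scale a r)) tail ⟩
  scaleP a (substq² r) +P (+ 0 ∷ ((+ 0 ∷ substq² p) *P substq² r)) ∎
  where
  tail : + 0 ∷ + 0 ∷ substq² (p *P r) ≋ + 0 ∷ ((+ 0 ∷ substq² p) *P substq² r)
  tail = coefficientwise λ
    { zero          → ≡.refl
    ; (suc zero)    → ≡.sym (at (shift-* (substq² p) (substq² r)) 0)
    ; (suc (suc i)) → ≡.trans (at (substq²-* p r) i) (≡.sym (at (shift-* (substq² p) (substq² r)) (suc i))) }

Q : Poly
Q = X *P X

substq²-X : substq² X ≋ Q
substq²-X = coefficientwise λ
  { zero → ≡.refl ; (suc zero) → ≡.refl ; (suc (suc zero)) → ≡.refl ; (suc (suc (suc zero))) → ≡.refl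
  ; (suc (suc (suc (suc i)))) → ≡.refl }

substq²-one : substq² oneP ≋ oneP
substq²-one = coefficientwise λ { zero → ≡.refl ; (suc zero) → ≡.refl ; (suc (suc i)) → ≡.refl }

substq²-^ : ∀ n → substq² (X ^ n) ≋ Q ^ n
substq²-^ zero    = substq²-one
substq²-^ (suc n) = PolyRing.trans (substq²-* X (X ^ n)) (PolyRing.*-cong substq²-X (substq²-^ n))

substq²-gauss : ∀ k m → substq² (gauss X k m) ≋ gauss Q k m
substq²-gauss zero    zero    = substq²-one
substq²-gauss (suc k) zero    = substq²-one
substq²-gauss zero    (suc m) = substq²-one
substq²-gauss (suc k) (suc m) = begin
  substq² (gauss X (suc k) m +P X ^ suc m *P gauss X k (suc m))
    ≡⟨ substq²-+ (gauss X (suc k) m) (X ^ suc m *P gauss X k (suc m)) ⟩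
  substq² (gauss X (suc k) m) +P substq² (X ^ suc m *P gauss X k (suc m))
    ≈⟨ PolyRing.+-cong (substq²-gauss (suc k) m) (PolyRing.trans (substq²-* (X ^ suc m) (gauss X k (suc m)))
         (PolyRing.*-cong (substq²-^ (suc m)) (substq²-gauss k (suc m)))) ⟩
  gauss Q (suc k) m +P Q ^ suc m *P gauss Q k (suc m) ∎

qbin2-gauss : ∀ k m → qbin2 (k ℕ.+ m) m ≋ gauss Q k m
qbin2-gauss k m = PolyRing.trans (substq²-cong (qbin-gauss k m)) (substq²-gauss k m)

-- Bridges the lower indices: the summand j = 0 contains [an, an-bn], whereas the theorem speaks of
-- [an, bn].
qbin2-gauss′ : ∀ k m → qbin2 (m ℕ.+ k) m ≋ gauss Q m k
qbin2-gauss′ k m = PolyRing.trans (PolyRing.reflexive (≡.cong (λ n → qbin2 n m) (ℕₚ.+-comm m k)))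
  (PolyRing.trans (substq²-cong (PolyRing.trans (qbin-gauss k m) (gauss-symmetric k m))) (substq²-gauss m k))

-- Closed form of ϑ_n

open RogersSchur polyRing X using (schur; schur-values; theta)
open Alternating polyRing using (sign)

sgn-sign : ∀ m → sgn m ∷ [] ≋ sign m
sgn-sign zero    = PolyRing.refl
sgn-sign (suc m) = PolyRing.-‿cong (sgn-sign m)

private
  values = schur-values (λ {x} {y} → Monic-cancel X x y Monic-X)

  schur₀ : ∀ m → schur (m ℕ.* 3) ≋ sign m *P X ^ pentagonal m
  schur₀ m = proj₁ (values m)
  schur₁ : ∀ m → schur (1 ℕ.+ m ℕ.* 3) ≋ sign m *P X ^ (pentagonal m ℕ.+ m)
  schur₁ m = proj₁ (proj₂ (values m))
  schur₂ : ∀ m → schur (2 ℕ.+ m ℕ.* 3) ≋ []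
  schur₂ m = proj₁ (proj₂ (proj₂ (values m)))

-- Here both S_n and S_{n-2} are nonzero, whence the factor 1 + q^{2m} of ϑ_{3m}; in the other two
-- residue classes one of the two sums vanishes.
theta₀ : ∀ m → theta (suc m ℕ.* 3) ≋ sign (suc m) *P (oneP +P powP X (2 ℕ.* suc m)) *P X ^ (pentagonal m ℕ.+ m)
theta₀ m = begin
  X *P schur (suc m ℕ.* 3) -P schur (1 ℕ.+ m ℕ.* 3)
    ≈⟨ PolyRing.+-cong (PolyRing.*-cong (PolyRing.refl {X}) (schur₀ (suc m))) (PolyRing.-‿cong (schur₁ m)) ⟩
  X *P (negP σ *P X ^ pentagonal (suc m)) -P σ *P e
    ≈⟨ PolyRing.+-cong (PolyRing.trans (solve 3 (λ x σ y → x :* (:- σ :* y) := :- σ :* (x :* y)) PolyRing.refl X σ (X ^ pentagonal (suc m)))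
         (PolyRing.*-cong (PolyRing.refl {negP σ}) power)) (PolyRing.refl {negP (σ *P e)}) ⟩
  negP σ *P (powP X (2 ℕ.* suc m) *P e) -P σ *P e
    ≈⟨ solve 3 (λ σ x e → :- σ :* (x :* e) :- σ :* e := :- σ :* (con (+ 1) :+ x) :* e) PolyRing.refl σ (powP X (2 ℕ.* suc m)) e ⟩
  negP σ *P (oneP +P powP X (2 ℕ.* suc m)) *P e ∎
  where
  σ = sign m
  e = X ^ (pentagonal m ℕ.+ m)
  power : X *P X ^ pentagonal (suc m) ≋ powP X (2 ℕ.* suc m) *P e
  power = begin
    X ^ suc (pentagonal m ℕ.+ suc (m ℕ.* 3))       ≡⟨ ≡.cong (X ^_) (lemma (pentagonal m) m) ⟩
    X ^ (2 ℕ.* suc m ℕ.+ (pentagonal m ℕ.+ m))     ≈⟨ ^-homo-* X (2 ℕ.* suc m) (pentagonal m ℕ.+ m) ⟩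
    X ^ (2 ℕ.* suc m) *P e                         ≡⟨ ≡.cong (_*P e) (powP≡^ X (2 ℕ.* suc m)) ⟨
    powP X (2 ℕ.* suc m) *P e                      ∎
    where
    lemma : ∀ p m → suc (p ℕ.+ suc (m ℕ.* 3)) ≡ 2 ℕ.* suc m ℕ.+ (p ℕ.+ m)
    lemma = ℕ-Solver.solve-∀

theta₁ : ∀ m → theta (1 ℕ.+ m ℕ.* 3) ≋ sign m *P X ^ (pentagonal m ℕ.+ m) *P X
theta₁ zero    = PolyRing.trans (PolyRing.*-comm X (schur 1)) (PolyRing.*-cong (schur₁ 0) (PolyRing.refl {X}))
theta₁ (suc m) = begin
  X *P schur (1 ℕ.+ suc m ℕ.* 3) -P schur (2 ℕ.+ m ℕ.* 3)
    ≈⟨ PolyRing.+-cong (PolyRing.*-cong (PolyRing.refl {X}) (schur₁ (suc m))) (PolyRing.-‿cong (schur₂ m)) ⟩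
  X *P y -P []   ≈⟨ solve 2 (λ x y → x :* y :- con (+ 0) := y :* x) PolyRing.refl X y ⟩
  y *P X         ∎
  where y = sign (suc m) *P X ^ (pentagonal (suc m) ℕ.+ suc m)

theta₂ : ∀ m → theta (2 ℕ.+ m ℕ.* 3) ≋ negP (sign m) *P X ^ pentagonal m
theta₂ m = begin
  X *P schur (2 ℕ.+ m ℕ.* 3) -P schur (m ℕ.* 3)
    ≈⟨ PolyRing.+-cong (PolyRing.*-cong (PolyRing.refl {X}) (schur₂ m)) (PolyRing.-‿cong (schur₀ m)) ⟩
  X *P [] -P sign m *P X ^ pentagonal m
    ≈⟨ solve 3 (λ x σ y → x :* con (+ 0) :- σ :* y := :- σ :* y) PolyRing.refl X (sign m) (X ^ pentagonal m) ⟩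
  negP (sign m) *P X ^ pentagonal m ∎

-- At m + 1 the factor 3m - 1 becomes 3m + 2, so the formula needs no subtraction.
pentagonal-double : ∀ m → pentagonal (suc m) ℕ.* 2 ≡ suc m ℕ.* (3 ℕ.* m ℕ.+ 2)
pentagonal-double zero    = ≡.refl
pentagonal-double (suc m) = ≡.trans (lemma₁ (pentagonal (suc m)) m)
  (≡.trans (≡.cong (ℕ._+ 2 ℕ.* suc (suc m ℕ.* 3)) (pentagonal-double m)) (lemma₂ m))
  where
  lemma₁ : ∀ p m → (p ℕ.+ suc (suc m ℕ.* 3)) ℕ.* 2 ≡ p ℕ.* 2 ℕ.+ 2 ℕ.* suc (suc m ℕ.* 3)
  lemma₁ = ℕ-Solver.solve-∀
  lemma₂ : ∀ m → suc m ℕ.* (3 ℕ.* m ℕ.+ 2) ℕ.+ 2 ℕ.* suc (suc m ℕ.* 3) ≡ suc (suc m) ℕ.* (3 ℕ.* suc m ℕ.+ 2)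
  lemma₂ = ℕ-Solver.solve-∀

half : ∀ e {z} → z ≡ + (e ℕ.* 2) → z /ℕ 2 ≡ + e
half e ≡.refl = ≡.cong +_ (ℕ/.m*n/n≡m e 2)

infix 4 _represents_
-- q ϑ = z, for ϑ a Laurent polynomial
_represents_ : LPoly → Poly → Set
(p , s) represents z = z *P powP X s ≋ p *P X

private
  -- Begins with ϑ_6: for ϑ_3 the exponent is -1, which is no natural number and is left to
  -- computation in `represents₀`.
  exponent₀ : ∀ m → (+ (2 ℕ.+ m) ℤ.* (+ (3 ℕ.* (2 ℕ.+ m)) ℤ.- + 5)) /ℕ 2 ≡ + (pentagonal (suc m) ℕ.+ m)
  exponent₀ m = half (pentagonal (suc m) ℕ.+ m) (≡.trans (≡.cong (+ (2 ℕ.+ m) ℤ.*_) difference)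
    (≡.trans (≡.sym (ℤₚ.pos-* (2 ℕ.+ m) (suc (3 ℕ.* m)))) (≡.cong +_ (≡.sym doubled))))
    where
    lemma₁ : ∀ m → 3 ℕ.* (2 ℕ.+ m) ≡ suc (3 ℕ.* m) ℕ.+ 5
    lemma₁ = ℕ-Solver.solve-∀
    lemma₂ : ∀ p m → (p ℕ.+ m) ℕ.* 2 ≡ p ℕ.* 2 ℕ.+ m ℕ.* 2
    lemma₂ = ℕ-Solver.solve-∀
    lemma₃ : ∀ m → suc m ℕ.* (3 ℕ.* m ℕ.+ 2) ℕ.+ m ℕ.* 2 ≡ (2 ℕ.+ m) ℕ.* suc (3 ℕ.* m)
    lemma₃ = ℕ-Solver.solve-∀
    difference : + (3 ℕ.* (2 ℕ.+ m)) ℤ.- + 5 ≡ + suc (3 ℕ.* m)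
    difference = ≡.trans (≡.cong (λ k → + k ℤ.- + 5) (lemma₁ m))
      (≡.trans (ℤₚ.[+m]-[+n]≡m⊖n (suc (3 ℕ.* m) ℕ.+ 5) 5)
        (≡.trans (ℤₚ.⊖-≥ (ℕₚ.m≤n+m 5 (suc (3 ℕ.* m)))) (≡.cong +_ (ℕₚ.m+n∸n≡m (suc (3 ℕ.* m)) 5))))
    doubled : (pentagonal (suc m) ℕ.+ m) ℕ.* 2 ≡ (2 ℕ.+ m) ℕ.* suc (3 ℕ.* m)
    doubled = ≡.trans (lemma₂ (pentagonal (suc m)) m) (≡.trans (≡.cong (ℕ._+ m ℕ.* 2) (pentagonal-double m)) (lemma₃ m))

  exponent₁ : ∀ m → (+ m ℤ.* + (3 ℕ.* m ℕ.+ 1)) /ℕ 2 ≡ + (pentagonal m ℕ.+ m)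
  exponent₁ m = half (pentagonal m ℕ.+ m) (≡.trans (≡.sym (ℤₚ.pos-* m (3 ℕ.* m ℕ.+ 1))) (≡.cong +_ (≡.sym (doubled m))))
    where
    lemma₂ : ∀ p m → (p ℕ.+ m) ℕ.* 2 ≡ p ℕ.* 2 ℕ.+ m ℕ.* 2
    lemma₂ = ℕ-Solver.solve-∀
    lemma₃ : ∀ m → suc m ℕ.* (3 ℕ.* m ℕ.+ 2) ℕ.+ suc m ℕ.* 2 ≡ suc m ℕ.* (3 ℕ.* suc m ℕ.+ 1)
    lemma₃ = ℕ-Solver.solve-∀
    doubled : ∀ m → (pentagonal m ℕ.+ m) ℕ.* 2 ≡ m ℕ.* (3 ℕ.* m ℕ.+ 1)
    doubled zero    = ≡.refl
    doubled (suc m) = ≡.trans (lemma₂ (pentagonal (suc m)) (suc m))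
      (≡.trans (≡.cong (ℕ._+ suc m ℕ.* 2) (pentagonal-double m)) (lemma₃ m))

  exponent₂ : ∀ m → ((+ suc m ℤ.- + 1) ℤ.* + (3 ℕ.* suc m ℕ.+ 2)) /ℕ 2 ≡ + (pentagonal m ℕ.+ m ℕ.* 3)
  exponent₂ m = half e (≡.trans (≡.sym (ℤₚ.pos-* m (3 ℕ.* suc m ℕ.+ 2))) (≡.cong +_ (≡.sym doubled)))
    where
    e = pentagonal m ℕ.+ m ℕ.* 3
    lemma : ∀ m → suc m ℕ.* (3 ℕ.* m ℕ.+ 2) ≡ 2 ℕ.+ m ℕ.* (3 ℕ.* suc m ℕ.+ 2)
    lemma = ℕ-Solver.solve-∀
    doubled : e ℕ.* 2 ≡ m ℕ.* (3 ℕ.* suc m ℕ.+ 2)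
    doubled = ℕₚ.suc-injective (ℕₚ.suc-injective (≡.trans (≡.cong (ℕ._* 2) (≡.sym (ℕₚ.+-suc (pentagonal m) (m ℕ.* 3))))
      (≡.trans (pentagonal-double m) (lemma m))))

-- The branches of `ϑ` for a free variable `m`, so that cases on `m` are possible without touching
-- `n`.
ϑ₀ ϑ₁ ϑ₂ : ℕ → LPoly
ϑ₀ m = constL (sgn m) *L toL (oneP +P powP X (2 ℕ.* m)) *L qpowZ ((+ m ℤ.* (+ (3 ℕ.* m) ℤ.- + 5)) /ℕ 2)
ϑ₁ m = constL (sgn m) *L qpowZ ((+ m ℤ.* + (3 ℕ.* m ℕ.+ 1)) /ℕ 2)
ϑ₂ m = constL (ℤ.- sgn m) *L qpowZ (((+ m ℤ.- + 1) ℤ.* + (3 ℕ.* m ℕ.+ 2)) /ℕ 2)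

represents₀ : ∀ m → 0 ℕ.< m → ϑ₀ m represents theta (m ℕ.* 3)
-- For n = 3, `qpowZ` returns 1/q, and the denominator appears as `powP X 1` on the left; n = 2 is
-- handled likewise in `represents₂`.
represents₀ (suc zero) _ = begin
  theta 3 *P powP X 1                 ≈⟨ PolyRing.*-cong (theta₀ 0) (PolyRing.refl {powP X 1}) ⟩
  negP oneP *P s *P oneP *P powP X 1  ≈⟨ solve 2 (λ s x → :- con (+ 1) :* s :* con (+ 1) :* (x :* con (+ 1)) := :- con (+ 1) :* s :* con (+ 1) :* x) PolyRing.refl s X ⟩
  (sgn 1 ∷ []) *P s *P oneP *P X      ∎
  where s = oneP +P powP X 2
represents₀ (suc (suc m)) _ = ≡.subst (λ z → constL (sgn (2 ℕ.+ m)) *L toL s *L qpowZ z represents theta (suc (suc m) ℕ.* 3))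
  (≡.sym (exponent₀ m)) (begin
    theta (suc (suc m) ℕ.* 3) *P oneP
      ≈⟨ PolyRing.*-identityʳ (theta (suc (suc m) ℕ.* 3)) ⟩
    theta (suc (suc m) ℕ.* 3)
      ≈⟨ theta₀ (suc m) ⟩
    sign (2 ℕ.+ m) *P s *P X ^ (pentagonal (suc m) ℕ.+ suc m)
      ≈⟨ PolyRing.*-cong (PolyRing.*-cong (PolyRing.sym (sgn-sign (2 ℕ.+ m))) (PolyRing.refl {s}))
           (PolyRing.reflexive (≡.trans (≡.cong (X ^_) (ℕₚ.+-suc (pentagonal (suc m)) m)) (≡.cong (X *P_) (≡.sym (powP≡^ X e))))) ⟩
    (sgn (2 ℕ.+ m) ∷ []) *P s *P (X *P powP X e)
      ≈⟨ solve 3 (λ a x y → a :* (x :* y) := a :* y :* x) PolyRing.refl ((sgn (2 ℕ.+ m) ∷ []) *P s) X (powP X e) ⟩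
    (sgn (2 ℕ.+ m) ∷ []) *P s *P powP X e *P X ∎)
  where
  s = oneP +P powP X (2 ℕ.* (2 ℕ.+ m))
  e = pentagonal (suc m) ℕ.+ m

represents₁ : ∀ m → ϑ₁ m represents theta (1 ℕ.+ m ℕ.* 3)
represents₁ m = ≡.subst (λ z → constL (sgn m) *L qpowZ z represents theta (1 ℕ.+ m ℕ.* 3)) (≡.sym (exponent₁ m)) (begin
  theta (1 ℕ.+ m ℕ.* 3) *P oneP                   ≈⟨ PolyRing.*-identityʳ (theta (1 ℕ.+ m ℕ.* 3)) ⟩
  theta (1 ℕ.+ m ℕ.* 3)                           ≈⟨ theta₁ m ⟩
  sign m *P X ^ (pentagonal m ℕ.+ m) *P X         ≈⟨ PolyRing.*-cong (PolyRing.*-cong (PolyRing.sym (sgn-sign m))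
                                                       (PolyRing.reflexive (≡.sym (powP≡^ X (pentagonal m ℕ.+ m))))) (PolyRing.refl {X}) ⟩
  (sgn m ∷ []) *P powP X (pentagonal m ℕ.+ m) *P X ∎)

represents₂ : ∀ m → ϑ₂ m represents theta (2 ℕ.+ m ℕ.* 3)
represents₂ zero = begin
  theta 2 *P powP X 1             ≈⟨ PolyRing.*-cong (theta₂ 0) (PolyRing.refl {powP X 1}) ⟩
  negP oneP *P oneP *P powP X 1   ≈⟨ solve 1 (λ x → :- con (+ 1) :* con (+ 1) :* (x :* con (+ 1)) := :- con (+ 1) :* con (+ 1) :* x) PolyRing.refl X ⟩
  negP oneP *P oneP *P X          ∎
represents₂ (suc m) = ≡.subst (λ z → constL (ℤ.- sgn (suc m)) *L qpowZ z represents theta (2 ℕ.+ suc m ℕ.* 3)) (≡.sym (exponent₂ m)) (begin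
  theta (2 ℕ.+ suc m ℕ.* 3) *P oneP                  ≈⟨ PolyRing.*-identityʳ (theta (2 ℕ.+ suc m ℕ.* 3)) ⟩
  theta (2 ℕ.+ suc m ℕ.* 3)                          ≈⟨ theta₂ (suc m) ⟩
  negP (sign (suc m)) *P X ^ pentagonal (suc m)      ≈⟨ PolyRing.*-cong (PolyRing.-‿cong (PolyRing.sym (sgn-sign (suc m))))
                                                          (PolyRing.reflexive (≡.trans (≡.cong (X ^_) (ℕₚ.+-suc (pentagonal m) (m ℕ.* 3))) (≡.cong (X *P_) (≡.sym (powP≡^ X e))))) ⟩
  ((ℤ.- sgn (suc m)) ∷ []) *P (X *P powP X e)        ≈⟨ solve 3 (λ a x y → a :* (x :* y) := a :* y :* x) PolyRing.refl ((ℤ.- sgn (suc m)) ∷ []) X (powP X e) ⟩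
  ((ℤ.- sgn (suc m)) ∷ []) *P powP X e *P X          ∎)
  where e = pentagonal m ℕ.+ m ℕ.* 3

ϑ-represents-theta : ∀ n → 0 ℕ.< n → ϑ n represents theta n
ϑ-represents-theta n 0<n with n ℕ/.% 3 in r≡ | ℕ/.m≡m%n+[m/n]*n n 3 | ℕ/.m%n<n n 3
... | 0 | n≡ | _ = ≡.subst (λ k → ϑ₀ (n ℕ/./ 3) represents theta k) (≡.sym n≡) (represents₀ (n ℕ/./ 3) (positive (n ℕ/./ 3) n≡))
  where
  positive : ∀ m → n ≡ m ℕ.* 3 → 0 ℕ.< m
  positive zero    ≡.refl = ⊥-elim (ℕₚ.n≮n 0 0<n)
  positive (suc m) _      = ℕ.s≤s ℕ.z≤n
... | 1 | n≡ | _ = ≡.subst (λ k → ϑ₁ (n ℕ/./ 3) represents theta k) (≡.sym n≡) (represents₁ (n ℕ/./ 3))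
... | 2 | n≡ | _ = ≡.subst (λ k → ϑ₂ (n ℕ/./ 3) represents theta k) (≡.sym n≡) (represents₂ (n ℕ/./ 3))
... | suc (suc (suc r)) | _ | r<3 = ⊥-elim (ℕₚ.m+n≮m 3 r r<3)

open import Data.Nat using (_*_; _<_)

open Alternating polyRing using (sum; sum-cong)

-- The congruence for T₁′

sumP-applyUpTo : ∀ L f → sumP (applyUpTo f L) ≡ sum L f
sumP-applyUpTo zero    f = ≡.refl
sumP-applyUpTo (suc L) f = ≡.cong (f 0 +P_) (sumP-applyUpTo L (f ∘ suc))

-- The square of φ Z = X^{n+1} - 1 is 1 modulo X; explicitly, its sum with X u is 1 for the `u`
-- below. A common divisor of X and φ² therefore divides 1.
coprime-X : ∀ n → CoprimeP X (Φ (suc n) *P Φ (suc n))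
coprime-X n D (E , DE≈X) (F , DF≈Φ²) = unit-constant D (F *P (Z *P Z) +P E *P u) (begin
    D *P (F *P (Z *P Z) +P E *P u)
      ≈⟨ solve 5 (λ D F Z E u → D :* (F :* Z :+ E :* u) := D :* F :* Z :+ D :* E :* u)
           PolyRing.refl D F (Z *P Z) E u ⟩
    D *P F *P (Z *P Z) +P D *P E *P u
      ≈⟨ PolyRing.+-cong (PolyRing.*-cong DF≋φ² (PolyRing.refl {Z *P Z}))
           (PolyRing.*-cong DE≋X (PolyRing.refl {u})) ⟩
    φ *P φ *P (Z *P Z) +P X *P u
      ≈⟨ PolyRing.+-cong (solve 2 (λ φ Z → φ :* φ :* (Z :* Z) := φ :* Z :* (φ :* Z)) PolyRing.refl φ Z) (PolyRing.refl {X *P u}) ⟩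
    φ *P Z *P (φ *P Z) +P X *P u
      ≈⟨ PolyRing.+-cong (PolyRing.*-cong φZ φZ) (PolyRing.refl {X *P u}) ⟩
    [ X ^ suc n -1] *P [ X ^ suc n -1] +P X *P u
      ≈⟨ solve 2 (λ x y → (x :* y :- con (+ 1)) :* (x :* y :- con (+ 1)) :+ x :* (y :+ y :- x :* y :* y) := con (+ 1))
           PolyRing.refl X (X ^ n) ⟩
    oneP ∎)
  where
  φ = Φ (suc n)
  Z = _∣_.cofactor (Cyclotomic.Φ-∣-bracket (cyclotomic-all n))
  φZ = _∣_.equation (Cyclotomic.Φ-∣-bracket (cyclotomic-all n))
  DF≋φ² : D *P F ≋ φ *P φ
  DF≋φ² = coefficientwise DF≈Φ²
  DE≋X : D *P E ≋ X
  DE≋X = coefficientwise DE≈X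
  u = X ^ n +P X ^ n -P X *P X ^ n *P X ^ n

module _ (a b n h : ℕ) (an≡ : a * n ≡ b * n ℕ.+ h) (L≤h : n ℕ/./ 2 ℕ.≤ h) where
  private
    L = n ℕ/./ 2
    B = b * n

    term : ℕ → ℕ → Poly
    term hi k = negqPow k *P qbin2 (a * n) k *P qbin (2 * (a * n) ∸ 2 * k) (hi ∸ k)

    hi≡h : a * n ∸ b * n ≡ h
    hi≡h = ≡.trans (≡.cong (_∸ b * n) an≡) (ℕₚ.m+n∸m≡n (b * n) h)

  -- This is t_j. The first index of `gauss` is the upper minus the lower entry: an - k = B + j and
  -- (2an - 2k) - j = 2B + j for k = h - j.
  coefficient : ℕ → Poly
  coefficient j = gauss Q (B ℕ.+ j) (h ∸ j) *P gauss X (B ℕ.+ B ℕ.+ j) j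

  term-coefficient : ∀ j → j ℕ.≤ h → term h (h ∸ j) ≋ negP X ^ (h ∸ j) *P coefficient j
  term-coefficient j j≤h = begin
    negqPow k *P qbin2 (a * n) k *P qbin (2 * (a * n) ∸ 2 * k) (h ∸ k)
      ≡⟨ ≡.cong₂ (λ p m → p *P qbin2 (a * n) k *P m) (powP≡^ (negP X) k) (≡.cong₂ qbin top (ℕₚ.m∸[m∸n]≡n j≤h)) ⟩
    negP X ^ k *P qbin2 (a * n) k *P qbin (B ℕ.+ B ℕ.+ j ℕ.+ j) j
      ≈⟨ PolyRing.*-cong (PolyRing.*-cong (PolyRing.refl {negP X ^ k})
           (PolyRing.trans (PolyRing.reflexive (≡.cong (λ N → qbin2 N k) an≡′)) (qbin2-gauss (B ℕ.+ j) k)))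
           (qbin-gauss (B ℕ.+ B ℕ.+ j) j) ⟩
    negP X ^ k *P gauss Q (B ℕ.+ j) k *P gauss X (B ℕ.+ B ℕ.+ j) j
      ≈⟨ PolyRing.*-assoc (negP X ^ k) (gauss Q (B ℕ.+ j) k) (gauss X (B ℕ.+ B ℕ.+ j) j) ⟩
    negP X ^ k *P coefficient j ∎
    where
    k = h ∸ j
    an≡′ : a * n ≡ B ℕ.+ j ℕ.+ k
    an≡′ = ≡.trans an≡ (≡.trans (≡.cong (B ℕ.+_) (≡.sym (ℕₚ.m+[n∸m]≡n j≤h))) (≡.sym (ℕₚ.+-assoc B j k)))
    top : 2 * (a * n) ∸ 2 * k ≡ B ℕ.+ B ℕ.+ j ℕ.+ j
    top = ≡.trans (≡.sym (ℕₚ.*-distribˡ-∸ 2 (a * n) k))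
      (≡.trans (≡.cong (λ m → 2 * (m ∸ k)) an≡′) (≡.trans (≡.cong (2 *_) (ℕₚ.m+n∸n≡m (B ℕ.+ j) k)) (lemma B j)))
      where
      lemma : ∀ B j → 2 * (B ℕ.+ j) ≡ B ℕ.+ B ℕ.+ j ℕ.+ j
      lemma = ℕ-Solver.solve-∀

  -- As ⌊n/2⌋ ≤ h, the truncated lower limit is the true one and the range has ⌊n/2⌋ + 1 elements.
  -- The order is reversed because j = h - k runs downwards as k grows.
  T1'-sum : T1' a b n ≋ sum (suc L) (λ j → negP X ^ (h ∸ j) *P coefficient j)
  T1'-sum = begin
    T1' a b n
      ≡⟨ ≡.cong (λ hi → sumP (map (λ i → term hi (hi ∸ L ℕ.+ i)) (upTo (suc (hi ∸ (hi ∸ L)))))) hi≡h ⟩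
    sumP (map f (upTo (suc (h ∸ (h ∸ L)))))
      ≡⟨ ≡.cong (λ k → sumP (map f (upTo (suc k)))) (ℕₚ.m∸[m∸n]≡n L≤h) ⟩
    sumP (map f (upTo (suc L)))
      ≡⟨ ≡.cong sumP (Listₚ.map-upTo f (suc L)) ⟩
    sumP (applyUpTo f (suc L))
      ≡⟨ sumP-applyUpTo (suc L) f ⟩
    sum (suc L) f
      ≈⟨ sum-cong (suc L) {f} {λ i → w (L ∸ i)} reindex ⟩
    sum (suc L) (λ i → w (L ∸ i))
      ≈⟨ Alternating.sum-reverse polyRing L w ⟩
    sum (suc L) w ∎
    where
    f w : ℕ → Poly
    f i = term h (h ∸ L ℕ.+ i)
    w j = negP X ^ (h ∸ j) *P coefficient j
    index : ∀ i → i ℕ.≤ L → h ∸ L ℕ.+ i ≡ h ∸ (L ∸ i)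
    index i i≤L = ≡.trans (≡.sym (ℕₚ.m+n∸n≡m (h ∸ L ℕ.+ i) (L ∸ i))) (≡.cong (_∸ (L ∸ i))
      (≡.trans (ℕₚ.+-assoc (h ∸ L) i (L ∸ i)) (≡.trans (≡.cong (h ∸ L ℕ.+_) (ℕₚ.m+[n∸m]≡n i≤L)) (ℕₚ.m∸n+n≡m L≤h))))
    reindex : ∀ i → i < suc L → f i ≋ w (L ∸ i)
    reindex i i<L = PolyRing.trans (PolyRing.reflexive (≡.cong (term h) (index i (ℕ.s≤s⁻¹ i<L))))
      (term-coefficient (L ∸ i) (ℕₚ.≤-trans (ℕₚ.m∸n≤m L i) L≤h))

rising-⊥ : ∀ {f} p k m → (∀ i → i < m → f ⊥ [ p ^ suc (k ℕ.+ i) -1]) → f ⊥ rising p k m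
rising-⊥ {f} p k zero    coprime = ⊥-oneʳ f
rising-⊥ {f} p k (suc m) coprime = ⊥-*ʳ (rising-⊥ p k m (λ i i<m → coprime i (ℕₚ.m<n⇒m<1+n i<m))) (coprime m ℕₚ.≤-refl)

module _ (n₀ b c : ℕ) where
  private
    n = suc n₀
    φ = Φ n
    D = φ *P φ
    B = b * n
    h = c * n
    open Quotient polyRing D using (_~_; congruent)
    module S = Supercongruence polyRing X n

    Φ-⊥ : ∀ k → ¬ n ℕ∣.∣ k → φ ⊥ [ X ^ k -1]
    Φ-⊥ k n∤k = ⊥-sym (bracket-⊥-Φ (λ {m} _ → cyclotomic-all m) k n∤k)

  -- Φ_n divides q^n - 1, so `summand-congruence` makes Φ_n² divide U (t - v). Coprimality removes U
  -- at the cost of an integer, and monicity of Φ_n² removes the integer.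
  coefficient-congruence : ∀ l m r → m ℕ.+ suc l ≡ h → suc l ℕ.+ suc l ℕ.+ r ≡ n →
    gauss Q (suc (B ℕ.+ l)) m *P gauss X (B ℕ.+ B ℕ.+ suc l) (suc l)
      ~ gauss Q B h *P natural (c ℕ.+ c) *P
          (X ^ triangle (suc l) *P (X ^ suc l *P gauss X r (suc l) +P gauss X r l))
  coefficient-congruence l m r m≡ n≡ = congruent (_∣_.cofactor divides-difference) (begin
    t                          ≈⟨ solve 2 (λ t v → t := v :+ (t :- v)) PolyRing.refl t v ⟩
    v +P (t -P v)              ≈⟨ PolyRing.+-cong (PolyRing.refl {v}) (_∣_.equation divides-difference) ⟨
    v +P D *P _∣_.cofactor divides-difference ∎)
    where
    j = suc l
    t = gauss Q (suc (B ℕ.+ l)) m *P gauss X (B ℕ.+ B ℕ.+ j) j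
    v = gauss Q B h *P natural (c ℕ.+ c) *P (X ^ triangle j *P (X ^ j *P gauss X r j +P gauss X r l))
    U = qfactorial X j *P rising Q B l
    W = [ X ^ n -1]
    2l<n : ∀ i → i ℕ.≤ l → i ℕ.+ i < n
    2l<n i i≤l = ≡.subst (i ℕ.+ i <_) n≡ (ℕₚ.≤-trans (ℕ.s≤s (ℕₚ.≤-trans (ℕₚ.+-mono-≤ i≤l i≤l) (ℕₚ.+-monoʳ-≤ l (ℕₚ.n≤1+n l)))) (ℕₚ.m≤m+n (j ℕ.+ j) r))
    φ⊥U : φ ⊥ U
    φ⊥U = ⊥-*ʳ
      (rising-⊥ X 0 j (λ i i<j → Φ-⊥ (suc i) (ℕ∣.>⇒∤ (≡.subst (suc i <_) n≡
        (ℕ.s≤s (ℕₚ.≤-trans i<j (ℕₚ.≤-trans (ℕₚ.m≤n+m j l) (ℕₚ.m≤m+n (l ℕ.+ j) r))))))))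
      (rising-⊥ Q B l (λ i i<l → ⊥-∣ʳ (Φ-⊥ (suc (B ℕ.+ i) ℕ.+ suc (B ℕ.+ i)) (not-multiple i i<l))
        (factors oneP (PolyRing.trans (PolyRing.*-identityʳ [ Q ^ suc (B ℕ.+ i) -1]) (S.square-bracket (suc (B ℕ.+ i)))))))
      where
      -- Modulo n the exponent is 2(i+1), which is positive and, since i + 1 ≤ l < j and 2j ≤ n,
      -- smaller than n.
      not-multiple : ∀ i → i < l → ¬ n ℕ∣.∣ suc (B ℕ.+ i) ℕ.+ suc (B ℕ.+ i)
      not-multiple i i<l n∣ = ℕ∣.>⇒∤ (2l<n (suc i) i<l)
        (ℕ∣.∣m+n∣m⇒∣n (≡.subst (n ℕ∣.∣_) (lemma b n i) n∣) (divides (b ℕ.+ b) ≡.refl))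
        where
        lemma : ∀ b n i → suc (b * n ℕ.+ i) ℕ.+ suc (b * n ℕ.+ i) ≡ (b ℕ.+ b) * n ℕ.+ (suc i ℕ.+ suc i)
        lemma = ℕ-Solver.solve-∀
    U⊥D : U ⊥ D
    U⊥D = ⊥-*ʳ (⊥-sym φ⊥U) (⊥-sym φ⊥U)
    φ∣W = Cyclotomic.Φ-∣-bracket (cyclotomic-all n₀)
    E = _∣_.cofactor φ∣W
    K = proj₁ (S.summand-congruence b c l m r m≡ n≡)
    D∣U : D ∣ U *P (t -P v)
    D∣U = factors (E *P E *P K) (begin
      φ *P φ *P (E *P E *P K)    ≈⟨ solve 3 (λ φ E K → φ :* φ :* (E :* E :* K) := φ :* E :* (φ :* E) :* K) PolyRing.refl φ E K ⟩
      φ *P E *P (φ *P E) *P K    ≈⟨ PolyRing.*-cong (PolyRing.*-cong (_∣_.equation φ∣W) (_∣_.equation φ∣W)) (PolyRing.refl {K}) ⟩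
      W *P W *P K                ≈⟨ proj₂ (S.summand-congruence b c l m r m≡ n≡) ⟨
      U *P (t -P v)              ∎)
    φ-monic = Cyclotomic.Φ-monic (cyclotomic-all n₀)
    divides-difference : D ∣ t -P v
    divides-difference = Monic-∣-saturated D (t -P v) (_⊥_.k U⊥D) (Monic-* φ φ φ-monic φ-monic) (⊥-cancel U⊥D D∣U)

clear-denominators : ∀ T C K p s z D P →
  z *P powP X s ≋ p *P X →
  X *P T ≋ C *P (X +P (K ∷ []) *P (z -P X)) +P D *P P →
  toL X *L (toL T -L toL C *L (oneL -L constL K *L (oneL -L (p , s)))) ≈L toL (D *P P)
clear-denominators T C K p s z D P zy≋pX XT≋ = at (begin
  X *P (T *P y +P negP (C *P (oneP *P y +P negP (k *P (oneP *P y +P negP p *P oneP)) *P oneP)) *P oneP) *P oneP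
    ≈⟨ solve 6 (λ x T y C k p → x :* (T :* y :+ :- (C :* (con (+ 1) :* y :+ :- (k :* (con (+ 1) :* y :+ :- p :* con (+ 1))) :* con (+ 1))) :* con (+ 1)) :* con (+ 1)
          := x :* T :* y :- C :* (x :* y :+ k :* (p :* x :- x :* y))) PolyRing.refl X T y C k p ⟩
  X *P T *P y -P C *P (X *P y +P k *P (p *P X -P X *P y))
    ≈⟨ PolyRing.+-cong (PolyRing.*-cong XT≋ (PolyRing.refl {y}))
         (PolyRing.-‿cong (PolyRing.*-cong (PolyRing.refl {C}) (PolyRing.+-cong (PolyRing.refl {X *P y})
           (PolyRing.*-cong (PolyRing.refl {k}) (PolyRing.+-cong (PolyRing.sym zy≋pX) (PolyRing.refl {negP (X *P y)})))))) ⟩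
  (C *P (X +P k *P (z -P X)) +P D *P P) *P y -P C *P (X *P y +P k *P (z *P y -P X *P y))
    ≈⟨ solve 6 (λ x y C k z d → (C :* (x :+ k :* (z :- x)) :+ d) :* y :- C :* (x :* y :+ k :* (z :* y :- x :* y)) := d :* y)
         PolyRing.refl X y C k z (D *P P) ⟩
  D *P P *P y ∎)
  where
  y = powP X s
  k = K ∷ []

theorem1p5 : (a b n : ℕ) → 0 < a → 0 < b → 0 < n → b < a →
    toL (T1' a b n)
      ≡ toL (negqPow (a * n ∸ b * n) *P qbin2 (a * n) (b * n))
          *L (oneL -L constL (+ (2 * (a ∸ b))) *L (oneL -L ϑ n))
      modP (Φ n *P Φ n)
theorem1p5 a b (suc n₀) _ _ 0<n b<a = P , X , coprime-X n₀ ,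
  clear-denominators (T1' a b n) C (+ (2 * c)) (proj₁ (ϑ n)) (proj₂ (ϑ n)) (theta n) D P (ϑ-represents-theta n 0<n) (begin
    X *P T1' a b n                           ≈⟨ PolyRing.*-cong (PolyRing.refl {X}) (T1'-sum a b n h an≡ L≤h) ⟩
    X *P sum (suc L) w                       ≈⟨ Quotient._~_.equation congruence ⟩
    negP X ^ h *P (N *P (X +P natural (c ℕ.+ c) *P (theta n -P X))) +P D *P P
      ≈⟨ PolyRing.+-cong leading (PolyRing.refl {D *P P}) ⟩
    C *P (X +P (+ (2 * c) ∷ []) *P (theta n -P X)) +P D *P P ∎)
  where
  n = suc n₀
  D = Φ n *P Φ n
  c = a ∸ b
  h = c * n
  B = b * n
  L = n ℕ/./ 2
  N = gauss Q B h
  C = negqPow (a * n ∸ b * n) *P qbin2 (a * n) (b * n)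
  an≡ : a * n ≡ B ℕ.+ h
  an≡ = ≡.trans (≡.cong (_* n) (≡.sym (ℕₚ.m+[n∸m]≡n (ℕₚ.<⇒≤ b<a)))) (ℕₚ.*-distribʳ-+ n b c)
  hi≡h : a * n ∸ B ≡ h
  hi≡h = ≡.trans (≡.cong (_∸ B) an≡) (ℕₚ.m+n∸m≡n B h)
  L≤h : L ℕ.≤ h
  L≤h = ℕₚ.≤-trans (ℕ/.m/n≤m n 2) (ℕₚ.≤-trans (ℕₚ.≤-reflexive (≡.sym (ℕₚ.+-identityʳ n))) (ℕₚ.*-monoˡ-≤ n (ℕₚ.m<n⇒0<n∸m b<a)))
  n≡ : n ≡ n ℕ/.% 2 ℕ.+ (L ℕ.+ L)
  n≡ = ≡.trans (ℕ/.m≡m%n+[m/n]*n n 2) (≡.cong (n ℕ/.% 2 ℕ.+_) (lemma L))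
    where
    lemma : ∀ L → L * 2 ≡ L ℕ.+ L
    lemma = ℕ-Solver.solve-∀
  2L≤n : L ℕ.+ L ℕ.≤ n
  2L≤n = ≡.subst (L ℕ.+ L ℕ.≤_) (≡.sym n≡) (ℕₚ.m≤n+m (L ℕ.+ L) (n ℕ/.% 2))
  n<2L+2 : n < suc L ℕ.+ suc L
  n<2L+2 = ≡.subst₂ _<_ (≡.sym n≡) (≡.cong suc (≡.sym (ℕₚ.+-suc L L))) (ℕₚ.+-monoˡ-< (L ℕ.+ L) (ℕ/.m%n<n n 2))
  t w : ℕ → Poly
  t = coefficient a b n h an≡ L≤h
  w j = negP X ^ (h ∸ j) *P t j
  module T = TruncatedSum polyRing X D
  open Quotient polyRing D using (_~_)
  t₀ : t 0 ≋ N
  t₀ = begin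
    gauss Q (B ℕ.+ 0) h *P gauss X (B ℕ.+ B ℕ.+ 0) 0  ≡⟨ ≡.cong (λ k → gauss Q k h *P gauss X (B ℕ.+ B ℕ.+ 0) 0) (ℕₚ.+-identityʳ B) ⟩
    N *P gauss X (B ℕ.+ B ℕ.+ 0) 0                    ≈⟨ PolyRing.*-cong (PolyRing.refl {N}) (gauss-0 (B ℕ.+ B ℕ.+ 0)) ⟩
    N *P oneP                                         ≈⟨ PolyRing.*-identityʳ N ⟩
    N                                                 ∎
    where
    gauss-0 : ∀ k → gauss X k 0 ≋ oneP
    gauss-0 zero    = PolyRing.refl
    gauss-0 (suc k) = PolyRing.refl
  t~ : ∀ l r → suc l ℕ.≤ L → suc l ℕ.+ suc l ℕ.+ r ≡ n →
    t (suc l) ~ N *P natural (c ℕ.+ c) *P (X ^ triangle (suc l) *P (X ^ suc l *P gauss X r (suc l) +P gauss X r l))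
  t~ l r l<L n≡′ = ≡.subst (λ k → gauss Q k (h ∸ suc l) *P gauss X (B ℕ.+ B ℕ.+ suc l) (suc l)
      ~ N *P natural (c ℕ.+ c) *P (X ^ triangle (suc l) *P (X ^ suc l *P gauss X r (suc l) +P gauss X r l)))
    (≡.sym (ℕₚ.+-suc B l))
    (coefficient-congruence n₀ b c l (h ∸ suc l) r (ℕₚ.m∸n+n≡m (ℕₚ.≤-trans l<L L≤h)) n≡′)
  congruence : X *P sum (suc L) w ~ T.value h N (natural (c ℕ.+ c)) t n
  congruence = T.truncated-sum h N (natural (c ℕ.+ c)) t t₀ n L 0<n L≤h 2L≤n n<2L+2 t~
  P = Quotient._~_.factor congruence
  leading : negP X ^ h *P (N *P (X +P natural (c ℕ.+ c) *P (theta n -P X))) ≋ C *P (X +P (+ (2 * c) ∷ []) *P (theta n -P X))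
  leading = begin
    negP X ^ h *P (N *P (X +P natural (c ℕ.+ c) *P z))  ≈⟨ PolyRing.*-assoc (negP X ^ h) N (X +P natural (c ℕ.+ c) *P z) ⟨
    negP X ^ h *P N *P (X +P natural (c ℕ.+ c) *P z)
      ≈⟨ PolyRing.*-cong (PolyRing.*-cong power binomial) (PolyRing.+-cong (PolyRing.refl {X}) (PolyRing.*-cong constant (PolyRing.refl {z}))) ⟩
    C *P (X +P (+ (2 * c) ∷ []) *P z) ∎
    where
    z = theta n -P X
    power : negP X ^ h ≋ negqPow (a * n ∸ b * n)
    power = PolyRing.reflexive (≡.trans (≡.cong (negP X ^_) (≡.sym hi≡h)) (≡.sym (powP≡^ (negP X) (a * n ∸ b * n))))
    binomial : N ≋ qbin2 (a * n) (b * n)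
    binomial = PolyRing.trans (PolyRing.sym (qbin2-gauss′ h B)) (PolyRing.reflexive (≡.cong (λ m → qbin2 m B) (≡.sym an≡)))
    constant : natural (c ℕ.+ c) ≋ + (2 * c) ∷ []
    constant = PolyRing.trans (natural-constant (c ℕ.+ c)) (PolyRing.reflexive (≡.cong (λ k → + k ∷ []) (≡.cong (c ℕ.+_) (≡.sym (ℕₚ.+-identityʳ c)))))
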